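{- The number of subgroup classes of abelian groups of order at most $x$ is asymptotic, as $x\to\infty$, to $C\,x\log x$, where $C$ is a constant. That is, there is a constant $C$ with $$\sum_{n\le x}A(n)\sim C\,x\log x\qquad(x\to\infty).$$
   Context: For a finite abelian group $G$, the number of subgroup classes of $G$ is the number of isomorphism classes of groups $H$ that are isomorphic to a subgroup of $G$ (isomorphic subgroups are counted once). $A(n)$ is the sum, over isomorphism classes of abelian groups $G$ of order $n$ (of arbitrary rank), of the number of subgroup classes of $G$. -}

module Defs where

open import Algebra.Bundles using (AbelianGroup)
import Algebra.Morphism.GroupMonomorphism as GroupMono
open import Algebra.Morphism.Structures using (module GroupMorphisms)
open import Algebra.Structures using (IsAbelianGroup)
open import Data.Fin.Base using (Fin; finToFun; funToFin)
open import Data.Fin.Properties using (any?; all?; finToFun-funToFin)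
  renaming (_≟_ to _≟ᶠ_)
open import Data.Fin.Subset using (Subset; _∈_)
open import Data.Fin.Subset.Properties using (_∈?_; anySubset?)
open import Data.Integer.Base as ℤ using (+_)
import Data.Integer.Properties as ℤ
open import Data.List.Base
  using (List; map; length; filter; deduplicate; upTo; allFin; mapMaybe; cartesianProduct)
import Data.Maybe.Base as Maybe
open import Data.Nat.Base as ℕ using (ℕ; zero; suc)
open import Data.Nat.ListAction using (sum)
import Data.Nat.Properties as ℕ
open import Data.Product using (Σ; ∃; _×_; _,_; proj₁; proj₂)
open import Data.Rational.Base
open import Data.Rational.Properties
open import Data.Rational.Solver using (module +-*-Solver)
import Data.Rational.Unnormalised.Base as ℚᵘ
import Data.Rational.Unnormalised.Properties as ℚᵘ
open import Data.Sum.Base using (inj₁; inj₂)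
open import Function.Base using (_∘_)
open import Level using (0ℓ)
open import Relation.Binary.PropositionalEquality
  using (_≡_; refl; sym; trans; cong; cong₂; subst; subst₂; isEquivalence; _≗_)
open import Relation.Nullary.Decidable using (Dec; map′; _×-dec_; _→-dec_; dec⇒maybe)
open +-*-Solver using (solve; _:=_; _:+_; _:*_; _:-_; :-_; con)

infix 4 _≅_

_≅_ : AbelianGroup 0ℓ 0ℓ → AbelianGroup 0ℓ 0ℓ → Set
G ≅ H = ∃ IsGroupIsomorphism
  where open GroupMorphisms (AbelianGroup.rawGroup G) (AbelianGroup.rawGroup H)

-- Abelian groups with underlying set Fin n; every abelian group of order n
-- is isomorphic to one of these.
record AbelianGroupOn (n : ℕ) : Set where
  field
    _∙_            : Fin n → Fin n → Fin n
    ε              : Fin n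
    _⁻¹            : Fin n → Fin n
    isAbelianGroup : IsAbelianGroup _≡_ _∙_ ε _⁻¹

  abelianGroup : AbelianGroup 0ℓ 0ℓ
  abelianGroup = record { isAbelianGroup = isAbelianGroup }

open AbelianGroupOn using (abelianGroup)

module _ {n : ℕ} (G : AbelianGroupOn n) where
  open AbelianGroupOn G hiding (abelianGroup)

  record IsSubgroup (S : Subset n) : Set where
    field
      ε-closed  : ε ∈ S
      ∙-closed  : ∀ x y → x ∈ S → y ∈ S → (x ∙ y) ∈ S
      ⁻¹-closed : ∀ x → x ∈ S → (x ⁻¹) ∈ S

  subgroup : (S : Subset n) → IsSubgroup S → AbelianGroup 0ℓ 0ℓ
  subgroup S S≤G = record
    { Carrier        = ∃ (_∈ S)
    ; _≈_            = λ a b → proj₁ a ≡ proj₁ b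
    ; _∙_            = λ a b → proj₁ a ∙ proj₁ b ,
                               ∙-closed (proj₁ a) (proj₁ b) (proj₂ a) (proj₂ b)
    ; ε              = ε , ε-closed
    ; _⁻¹            = λ a → proj₁ a ⁻¹ , ⁻¹-closed (proj₁ a) (proj₂ a)
    ; isAbelianGroup = GroupMono.isAbelianGroup inclusion isAbelianGroup
    }
    where
    open IsSubgroup S≤G
    inclusion = record
      { isGroupHomomorphism = record
        { isMonoidHomomorphism = record
          { isMagmaHomomorphism = record
            { isRelHomomorphism = record { cong = λ eq → eq }
            ; homo              = λ _ _ → refl
            }
          ; ε-homo = refl
          }
        ; ⁻¹-homo = λ _ → refl
        }
      ; injective = λ eq → eq
      }

infix 4 _≲_

-- H is isomorphic to a subgroup of G.
_≲_ : ∀ {m n} → AbelianGroupOn m → AbelianGroupOn n → Set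
H ≲ G = ∃ λ S → Σ (IsSubgroup G S) λ S≤G → abelianGroup H ≅ subgroup G S S≤G

anyFunction? : ∀ {m n} {P : (Fin m → Fin n) → Set} →
               (∀ {f g} → f ≗ g → P f → P g) →
               (∀ f → Dec (P f)) → Dec (∃ P)
anyFunction? resp P? = map′
  (λ (c , p) → finToFun c , p)
  (λ (f , p) → funToFin f , resp (λ x → sym (finToFun-funToFin f x)) p)
  (any? (λ c → P? (finToFun c)))

isAbelianGroup? : ∀ {n} (_∙_ : Fin n → Fin n → Fin n) (ε : Fin n) (_⁻¹ : Fin n → Fin n) →
                  Dec (IsAbelianGroup _≡_ _∙_ ε _⁻¹)
isAbelianGroup? {n} _∙_ ε _⁻¹ = map′ to from
  (all? (λ x → all? λ y → all? λ z → ((x ∙ y) ∙ z) ≟ᶠ (x ∙ (y ∙ z)))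
    ×-dec all? (λ x → (ε ∙ x) ≟ᶠ x)
    ×-dec all? (λ x → ((x ⁻¹) ∙ x) ≟ᶠ ε)
    ×-dec all? (λ x → all? λ y → (x ∙ y) ≟ᶠ (y ∙ x)))
  where
  Laws : Set
  Laws = (∀ x y z → (x ∙ y) ∙ z ≡ x ∙ (y ∙ z)) × (∀ x → ε ∙ x ≡ x) ×
         (∀ x → (x ⁻¹) ∙ x ≡ ε) × (∀ x y → x ∙ y ≡ y ∙ x)

  to : Laws → IsAbelianGroup _≡_ _∙_ ε _⁻¹
  to (assoc , idˡ , invˡ , comm) = record
    { isGroup = record
      { isMonoid = record
        { isSemigroup = record
          { isMagma = record { isEquivalence = isEquivalence ; ∙-cong = cong₂ _∙_ }
          ; assoc   = assoc
          }
        ; identity = idˡ , λ x → trans (comm x ε) (idˡ x)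
        }
      ; inverse = invˡ , λ x → trans (comm x (x ⁻¹)) (invˡ x)
      ; ⁻¹-cong = cong _⁻¹
      }
    ; comm = comm
    }

  from : IsAbelianGroup _≡_ _∙_ ε _⁻¹ → Laws
  from G = assoc , identityˡ , inverseˡ , comm
    where open IsAbelianGroup G

module _ {m n : ℕ} (H : AbelianGroupOn m) (G : AbelianGroupOn n) where
  private
    module H = AbelianGroupOn H
    module G = AbelianGroupOn G

  private
    Hom : (Fin m → Fin n) → Set
    Hom f = (∀ x y → f (x H.∙ y) ≡ f x G.∙ f y) × f H.ε ≡ G.ε ×
            (∀ x → f (x H.⁻¹) ≡ f x G.⁻¹) × (∀ x y → f x ≡ f y → x ≡ y)

    Hom? : ∀ f → Dec (Hom f)
    Hom? f = all? (λ x → all? λ y → f (x H.∙ y) ≟ᶠ (f x G.∙ f y))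
      ×-dec f H.ε ≟ᶠ G.ε
      ×-dec all? (λ x → f (x H.⁻¹) ≟ᶠ (f x G.⁻¹))
      ×-dec all? (λ x → all? λ y → (f x ≟ᶠ f y) →-dec (x ≟ᶠ y))

    Hom-resp : ∀ {f g} → f ≗ g → Hom f → Hom g
    Hom-resp eq (∙-homo , ε-homo , ⁻¹-homo , inj) =
      (λ x y → trans (sym (eq _)) (trans (∙-homo x y) (cong₂ G._∙_ (eq x) (eq y)))) ,
      trans (sym (eq _)) ε-homo ,
      (λ x → trans (sym (eq _)) (trans (⁻¹-homo x) (cong G._⁻¹ (eq x)))) ,
      λ x y gx≡gy → inj x y (trans (eq x) (trans gx≡gy (sym (eq y))))

  infix 4 _≅?_ _≲?_

  _≅?_ : Dec (H.abelianGroup ≅ G.abelianGroup)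
  _≅?_ = map′ to from (anyFunction? {P = Iso} resp
    (λ f → Hom? f ×-dec all? (λ y → any? λ x → f x ≟ᶠ y)))
    where
    Iso : (Fin m → Fin n) → Set
    Iso f = Hom f × (∀ y → ∃ λ x → f x ≡ y)

    resp : ∀ {f g} → f ≗ g → Iso f → Iso g
    resp eq (hom , surj) =
      Hom-resp eq hom , λ y → proj₁ (surj y) , trans (sym (eq _)) (proj₂ (surj y))

    to : ∃ Iso → H.abelianGroup ≅ G.abelianGroup
    to (f , (∙-homo , ε-homo , ⁻¹-homo , inj) , surj) = f , record
      { isGroupMonomorphism = record
        { isGroupHomomorphism = record
          { isMonoidHomomorphism = record
            { isMagmaHomomorphism = record
              { isRelHomomorphism = record { cong = cong f }
              ; homo              = ∙-homo
              }
            ; ε-homo = ε-homo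
            }
          ; ⁻¹-homo = ⁻¹-homo
          }
        ; injective = inj _ _
        }
      ; surjective = λ y → proj₁ (surj y) , λ { refl → proj₂ (surj y) }
      }

    from : H.abelianGroup ≅ G.abelianGroup → ∃ Iso
    from (f , iso) = f , (∙-homo , ε-homo , ⁻¹-homo , λ _ _ → injective) ,
      λ y → proj₁ (surjective y) , proj₂ (surjective y) refl
      where
      open GroupMorphisms.IsGroupIsomorphism iso

  _≲?_ : Dec (H ≲ G)
  _≲?_ = anySubset? λ S → map′ (to S) (from S)
    ((G.ε ∈? S
      ×-dec all? (λ x → all? λ y → (x ∈? S) →-dec ((y ∈? S) →-dec ((x G.∙ y) ∈? S)))
      ×-dec all? (λ x → (x ∈? S) →-dec ((x G.⁻¹) ∈? S)))
    ×-dec anyFunction? {P = Onto S} (λ {f} {g} → resp S {f} {g}) (λ f →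
      Hom? f
      ×-dec all? (λ x → f x ∈? S)
      ×-dec all? (λ y → (y ∈? S) →-dec any? (λ x → f x ≟ᶠ y))))
    where
    Closed : Subset n → Set
    Closed S = G.ε ∈ S × (∀ x y → x ∈ S → y ∈ S → (x G.∙ y) ∈ S) ×
               (∀ x → x ∈ S → (x G.⁻¹) ∈ S)

    Onto : Subset n → (Fin m → Fin n) → Set
    Onto S f = Hom f × (∀ x → f x ∈ S) × (∀ y → y ∈ S → ∃ λ x → f x ≡ y)

    resp : ∀ S {f g} → f ≗ g → Onto S f → Onto S g
    resp S eq (hom , f∈S , onto) =
      Hom-resp eq hom ,
      (λ x → subst (_∈ S) (eq x) (f∈S x)) ,
      λ y y∈S → proj₁ (onto y y∈S) , trans (sym (eq _)) (proj₂ (onto y y∈S))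

    to : ∀ S → Closed S × ∃ (Onto S) →
         Σ (IsSubgroup G S) λ S≤G → H.abelianGroup ≅ subgroup G S S≤G
    to S ((ε∈S , ∙-cl , ⁻¹-cl) , f , (∙-homo , ε-homo , ⁻¹-homo , inj) , f∈S , onto) =
      record { ε-closed = ε∈S ; ∙-closed = ∙-cl ; ⁻¹-closed = ⁻¹-cl } ,
      (λ x → f x , f∈S x) , record
      { isGroupMonomorphism = record
        { isGroupHomomorphism = record
          { isMonoidHomomorphism = record
            { isMagmaHomomorphism = record
              { isRelHomomorphism = record { cong = cong f }
              ; homo              = ∙-homo
              }
            ; ε-homo = ε-homo
            }
          ; ⁻¹-homo = ⁻¹-homo
          }
        ; injective = inj _ _
        }
      ; surjective = λ (y , y∈S) → proj₁ (onto y y∈S) , λ { refl → proj₂ (onto y y∈S) }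
      }

    from : ∀ S → (Σ (IsSubgroup G S) λ S≤G → H.abelianGroup ≅ subgroup G S S≤G) →
           Closed S × ∃ (Onto S)
    from S (S≤G , f , iso) =
      (ε-closed , ∙-closed , ⁻¹-closed) ,
      (λ x → proj₁ (f x)) ,
      (∙-homo , ε-homo , ⁻¹-homo , λ _ _ → injective) ,
      (λ x → proj₂ (f x)) ,
      λ y y∈S → proj₁ (surjective (y , y∈S)) , proj₂ (surjective (y , y∈S)) refl
      where
      open IsSubgroup S≤G
      open GroupMorphisms.IsGroupIsomorphism iso

-- Any abelian group structure on Fin n agrees pointwise with one in this list.
groups : ∀ n → List (AbelianGroupOn n)
groups n = mapMaybe
  (λ (op , ε , inv) →
    let _∙_ = finToFun ∘ finToFun op
        _⁻¹ = finToFun inv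
    in Maybe.map
         (λ isAbelianGroup → record
           { _∙_ = _∙_ ; ε = ε ; _⁻¹ = _⁻¹ ; isAbelianGroup = isAbelianGroup })
         (dec⇒maybe (isAbelianGroup? _∙_ ε _⁻¹)))
  (cartesianProduct (allFin ((n ℕ.^ n) ℕ.^ n))
    (cartesianProduct (allFin n) (allFin (n ℕ.^ n))))

-- One representative of each isomorphism class of abelian groups of order n.
isoClasses : ∀ n → List (AbelianGroupOn n)
isoClasses n = deduplicate _≅?_ (groups n)

-- It suffices to count H of order m ≤ n, as a subgroup of G has order at most n.
subgroupClasses : ∀ {n} → AbelianGroupOn n → ℕ
subgroupClasses {n} G =
  sum (map (λ m → length (filter (_≲? G) (isoClasses m))) (upTo (suc n)))

A : ℕ → ℕ
A n = sum (map subgroupClasses (isoClasses n))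

-- a 1 + … + a k
partialSum : (ℕ → ℕ) → ℕ → ℕ
partialSum a k = sum (map (λ i → a (suc i)) (upTo k))

fromℕ : ℕ → ℚ
fromℕ n = + n / 1

toℚᵘ-fromℕ : ∀ n → toℚᵘ (fromℕ n) ℚᵘ.≃ ℚᵘ.mkℚᵘ (+ n) 0
toℚᵘ-fromℕ n = toℚᵘ-fromℚᵘ (ℚᵘ.mkℚᵘ (+ n) 0)

fromℕ-+ : ∀ m n → fromℕ (m ℕ.+ n) ≡ fromℕ m + fromℕ n
fromℕ-+ m n = toℚᵘ-injective (begin
  toℚᵘ (fromℕ (m ℕ.+ n))                     ≈⟨ toℚᵘ-fromℕ (m ℕ.+ n) ⟩
  ℚᵘ.mkℚᵘ (+ (m ℕ.+ n)) 0                     ≈⟨ ℚᵘ.*≡* (cong (ℤ._* + 1) (sym (cong₂ ℤ._+_ (ℤ.*-identityʳ (+ m)) (ℤ.*-identityʳ (+ n))))) ⟩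
  ℚᵘ.mkℚᵘ (+ m) 0 ℚᵘ.+ ℚᵘ.mkℚᵘ (+ n) 0        ≈⟨ ℚᵘ.+-cong (toℚᵘ-fromℕ m) (toℚᵘ-fromℕ n) ⟨
  toℚᵘ (fromℕ m) ℚᵘ.+ toℚᵘ (fromℕ n)         ≈⟨ toℚᵘ-homo-+ (fromℕ m) (fromℕ n) ⟨
  toℚᵘ (fromℕ m + fromℕ n)                   ∎)
  where open ℚᵘ.≃-Reasoning

fromℕ-* : ∀ m n → fromℕ (m ℕ.* n) ≡ fromℕ m * fromℕ n
fromℕ-* m n = toℚᵘ-injective (begin
  toℚᵘ (fromℕ (m ℕ.* n))                     ≈⟨ toℚᵘ-fromℕ (m ℕ.* n) ⟩
  ℚᵘ.mkℚᵘ (+ (m ℕ.* n)) 0                     ≈⟨ ℚᵘ.*≡* (cong (ℤ._* + 1) (ℤ.pos-* m n)) ⟩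
  ℚᵘ.mkℚᵘ (+ m) 0 ℚᵘ.* ℚᵘ.mkℚᵘ (+ n) 0        ≈⟨ ℚᵘ.*-cong (toℚᵘ-fromℕ m) (toℚᵘ-fromℕ n) ⟨
  toℚᵘ (fromℕ m) ℚᵘ.* toℚᵘ (fromℕ n)         ≈⟨ toℚᵘ-homo-* (fromℕ m) (fromℕ n) ⟨
  toℚᵘ (fromℕ m * fromℕ n)                   ∎)
  where open ℚᵘ.≃-Reasoning

0≤fromℕ : ∀ n → 0ℚ ≤ fromℕ n
0≤fromℕ n = nonNegative⁻¹ (fromℕ n) {{normalize-nonNeg n 1}}

fromℕ-mono-≤ : ∀ {m n} → m ℕ.≤ n → fromℕ m ≤ fromℕ n
fromℕ-mono-≤ {m} {n} m≤n = subst₂ _≤_ (+-identityʳ (fromℕ m))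
  (trans (sym (fromℕ-+ m (n ℕ.∸ m))) (cong fromℕ (ℕ.m+[n∸m]≡n m≤n)))
  (+-monoʳ-≤ (fromℕ m) (0≤fromℕ (n ℕ.∸ m)))

0<fromℕ : ∀ n → 0ℚ < fromℕ (suc n)
0<fromℕ n = positive⁻¹ (fromℕ (suc n)) {{normalize-pos (suc n) 1}}

*-pos : ∀ {p q} → 0ℚ < p → 0ℚ < q → 0ℚ < p * q
*-pos {p} {q} 0<p 0<q = positive⁻¹ (p * q) {{pos*pos⇒pos p {{positive 0<p}} q {{positive 0<q}}}}

*-nonNeg : ∀ {p q} → 0ℚ ≤ p → 0ℚ ≤ q → 0ℚ ≤ p * q
*-nonNeg {p} {q} 0≤p 0≤q =
  nonNegative⁻¹ (p * q) {{nonNeg*nonNeg⇒nonNeg p {{nonNegative 0≤p}} q {{nonNegative 0≤q}}}}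

*-mono-≤ : ∀ {p q r s} → 0ℚ ≤ p → 0ℚ ≤ s → p ≤ q → r ≤ s → p * r ≤ q * s
*-mono-≤ {p} {q} {r} {s} 0≤p 0≤s p≤q r≤s = ≤-trans
  (*-monoˡ-≤-nonNeg p {{nonNegative 0≤p}} r≤s)
  (*-monoʳ-≤-nonNeg s {{nonNegative 0≤s}} p≤q)

archimedean : ∀ p {ε} → 0ℚ < ε → ∃ λ n → p ≤ fromℕ n * ε
archimedean p {ε} 0<ε = ∣num∣ , subst (_≤ fromℕ ∣num∣ * ε) r*ε≡p
    (*-monoʳ-≤-nonNeg ε {{nonNegative (<⇒≤ 0<ε)}} r≤)
  where
  instance ε≢0 = >-nonZero 0<ε
  r = p ÷ ε
  ∣num∣ = ℤ.∣ ↥ r ∣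
  r*ε≡p : r * ε ≡ p
  r*ε≡p = trans (*-assoc p (1/ ε) ε)
    (trans (cong (p *_) (*-inverseˡ ε)) (*-identityʳ p))
  below : ∀ q → toℚᵘ q ℚᵘ.≤ ℚᵘ.mkℚᵘ (+ ℤ.∣ ↥ q ∣) 0
  below (mkℚ (+ n) d _) = ℚᵘ.*≤* (subst₂ ℤ._≤_ (ℤ.pos-* n 1) (ℤ.pos-* n (suc d))
    (ℤ.+≤+ (ℕ.*-monoʳ-≤ n (ℕ.s≤s ℕ.z≤n))))
  below (mkℚ (ℤ.-[1+ n ]) d _) = ℚᵘ.*≤* ℤ.-≤+
  r≤ : r ≤ fromℕ ∣num∣
  r≤ = toℚᵘ-cancel-≤ (ℚᵘ.≤-respʳ-≃ (ℚᵘ.≃-sym (toℚᵘ-fromℕ ∣num∣)) (below r))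

recip : ∀ {p} → 0ℚ < p → ℚ
recip {p} 0<p = (1/ p) {{>-nonZero 0<p}}

0<recip : ∀ {p} (0<p : 0ℚ < p) → 0ℚ < recip 0<p
0<recip {p} 0<p = positive⁻¹ (recip 0<p) {{1/pos⇒pos p {{positive 0<p}}}}

recip-inverseʳ : ∀ {p} (0<p : 0ℚ < p) → p * recip 0<p ≡ 1ℚ
recip-inverseʳ {p} 0<p = *-inverseʳ p {{>-nonZero 0<p}}

recip-inverseˡ : ∀ {p} (0<p : 0ℚ < p) → recip 0<p * p ≡ 1ℚ
recip-inverseˡ {p} 0<p = *-inverseˡ p {{>-nonZero 0<p}}

recip-≤ : ∀ {p y} (0<p : 0ℚ < p) → 1ℚ ≤ p * y → recip 0<p ≤ y
recip-≤ {p} {y} 0<p 1≤py = subst₂ _≤_ (*-identityʳ (recip 0<p))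
  (trans (sym (*-assoc (recip 0<p) p y))
    (trans (cong (_* y) (recip-inverseˡ 0<p)) (*-identityˡ y)))
  (*-monoˡ-≤-nonNeg (recip 0<p) {{nonNegative (<⇒≤ (0<recip 0<p))}} 1≤py)

third : ∀ {ε} → 0ℚ < ε → 0ℚ < ε * (+ 1 / 3)
third 0<ε = *-pos 0<ε (positive⁻¹ (+ 1 / 3))

thirds : ∀ ε → ε * (+ 1 / 3) + ε * (+ 1 / 3) + ε * (+ 1 / 3) ≡ ε
thirds = solve 1 (λ e → e :* con (+ 1 / 3) :+ e :* con (+ 1 / 3) :+ e :* con (+ 1 / 3) := e) refl

half : ∀ {ε} → 0ℚ < ε → 0ℚ < ε * ½
half 0<ε = *-pos 0<ε (positive⁻¹ ½)

halves : ∀ ε → ε * ½ + ε * ½ ≡ ε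
halves = solve 1 (λ e → e :* con ½ :+ e :* con ½ := e) refl

∣p-q∣-sym : ∀ p q → ∣ p - q ∣ ≡ ∣ q - p ∣
∣p-q∣-sym p q = trans (cong ∣_∣ (solve 2 (λ a b → a :- b := :- (b :- a)) refl p q)) (∣-p∣≡∣p∣ (q - p))

∣-∣-triangle : ∀ p q r → ∣ p - r ∣ ≤ ∣ p - q ∣ + ∣ q - r ∣
∣-∣-triangle p q r = subst (λ z → ∣ z ∣ ≤ ∣ p - q ∣ + ∣ q - r ∣)
  (solve 3 (λ a b c → (a :- b) :+ (b :- c) := a :- c) refl p q r)
  (∣p+q∣≤∣p∣+∣q∣ (p - q) (q - r))

∣p∣≤∣q∣+∣p-q∣ : ∀ p q → ∣ p ∣ ≤ ∣ q ∣ + ∣ p - q ∣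
∣p∣≤∣q∣+∣p-q∣ p q = subst (λ z → ∣ z ∣ ≤ ∣ q ∣ + ∣ p - q ∣)
  (solve 2 (λ a b → b :+ (a :- b) := a) refl p q)
  (∣p+q∣≤∣p∣+∣q∣ q (p - q))

-- Cauchy sequences of rationals; equality of reals is x ≤ʳ y × y ≤ʳ x.
record ℝ : Set where
  field
    seq    : ℕ → ℚ
    cauchy : ∀ ε → 0ℚ < ε → ∃ λ N → ∀ m n → N ℕ.≤ m → N ℕ.≤ n → ∣ seq m - seq n ∣ ≤ ε

open ℝ

bounded : ∀ x → ∃ λ K → 0ℚ < K × ∃ λ N → ∀ n → N ℕ.≤ n → ∣ seq x n ∣ ≤ K
bounded x = let N , h = cauchy x 1ℚ (positive⁻¹ 1ℚ) in
  ∣ seq x N ∣ + 1ℚ ,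
  positive⁻¹ _ {{nonNeg+pos⇒pos ∣ seq x N ∣ {{∣-∣-nonNeg (seq x N)}} 1ℚ}} ,
  N , λ n N≤n → ≤-trans (∣p∣≤∣q∣+∣p-q∣ (seq x n) (seq x N))
    (+-monoʳ-≤ ∣ seq x N ∣ (h n N N≤n ℕ.≤-refl))

infix  4 _≤ʳ_ _<ʳ_
infixl 6 _-ʳ_
infixl 7 _*ʳ_

_≤ʳ_ : ℝ → ℝ → Set
x ≤ʳ y = ∀ ε → 0ℚ < ε → ∃ λ N → ∀ n → N ℕ.≤ n → seq x n ≤ seq y n + ε

_<ʳ_ : ℝ → ℝ → Set
x <ʳ y = ∃ λ ε → 0ℚ < ε × ∃ λ N → ∀ n → N ℕ.≤ n → seq x n + ε ≤ seq y n

fromℚ : ℚ → ℝ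
fromℚ q = record
  { seq    = λ _ → q
  ; cauchy = λ ε 0<ε → 0 , λ _ _ _ _ →
      subst (λ z → ∣ z ∣ ≤ ε) (sym (+-inverseʳ q)) (<⇒≤ 0<ε)
  }

0ℝ : ℝ
0ℝ = fromℚ 0ℚ

-- A relation, because the floor of a real number is not computable; a sum over
-- n ≤ x is one over n ≤ k for k the floor of x.
IsFloor : ℝ → ℕ → Set
IsFloor x k = fromℚ (fromℕ k) ≤ʳ x × x <ʳ fromℚ (fromℕ (suc k))

_-ʳ_ : ℝ → ℝ → ℝ
x -ʳ y = record
  { seq    = λ n → seq x n - seq y n
  ; cauchy = λ ε 0<ε →
      let M , h = cauchy x (ε * ½) (half 0<ε)
          N , k = cauchy y (ε * ½) (half 0<ε)
      in M ℕ.⊔ N , λ m n p q →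
        subst₂ _≤_
          (cong ∣_∣ (solve 4 (λ a b c d → (a :- b) :- (c :- d) := (a :- c) :- (b :- d)) refl
            (seq x m) (seq x n) (seq y m) (seq y n)))
          (halves ε)
          (≤-trans (∣p-q∣≤∣p∣+∣q∣ (seq x m - seq x n) (seq y m - seq y n))
            (+-mono-≤ (h m n (ℕ.m⊔n≤o⇒m≤o M N p) (ℕ.m⊔n≤o⇒m≤o M N q))
                      (k m n (ℕ.m⊔n≤o⇒n≤o M N p) (ℕ.m⊔n≤o⇒n≤o M N q))))
  }

_*ʳ_ : ℝ → ℝ → ℝ
x *ʳ y = record { seq = λ n → seq x n * seq y n ; cauchy = λ ε 0<ε →
  let K , 0<K , M₁ , hx = bounded x
      L , 0<L , M₂ , hy = bounded y
      K⁻¹ = recip 0<K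
      L⁻¹ = recip 0<L
      N₁ , cx = cauchy x (ε * ½ * L⁻¹) (*-pos (half 0<ε) (0<recip 0<L))
      N₂ , cy = cauchy y (ε * ½ * K⁻¹) (*-pos (half 0<ε) (0<recip 0<K))
      M = M₁ ℕ.⊔ M₂
      N = N₁ ℕ.⊔ N₂
  in M ℕ.⊔ N , λ m n p q →
    let xm = seq x m ; xn = seq x n ; ym = seq y m ; yn = seq y n
        M≤m = ℕ.m⊔n≤o⇒m≤o M N p
        M≤n = ℕ.m⊔n≤o⇒m≤o M N q
        N≤m = ℕ.m⊔n≤o⇒n≤o M N p
        N≤n = ℕ.m⊔n≤o⇒n≤o M N q
    in begin
      ∣ xm * ym - xn * yn ∣
        ≡⟨ cong ∣_∣ (solve 4 (λ a b c d → a :* c :- b :* d := a :* (c :- d) :+ (a :- b) :* d) refl xm xn ym yn) ⟩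
      ∣ xm * (ym - yn) + (xm - xn) * yn ∣
        ≤⟨ ∣p+q∣≤∣p∣+∣q∣ (xm * (ym - yn)) ((xm - xn) * yn) ⟩
      ∣ xm * (ym - yn) ∣ + ∣ (xm - xn) * yn ∣
        ≡⟨ cong₂ _+_ (∣p*q∣≡∣p∣*∣q∣ xm (ym - yn)) (∣p*q∣≡∣p∣*∣q∣ (xm - xn) yn) ⟩
      ∣ xm ∣ * ∣ ym - yn ∣ + ∣ xm - xn ∣ * ∣ yn ∣
        ≤⟨ +-mono-≤
             (*-mono-≤ (0≤∣p∣ xm) (<⇒≤ (*-pos (half 0<ε) (0<recip 0<K)))
               (hx m (ℕ.m⊔n≤o⇒m≤o M₁ M₂ M≤m))
               (cy m n (ℕ.m⊔n≤o⇒n≤o N₁ N₂ N≤m) (ℕ.m⊔n≤o⇒n≤o N₁ N₂ N≤n)))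
             (*-mono-≤ (0≤∣p∣ (xm - xn)) (<⇒≤ 0<L)
               (cx m n (ℕ.m⊔n≤o⇒m≤o N₁ N₂ N≤m) (ℕ.m⊔n≤o⇒m≤o N₁ N₂ N≤n))
               (hy n (ℕ.m⊔n≤o⇒n≤o M₁ M₂ M≤n))) ⟩
      K * (ε * ½ * K⁻¹) + ε * ½ * L⁻¹ * L
        ≡⟨ cong₂ _+_
             (trans (solve 3 (λ k e i → k :* (e :* i) := e :* (k :* i)) refl K (ε * ½) K⁻¹)
               (trans (cong (ε * ½ *_) (recip-inverseʳ 0<K)) (*-identityʳ (ε * ½))))
             (trans (*-assoc (ε * ½) L⁻¹ L)
               (trans (cong (ε * ½ *_) (recip-inverseˡ 0<L)) (*-identityʳ (ε * ½)))) ⟩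
      ε * ½ + ε * ½
        ≡⟨ halves ε ⟩
      ε ∎ }
  where open ≤-Reasoning

∣_∣ʳ : ℝ → ℝ
∣ x ∣ʳ = record
  { seq    = λ n → ∣ seq x n ∣
  ; cauchy = λ ε 0<ε → let N , h = cauchy x ε 0<ε in
      N , λ m n p q → ≤-trans (reverse (seq x m) (seq x n)) (h m n p q)
  }
  where
  half-reverse : ∀ p q → ∣ p ∣ - ∣ q ∣ ≤ ∣ p - q ∣
  half-reverse p q = subst (∣ p ∣ - ∣ q ∣ ≤_)
    (solve 2 (λ a b → a :+ b :- a := b) refl ∣ q ∣ ∣ p - q ∣)
    (+-monoˡ-≤ (- ∣ q ∣) (∣p∣≤∣q∣+∣p-q∣ p q))

  reverse : ∀ p q → ∣ ∣ p ∣ - ∣ q ∣ ∣ ≤ ∣ p - q ∣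
  reverse p q with ∣p∣≡p∨∣p∣≡-p (∣ p ∣ - ∣ q ∣)
  ... | inj₁ eq = subst (_≤ ∣ p - q ∣) (sym eq) (half-reverse p q)
  ... | inj₂ eq = subst₂ _≤_
    (sym (trans eq (solve 2 (λ a b → :- (a :- b) := b :- a) refl ∣ p ∣ ∣ q ∣)))
    (∣p-q∣-sym q p) (half-reverse q p)

∑ : ℕ → (ℕ → ℚ) → ℚ
∑ zero    f = 0ℚ
∑ (suc n) f = ∑ n f + f n

-- n times the point 1 + (i + 1)(q - 1)/n of the subdivision of [1, q] into n
-- equal steps; in this form it is visibly positive for every q > 0.
node : ℕ → ℕ → ℚ → ℚ
node n i q = fromℕ (n ℕ.∸ suc i) + fromℕ (suc i) * q

0<node : ∀ n i {q} → 0ℚ < q → 0ℚ < node n i q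
0<node n i 0<q = +-mono-≤-< (0≤fromℕ (n ℕ.∸ suc i)) (*-pos (0<fromℕ i) 0<q)

-- The sum of the terms (q - 1)/n · 1/tᵢ with tᵢ = node n i q / n.
riemann : ℕ → ∀ {q} → 0ℚ < q → ℚ
riemann n {q} 0<q = ∑ n (λ i → (q - 1ℚ) * recip (0<node n i 0<q))

∑-+ : ∀ m n f → ∑ (m ℕ.+ n) f ≡ ∑ m f + ∑ n (λ j → f (m ℕ.+ j))
∑-+ m zero    f = trans (cong (λ k → ∑ k f) (ℕ.+-identityʳ m)) (sym (+-identityʳ (∑ m f)))
∑-+ m (suc n) f = trans (cong (λ k → ∑ k f) (ℕ.+-suc m n))
  (trans (cong (_+ f (m ℕ.+ n)) (∑-+ m n f)) (+-assoc (∑ m f) _ _))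

∑-* : ∀ m n f → ∑ (m ℕ.* n) f ≡ ∑ m (λ i → ∑ n (λ j → f (i ℕ.* n ℕ.+ j)))
∑-* zero    n f = refl
∑-* (suc m) n f = trans (cong (λ k → ∑ k f) (ℕ.+-comm n (m ℕ.* n)))
  (trans (∑-+ (m ℕ.* n) n f) (cong (_+ ∑ n (λ j → f (m ℕ.* n ℕ.+ j))) (∑-* m n f)))

∑-const : ∀ n p → ∑ n (λ _ → p) ≡ fromℕ n * p
∑-const zero    p = sym (*-zeroˡ p)
∑-const (suc n) p = trans (cong (_+ p) (∑-const n p))
  (trans (solve 2 (λ n p → n :* p :+ p := (con 1ℚ :+ n) :* p) refl (fromℕ n) p)
    (cong (_* p) (sym (fromℕ-+ 1 n))))

∑-diff : ∀ n {f g B} → (∀ i → i ℕ.< n → ∣ f i - g i ∣ ≤ B) →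
         ∣ ∑ n f - ∑ n g ∣ ≤ fromℕ n * B
∑-diff zero    {B = B} h = ≤-reflexive (sym (*-zeroˡ B))
∑-diff (suc n) {f} {g} {B} h = begin
  ∣ ∑ n f + f n - (∑ n g + g n) ∣
    ≡⟨ cong ∣_∣ (solve 4 (λ a b c d → a :+ b :- (c :+ d) := (a :- c) :+ (b :- d)) refl
         (∑ n f) (f n) (∑ n g) (g n)) ⟩
  ∣ (∑ n f - ∑ n g) + (f n - g n) ∣
    ≤⟨ ∣p+q∣≤∣p∣+∣q∣ (∑ n f - ∑ n g) (f n - g n) ⟩
  ∣ ∑ n f - ∑ n g ∣ + ∣ f n - g n ∣
    ≤⟨ +-mono-≤ (∑-diff n (λ i i<n → h i (ℕ.m<n⇒m<1+n i<n))) (h n ℕ.≤-refl) ⟩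
  fromℕ n * B + B
    ≡⟨ solve 2 (λ n p → n :* p :+ p := (con 1ℚ :+ n) :* p) refl (fromℕ n) B ⟩
  (1ℚ + fromℕ n) * B
    ≡⟨ cong (_* B) (fromℕ-+ 1 n) ⟨
  fromℕ (suc n) * B ∎
  where open ≤-Reasoning

node-≡ : ∀ n i q → i ℕ.< n → node n i q ≡ fromℕ n + fromℕ (suc i) * (q - 1ℚ)
node-≡ n i q i<n = trans
  (solve 3 (λ d s q → d :+ s :* q := (d :+ s) :+ s :* (q :- con 1ℚ)) refl
    (fromℕ (n ℕ.∸ suc i)) (fromℕ (suc i)) q)
  (cong (_+ fromℕ (suc i) * (q - 1ℚ))
    (trans (sym (fromℕ-+ (n ℕ.∸ suc i) (suc i))) (cong fromℕ (ℕ.m∸n+n≡m i<n))))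

module Bounds {c} (0<c : 0ℚ < c) (c≤1 : c ≤ 1ℚ) where
  κ : ℚ
  κ = recip 0<c

  0≤κ : 0ℚ ≤ κ
  0≤κ = <⇒≤ (0<recip 0<c)

  ν : ℕ → ℚ
  ν n = recip (0<fromℕ n)

  0≤ν : ∀ n → 0ℚ ≤ ν n
  0≤ν n = <⇒≤ (0<recip (0<fromℕ n))

  node-≥ : ∀ n i {q} → c ≤ q → i ℕ.< n → fromℕ n * c ≤ node n i q
  node-≥ n i {q} c≤q i<n = begin
    fromℕ n * c
      ≡⟨ cong (λ k → fromℕ k * c) (ℕ.m∸n+n≡m i<n) ⟨
    fromℕ (n ℕ.∸ suc i ℕ.+ suc i) * c
      ≡⟨ cong (_* c) (fromℕ-+ (n ℕ.∸ suc i) (suc i)) ⟩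
    (fromℕ (n ℕ.∸ suc i) + fromℕ (suc i)) * c
      ≡⟨ *-distribʳ-+ c (fromℕ (n ℕ.∸ suc i)) (fromℕ (suc i)) ⟩
    fromℕ (n ℕ.∸ suc i) * c + fromℕ (suc i) * c
      ≤⟨ +-mono-≤
           (*-monoˡ-≤-nonNeg (fromℕ (n ℕ.∸ suc i)) {{nonNegative (0≤fromℕ (n ℕ.∸ suc i))}} c≤1)
           (*-monoˡ-≤-nonNeg (fromℕ (suc i)) {{nonNegative (0≤fromℕ (suc i))}} c≤q) ⟩
    fromℕ (n ℕ.∸ suc i) * 1ℚ + fromℕ (suc i) * q
      ≡⟨ cong (_+ fromℕ (suc i) * q) (*-identityʳ (fromℕ (n ℕ.∸ suc i))) ⟩
    node n i q ∎
    where open ≤-Reasoning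

  recip-node : ∀ n i {q y} (0<q : 0ℚ < q) → c ≤ q → i ℕ.< n → 0ℚ ≤ y → fromℕ n * y ≡ 1ℚ →
               recip (0<node n i 0<q) ≤ κ * y
  recip-node n i {q} {y} 0<q c≤q i<n 0≤y ny≡1 = recip-≤ (0<node n i 0<q) (begin
    1ℚ                      ≡⟨ cong₂ _*_ ny≡1 (recip-inverseʳ 0<c) ⟨
    fromℕ n * y * (c * κ)   ≡⟨ solve 4 (λ n y c k → n :* y :* (c :* k) := n :* c :* (k :* y)) refl (fromℕ n) y c κ ⟩
    fromℕ n * c * (κ * y)   ≤⟨ *-monoʳ-≤-nonNeg (κ * y) {{nonNegative (*-nonNeg 0≤κ 0≤y)}} (node-≥ n i c≤q i<n) ⟩
    node n i q * (κ * y)    ∎)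
    where open ≤-Reasoning

  lipschitz : ∀ n' {p q} (0<p : 0ℚ < p) (0<q : 0ℚ < q) → c ≤ p → c ≤ q →
              ∣ riemann (suc n') 0<p - riemann (suc n') 0<q ∣ ≤ ∣ p - q ∣ * (κ * κ)
  lipschitz n' {p} {q} 0<p 0<q c≤p c≤q = ≤-trans (∑-diff n term) (≤-reflexive total)
    where
    open ≤-Reasoning
    n = suc n'
    N = fromℕ n
    y = ν n'
    D = ∣ p - q ∣
    Ny≡1 : N * y ≡ 1ℚ
    Ny≡1 = recip-inverseʳ (0<fromℕ n')

    total : N * (N * D * (κ * y * (κ * y))) ≡ D * (κ * κ)
    total = trans
      (solve 4 (λ n d k y → n :* (n :* d :* (k :* y :* (k :* y))) :=
                            d :* (k :* k) :* ((n :* y) :* (n :* y))) refl N D κ y)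
      (trans (cong (D * (κ * κ) *_) (cong₂ _*_ Ny≡1 Ny≡1)) (*-identityʳ (D * (κ * κ))))

    term : ∀ i → i ℕ.< n →
      ∣ (p - 1ℚ) * recip (0<node n i 0<p) - (q - 1ℚ) * recip (0<node n i 0<q) ∣
      ≤ N * D * (κ * y * (κ * y))
    term i i<n = begin
      ∣ u * ra - v * rb ∣
        ≡⟨ cong ∣_∣ (cong₂ (λ s t → s - t) (*-identityʳ (u * ra)) (*-identityʳ (v * rb))) ⟨
      ∣ u * ra * 1ℚ - v * rb * 1ℚ ∣
        ≡⟨ cong ∣_∣ (cong₂ (λ s t → u * ra * s - v * rb * t)
             (recip-inverseʳ (0<node n i 0<q)) (recip-inverseʳ (0<node n i 0<p))) ⟨
      ∣ u * ra * (node n i q * rb) - v * rb * (node n i p * ra) ∣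
        ≡⟨ cong ∣_∣ (cong₂ (λ s t → u * ra * (s * rb) - v * rb * (t * ra))
             (node-≡ n i q i<n) (node-≡ n i p i<n)) ⟩
      ∣ u * ra * ((N + S * v) * rb) - v * rb * ((N + S * u) * ra) ∣
        ≡⟨ cong ∣_∣ (solve 6 (λ p q a b n s →
             (p :- con 1ℚ) :* a :* ((n :+ s :* (q :- con 1ℚ)) :* b)
               :- (q :- con 1ℚ) :* b :* ((n :+ s :* (p :- con 1ℚ)) :* a)
             := (p :- q) :* (n :* (a :* b))) refl p q ra rb N S) ⟩
      ∣ (p - q) * (N * (ra * rb)) ∣
        ≡⟨ ∣p*q∣≡∣p∣*∣q∣ (p - q) (N * (ra * rb)) ⟩
      D * ∣ N * (ra * rb) ∣
        ≡⟨ cong (D *_) (0≤p⇒∣p∣≡p (*-nonNeg (0≤fromℕ n) (*-nonNeg 0≤ra 0≤rb))) ⟩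
      D * (N * (ra * rb))
        ≡⟨ solve 3 (λ d n z → d :* (n :* z) := n :* d :* z) refl D N (ra * rb) ⟩
      N * D * (ra * rb)
        ≤⟨ *-monoˡ-≤-nonNeg (N * D) {{nonNegative (*-nonNeg (0≤fromℕ n) (0≤∣p∣ (p - q)))}}
             (*-mono-≤ 0≤ra (*-nonNeg 0≤κ (0≤ν n'))
               (recip-node n i 0<p c≤p i<n (0≤ν n') Ny≡1)
               (recip-node n i 0<q c≤q i<n (0≤ν n') Ny≡1)) ⟩
      N * D * (κ * y * (κ * y)) ∎
      where
      u = p - 1ℚ
      v = q - 1ℚ
      ra = recip (0<node n i 0<p)
      rb = recip (0<node n i 0<q)
      S = fromℕ (suc i)
      0≤ra = <⇒≤ (0<recip (0<node n i 0<p))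
      0≤rb = <⇒≤ (0<recip (0<node n i 0<q))

  refine : ∀ n' m' {p} (0<p : 0ℚ < p) → c ≤ p →
           ∣ riemann (suc n') 0<p - riemann (suc n' ℕ.* suc m') 0<p ∣
           ≤ ∣ p - 1ℚ ∣ * ∣ p - 1ℚ ∣ * (κ * κ) * ν n'
  refine n' m' {p} 0<p c≤p =
    subst (λ z → ∣ riemann n 0<p - z ∣ ≤ E * (κ * κ) * y) (sym (∑-* n m g))
      (≤-trans (∑-diff n block) (≤-reflexive total))
    where
    open ≤-Reasoning
    n = suc n'
    m = suc m'
    N = fromℕ n
    M = fromℕ m
    y = ν n'
    w = ν m'
    u = p - 1ℚ
    E = ∣ u ∣ * ∣ u ∣
    f g : ℕ → ℚ
    f i = u * recip (0<node n i 0<p)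
    g k = u * recip (0<node (n ℕ.* m) k 0<p)
    B = E * (κ * y * (κ * (y * w)))
    Ny≡1 : N * y ≡ 1ℚ
    Ny≡1 = recip-inverseʳ (0<fromℕ n')
    Mw≡1 : M * w ≡ 1ℚ
    Mw≡1 = recip-inverseʳ (0<fromℕ m')
    NMyw≡1 : fromℕ (n ℕ.* m) * (y * w) ≡ 1ℚ
    NMyw≡1 = trans (cong (_* (y * w)) (fromℕ-* n m))
      (trans (solve 4 (λ a b c d → a :* b :* (c :* d) := (a :* c) :* (b :* d)) refl N M y w)
        (cong₂ _*_ Ny≡1 Mw≡1))

    total : N * (M * B) ≡ E * (κ * κ) * y
    total = trans
      (solve 6 (λ n m e k y w → n :* (m :* (e :* (k :* y :* (k :* (y :* w))))) :=
                  e :* (k :* k) :* y :* ((n :* y) :* (m :* w))) refl N M E κ y w)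
      (trans (cong (E * (κ * κ) * y *_) (cong₂ _*_ Ny≡1 Mw≡1))
        (*-identityʳ (E * (κ * κ) * y)))

    term : ∀ i j → i ℕ.< n → j ℕ.< m → ∣ w * f i - g (i ℕ.* m ℕ.+ j) ∣ ≤ B
    term i j i<n j<m = begin
      ∣ w * (u * ra) - u * rb ∣
        ≡⟨ cong ∣_∣ (cong₂ (λ s t → s - t) (*-identityʳ (w * (u * ra))) (*-identityʳ (u * rb))) ⟨
      ∣ w * (u * ra) * 1ℚ - u * rb * 1ℚ ∣
        ≡⟨ cong ∣_∣ (cong₂ (λ s t → w * (u * ra) * s - u * rb * t)
             (recip-inverseʳ (0<node nm k 0<p)) (recip-inverseʳ (0<node n i 0<p))) ⟨
      ∣ w * (u * ra) * (node nm k p * rb) - u * rb * (node n i p * ra) ∣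
        ≡⟨ cong ∣_∣ (cong₂ (λ s t → w * (u * ra) * (s * rb) - u * rb * (t * ra)) b≡ a≡) ⟩
      ∣ w * (u * ra) * ((N * M + K * u) * rb) - u * rb * ((N * (M * w) + (K + d) * w * u) * ra) ∣
        ≡⟨ cong ∣_∣ (solve 8 (λ w u a b n m k d →
             w :* (u :* a) :* ((n :* m :+ k :* u) :* b)
               :- u :* b :* ((n :* (m :* w) :+ (k :+ d) :* w :* u) :* a)
             := :- (u :* u :* (d :* w :* (a :* b)))) refl w u ra rb N M K d) ⟩
      ∣ - (u * u * (d * w * (ra * rb))) ∣
        ≡⟨ ∣-p∣≡∣p∣ (u * u * (d * w * (ra * rb))) ⟩
      ∣ u * u * (d * w * (ra * rb)) ∣
        ≡⟨ ∣p*q∣≡∣p∣*∣q∣ (u * u) (d * w * (ra * rb)) ⟩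
      ∣ u * u ∣ * ∣ d * w * (ra * rb) ∣
        ≡⟨ cong₂ _*_ (∣p*q∣≡∣p∣*∣q∣ u u)
             (0≤p⇒∣p∣≡p (*-nonNeg 0≤dw (*-nonNeg 0≤ra 0≤rb))) ⟩
      E * (d * w * (ra * rb))
        ≤⟨ *-monoˡ-≤-nonNeg E {{nonNegative 0≤E}}
             (*-mono-≤ 0≤dw (*-nonNeg 0≤κy 0≤κyw) dw≤1
               (*-mono-≤ 0≤ra 0≤κyw
                 (recip-node n i 0<p c≤p i<n (0≤ν n') Ny≡1)
                 (recip-node nm k 0<p c≤p k<nm (*-nonNeg (0≤ν n') (0≤ν m')) NMyw≡1))) ⟩
      E * (1ℚ * (κ * y * (κ * (y * w))))
        ≡⟨ cong (E *_) (*-identityˡ (κ * y * (κ * (y * w)))) ⟩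
      B ∎
      where
      nm = n ℕ.* m
      k = i ℕ.* m ℕ.+ j
      K = fromℕ (suc k)
      d = fromℕ (m ℕ.∸ suc j)
      ra = recip (0<node n i 0<p)
      rb = recip (0<node nm k 0<p)
      0≤ra = <⇒≤ (0<recip (0<node n i 0<p))
      0≤rb = <⇒≤ (0<recip (0<node nm k 0<p))
      0≤dw = *-nonNeg (0≤fromℕ (m ℕ.∸ suc j)) (0≤ν m')
      0≤E = *-nonNeg (0≤∣p∣ u) (0≤∣p∣ u)
      0≤κy = *-nonNeg 0≤κ (0≤ν n')
      0≤κyw = *-nonNeg 0≤κ (*-nonNeg (0≤ν n') (0≤ν m'))
      dw≤1 : d * w ≤ 1ℚ
      dw≤1 = subst (d * w ≤_) Mw≡1
        (*-monoʳ-≤-nonNeg w {{nonNegative (0≤ν m')}} (fromℕ-mono-≤ (ℕ.m∸n≤m m (suc j))))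
      1+k+[m-1-j] : suc k ℕ.+ (m ℕ.∸ suc j) ≡ suc i ℕ.* m
      1+k+[m-1-j] = trans (cong (ℕ._+ (m ℕ.∸ suc j)) (sym (ℕ.+-suc (i ℕ.* m) j)))
        (trans (ℕ.+-assoc (i ℕ.* m) (suc j) (m ℕ.∸ suc j))
          (trans (cong (i ℕ.* m ℕ.+_) (ℕ.m+[n∸m]≡n j<m)) (ℕ.+-comm (i ℕ.* m) m)))
      k<nm : k ℕ.< nm
      k<nm = ℕ.≤-trans (ℕ.≤-trans (ℕ.m≤m+n (suc k) (m ℕ.∸ suc j)) (ℕ.≤-reflexive 1+k+[m-1-j]))
        (ℕ.*-monoˡ-≤ m i<n)
      b≡ : node nm k p ≡ N * M + K * u
      b≡ = trans (node-≡ nm k p k<nm) (cong (_+ K * u) (fromℕ-* n m))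
      K+d : K + d ≡ fromℕ (suc i) * M
      K+d = trans (sym (fromℕ-+ (suc k) (m ℕ.∸ suc j)))
        (trans (cong fromℕ 1+k+[m-1-j]) (fromℕ-* (suc i) m))
      a≡ : node n i p ≡ N * (M * w) + (K + d) * w * u
      a≡ = begin-equality
        node n i p
          ≡⟨ node-≡ n i p i<n ⟩
        N + fromℕ (suc i) * u
          ≡⟨ cong₂ (λ s t → s + t * u) (*-identityʳ N) (*-identityʳ (fromℕ (suc i))) ⟨
        N * 1ℚ + fromℕ (suc i) * 1ℚ * u
          ≡⟨ cong (λ z → N * z + fromℕ (suc i) * z * u) Mw≡1 ⟨
        N * (M * w) + fromℕ (suc i) * (M * w) * u
          ≡⟨ cong (λ z → N * (M * w) + z * u) (*-assoc (fromℕ (suc i)) M w) ⟨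
        N * (M * w) + fromℕ (suc i) * M * w * u
          ≡⟨ cong (λ z → N * (M * w) + z * w * u) K+d ⟨
        N * (M * w) + (K + d) * w * u ∎

    block : ∀ i → i ℕ.< n → ∣ f i - ∑ m (λ j → g (i ℕ.* m ℕ.+ j)) ∣ ≤ M * B
    block i i<n = subst (λ z → ∣ z - ∑ m (λ j → g (i ℕ.* m ℕ.+ j)) ∣ ≤ M * B)
      (trans (∑-const m (w * f i))
        (trans (sym (*-assoc M w (f i)))
          (trans (cong (_* f i) Mw≡1) (*-identityˡ (f i)))))
      (∑-diff m (λ j j<m → term i j i<n j<m))

-- log x = ∫ dt/t from 1 to x: term n is the right Riemann sum with n + 1 steps
-- for a rational approximation of x; the shift of the index by N₀ keeps these
-- approximations bounded away from 0.
log : (x : ℝ) → 0ℝ <ʳ x → ℝ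
log x (c₀ , 0<c₀ , N₀ , c₀≤) = record
  { seq    = λ n → riemann (suc n) (0<q n)
  ; cauchy = λ ε 0<ε →
      let N₁ , cx = cauchy x (ε * (+ 1 / 3) * (c * c)) (*-pos (third 0<ε) (*-pos 0<c 0<c))
          N₂ , ar = archimedean (L * L * (κ * κ)) (third 0<ε)
          N = K₀ ℕ.⊔ (N₁ ℕ.⊔ N₂)
          K₀≤ : ∀ {n} → N ℕ.≤ n → K₀ ℕ.≤ n
          K₀≤ = ℕ.m⊔n≤o⇒m≤o K₀ (N₁ ℕ.⊔ N₂)
          N₁≤ : ∀ {n} → N ℕ.≤ n → N₁ ℕ.≤ n
          N₁≤ p = ℕ.m⊔n≤o⇒m≤o N₁ N₂ (ℕ.m⊔n≤o⇒n≤o K₀ (N₁ ℕ.⊔ N₂) p)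
          N₂≤ : ∀ {n} → N ℕ.≤ n → N₂ ℕ.≤ n
          N₂≤ p = ℕ.m⊔n≤o⇒n≤o N₁ N₂ (ℕ.m⊔n≤o⇒n≤o K₀ (N₁ ℕ.⊔ N₂) p)
      in N , λ m n N≤m N≤n →
        let M' = suc m ; N' = suc n in begin
        ∣ riemann M' (0<q m) - riemann N' (0<q n) ∣
          ≤⟨ ∣-∣-triangle (riemann M' (0<q m)) (riemann (M' ℕ.* N') (0<q m)) (riemann N' (0<q n)) ⟩
        ∣ riemann M' (0<q m) - riemann (M' ℕ.* N') (0<q m) ∣
          + ∣ riemann (M' ℕ.* N') (0<q m) - riemann N' (0<q n) ∣
          ≤⟨ +-mono-≤ (mesh ε 0<ε m n N₂ (K₀≤ N≤m) (N₂≤ N≤m) ar)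
               (∣-∣-triangle (riemann (M' ℕ.* N') (0<q m)) (riemann (M' ℕ.* N') (0<q n)) (riemann N' (0<q n))) ⟩
        ε * (+ 1 / 3) + (∣ riemann (M' ℕ.* N') (0<q m) - riemann (M' ℕ.* N') (0<q n) ∣
          + ∣ riemann (M' ℕ.* N') (0<q n) - riemann N' (0<q n) ∣)
          ≤⟨ +-monoʳ-≤ (ε * (+ 1 / 3)) (+-mono-≤
               (≤-trans (lipschitz (n ℕ.+ m ℕ.* N') (0<q m) (0<q n) (c≤q m) (c≤q n))
                 (≤-trans (*-monoʳ-≤-nonNeg (κ * κ) {{nonNegative (*-nonNeg 0≤κ 0≤κ)}}
                   (cx _ _ (ℕ.≤-trans (N₁≤ N≤m) (ℕ.m≤n+m m N₀)) (ℕ.≤-trans (N₁≤ N≤n) (ℕ.m≤n+m n N₀))))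
                   (≤-reflexive (cancel (ε * (+ 1 / 3))))))
               (subst (_≤ ε * (+ 1 / 3))
                 (trans (∣p-q∣-sym (riemann N' (0<q n)) (riemann (N' ℕ.* M') (0<q n)))
                   (cong (λ k → ∣ riemann k (0<q n) - riemann N' (0<q n) ∣) (ℕ.*-comm N' M')))
                 (mesh ε 0<ε n m N₂ (K₀≤ N≤n) (N₂≤ N≤n) ar))) ⟩
        ε * (+ 1 / 3) + (ε * (+ 1 / 3) + ε * (+ 1 / 3))
          ≡⟨ trans (sym (+-assoc (ε * (+ 1 / 3)) (ε * (+ 1 / 3)) (ε * (+ 1 / 3)))) (thirds ε) ⟩
        ε ∎
  }
  where
  open ≤-Reasoning
  q : ℕ → ℚ
  q n = seq x (N₀ ℕ.+ n)

  c₀≤q : ∀ n → c₀ ≤ q n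
  c₀≤q n = subst (_≤ q n) (+-identityˡ c₀) (c₀≤ (N₀ ℕ.+ n) (ℕ.m≤m+n N₀ n))

  0<q : ∀ n → 0ℚ < q n
  0<q n = <-≤-trans 0<c₀ (c₀≤q n)

  c : ℚ
  c = c₀ ⊓ 1ℚ

  0<c : 0ℚ < c
  0<c with ⊓-sel c₀ 1ℚ
  ... | inj₁ eq = subst (0ℚ <_) (sym eq) 0<c₀
  ... | inj₂ eq = subst (0ℚ <_) (sym eq) (positive⁻¹ 1ℚ)

  c≤q : ∀ n → c ≤ q n
  c≤q n = ≤-trans (p⊓q≤p c₀ 1ℚ) (c₀≤q n)

  open Bounds 0<c (p⊓q≤q c₀ 1ℚ)

  K = proj₁ (bounded x)
  K₀ = proj₁ (proj₂ (proj₂ (bounded x)))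
  L = K + 1ℚ

  0≤L : 0ℚ ≤ L
  0≤L = +-mono-≤ (<⇒≤ (proj₁ (proj₂ (bounded x)))) (nonNegative⁻¹ 1ℚ)

  ∣q-1∣≤L : ∀ n → K₀ ℕ.≤ n → ∣ q n - 1ℚ ∣ ≤ L
  ∣q-1∣≤L n K₀≤n = ≤-trans (∣p-q∣≤∣p∣+∣q∣ (q n) 1ℚ)
    (+-monoˡ-≤ 1ℚ (proj₂ (proj₂ (proj₂ (bounded x))) (N₀ ℕ.+ n) (ℕ.≤-trans K₀≤n (ℕ.m≤n+m n N₀))))

  cancel : ∀ e → e * (c * c) * (κ * κ) ≡ e
  cancel e = trans (solve 3 (λ e c k → e :* (c :* c) :* (k :* k) := e :* ((c :* k) :* (c :* k))) refl e c κ)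
    (trans (cong (e *_) (cong₂ _*_ (recip-inverseʳ 0<c) (recip-inverseʳ 0<c))) (*-identityʳ e))

  mesh : ∀ ε → 0ℚ < ε → ∀ m n N₂ → K₀ ℕ.≤ m → N₂ ℕ.≤ m → L * L * (κ * κ) ≤ fromℕ N₂ * (ε * (+ 1 / 3)) →
         ∣ riemann (suc m) (0<q m) - riemann (suc m ℕ.* suc n) (0<q m) ∣ ≤ ε * (+ 1 / 3)
  mesh ε 0<ε m n N₂ K₀≤m N₂≤m ar = begin
    ∣ riemann (suc m) (0<q m) - riemann (suc m ℕ.* suc n) (0<q m) ∣
      ≤⟨ refine m n (0<q m) (c≤q m) ⟩
    ∣ q m - 1ℚ ∣ * ∣ q m - 1ℚ ∣ * (κ * κ) * ν m
      ≤⟨ *-monoʳ-≤-nonNeg (ν m) {{nonNegative (0≤ν m)}} (≤-trans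
           (*-monoʳ-≤-nonNeg (κ * κ) {{nonNegative (*-nonNeg 0≤κ 0≤κ)}}
             (*-mono-≤ (0≤∣p∣ (q m - 1ℚ)) 0≤L (∣q-1∣≤L m K₀≤m) (∣q-1∣≤L m K₀≤m)))
           (≤-trans ar (*-monoʳ-≤-nonNeg (ε * (+ 1 / 3)) {{nonNegative (<⇒≤ (third 0<ε))}}
             (fromℕ-mono-≤ (ℕ.≤-trans N₂≤m (ℕ.n≤1+n m)))))) ⟩
    fromℕ (suc m) * (ε * (+ 1 / 3)) * ν m
      ≡⟨ solve 3 (λ n e y → n :* e :* y := n :* y :* e) refl (fromℕ (suc m)) (ε * (+ 1 / 3)) (ν m) ⟩
    fromℕ (suc m) * ν m * (ε * (+ 1 / 3))
      ≡⟨ trans (cong (_* (ε * (+ 1 / 3))) (recip-inverseʳ (0<fromℕ m))) (*-identityˡ _) ⟩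
    ε * (+ 1 / 3) ∎

-- A finite abelian group of order m n, with m and n coprime, splits into its m- and
-- n-torsion, and so do its subgroups; hence A is multiplicative. Abelian groups of order
-- p ^ k are sums of cyclic groups, so their classes are at most as many as the partitions
-- of k; hence A p = 2 and A (p ^ k) = O((16/9) ^ k) uniformly in p. Thus A agrees with
-- the divisor function d at the primes. Replace the values d (p ^ k) by A (p ^ k) for one
-- prime p after the other: this changes the sum over n ≤ x by a factor 1 + O(1/p²), and
-- each of the resulting sums is asymptotic to a multiple of x H x (H the harmonic
-- numbers), as that of d is. The sums converge uniformly relative to x H x, so the sum of
-- A is approximated by rational multiples of x H x to any precision; these multiples form
-- a Cauchy sequence, whose limit C is positive because A ≥ d. Finally H k = log x + O(1)
-- for k = ⌊x⌋.

module Submission where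

-- The passage from d to A at one prime is multiplication of Dirichlet series. With t standing for
-- p^(-s), the local factor of d is ∑ (k + 1) t^k = (1 - t)^(-2), so it is replaced by ∑ A(p^k) t^k
-- on multiplying by γ(t) = (1 - t)² ∑ A(p^k) t^k. As A(1) = 1 and A(p) = 2, γ(t) = 1 + O(t²): this
-- is the origin of the error O(1/p²). On summatory functions the multiplication reads S′(x) = ∑ γ_k
-- S(x / p^k). The obstacle is p = 2: the series ∑ |γ_k| 2^(-k) has to converge, so A(2^k) must grow
-- more slowly than 2^k. A(p^k) is bounded by a number of pairs of partitions, so partition numbers
-- O(η^k) with η² < 2 are required; η = 4/3 gives the 16/9. All estimates are made in ℚ. The limit C
-- is known only through the approximating multiples, and an explicit lower bound ½ for these turns
-- an error relative to x H x into one relative to C x log x.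

-- Divisibility: prime powers and coprime factors.

module Arithmetic where

  open import Data.List.Base using ([]; _∷_)
  open import Data.List.Relation.Unary.All using (_∷_)
  open import Data.Nat.Base
  open import Data.Nat.Coprimality as Coprime using (Coprime; coprime-divisor)
  open import Data.Nat.DivMod
  open import Data.Nat.Divisibility
  open import Data.Nat.ListAction using (product)
  open import Data.Nat.Induction using (<-rec)
  open import Data.Nat.Primality
  open import Data.Nat.Primality.Factorisation using (factorise)
  open import Data.Nat.Properties
  open import Data.Product using (∃; _×_; _,_)
  open import Data.Sum.Base using (_⊎_; inj₁; inj₂)
  open import Relation.Binary.PropositionalEquality
  open import Relation.Nullary using (¬_; Dec; yes; no; contradiction)

  leastPositive : ∀ {Q : ℕ → Set} → (∀ n → Dec (Q n)) → ∀ n → Q (suc n) →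
                  ∃ λ m → Q (suc m) × (∀ k → k < m → ¬ Q (suc k))
  leastPositive {Q} Q? n = <-rec (λ n → Q (suc n) → Least) step n
    where
    Least = ∃ λ m → Q (suc m) × (∀ k → k < m → ¬ Q (suc k))
    below : ∀ n → (∃ λ k → k < n × Q (suc k)) ⊎ (∀ k → k < n → ¬ Q (suc k))
    below zero = inj₂ λ _ ()
    below (suc n) with Q? (suc n)
    ... | yes q = inj₁ (n , ≤-refl , q)
    ... | no ¬q with below n
    ...   | inj₁ (k , k<n , q) = inj₁ (k , m<n⇒m<1+n k<n , q)
    ...   | inj₂ none = inj₂ λ k k<1+n q → case k<1+n q
      where
      case : ∀ {k} → k < suc n → ¬ Q (suc k)
      case {k} (s≤s k≤n) q with m≤n⇒m<n∨m≡n k≤n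
      ... | inj₁ k<n  = none k k<n q
      ... | inj₂ refl = ¬q q
    step : ∀ n → (∀ {m} → m < n → Q (suc m) → Least) → Q (suc n) → Least
    step n rec q with below n
    ... | inj₁ (k , k<n , q′) = rec k<n q′
    ... | inj₂ none           = n , q , none

  -- The remainder of `a` modulo the least positive element of `Q` lies in `Q` again, so it is 0.
  -- This serves for the order of an element and for the multiples of an element that fall into a
  -- subgroup.
  idealGenerator : ∀ {Q : ℕ → Set} → (∀ n → Dec (Q n)) →
                   (∀ a b → Q a → Q b → Q (a + b)) → (∀ a b → Q b → Q (a + b) → Q a) →
                   ∀ n → Q (suc n) → ∃ λ m → Q (suc m) × (∀ a → Q a → suc m ∣ a)
  idealGenerator {Q} Q? add sub n Qn with leastPositive Q? n Qn
  ... | m , Qm , least = m , Qm , λ a Qa → m%n≡0⇒n∣m a (suc m) (rem a Qa)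
    where
    multiple : ∀ k → Q 0 → Q (k * suc m)
    multiple zero    q0 = q0
    multiple (suc k) q0 = add (suc m) (k * suc m) Qm (multiple k q0)
    rem : ∀ a → Q a → a % suc m ≡ 0
    rem a Qa with a % suc m in eq | sub (a % suc m) (a / suc m * suc m)
                         (multiple (a / suc m) (sub 0 (suc m) Qm Qm))
                         (subst Q (m≡m%n+[m/n]*n a (suc m)) Qa)
    ... | zero  | _ = refl
    ... | suc r | q = contradiction q
                        (least r (s≤s⁻¹ (subst (_< suc m) eq (m%n<n a (suc m)))))

  primeDivisor : ∀ n → 2 ≤ n → ∃ λ p → Prime p × p ∣ n
  primeDivisor n@(suc _) 2≤n with factorise n
  ... | record { factors = []     ; isFactorisation = eq } = contradiction 2≤n (<⇒≱ (subst (_< 2) (sym eq) ≤-refl))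
  ... | record { factors = p ∷ ps ; isFactorisation = eq ; factorsPrime = pp ∷ _ } =
    p , pp , subst (p ∣_) (sym eq) (m∣m*n (product ps))

  2≤prime : ∀ {p} → Prime p → 2 ≤ p
  2≤prime pp = nonTrivial⇒n>1 _ {{prime⇒nonTrivial pp}}

  prime∣prime⇒≡ : ∀ {p q} → Prime p → Prime q → p ∣ q → p ≡ q
  prime∣prime⇒≡ pp pq p∣q with prime⇒irreducible pq p∣q
  ... | inj₁ refl = contradiction pp ¬prime[1]
  ... | inj₂ eq   = eq

  prime∣^⇒∣ : ∀ {p} → Prime p → ∀ m k → p ∣ m ^ k → p ∣ m
  prime∣^⇒∣ pp m zero    p∣1 = contradiction (subst Prime (∣1⇒≡1 p∣1) pp) ¬prime[1]
  prime∣^⇒∣ pp m (suc k) p∣ with euclidsLemma m (m ^ k) pp p∣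
  ... | inj₁ p∣m = p∣m
  ... | inj₂ p∣r = prime∣^⇒∣ pp m k p∣r

  noCommonPrime⇒coprime : ∀ {m n} → 0 < m → (∀ {p} → Prime p → p ∣ m → ¬ p ∣ n) → Coprime m n
  noCommonPrime⇒coprime {m} 0<m h {d} (d∣m , d∣n) with d
  ... | 0 = contradiction 0<m (<⇒≱ (s≤s (≤-reflexive (0∣⇒≡0 d∣m))))
  ... | 1 = refl
  ... | d@(suc (suc _)) = let p , pp , p∣d = primeDivisor d (s≤s (s≤s z≤n)) in
    contradiction (∣-trans p∣d d∣n) (h pp (∣-trans p∣d d∣m))

  prime-∤⇒coprime-^ : ∀ {p} → Prime p → ∀ k {m} → ¬ p ∣ m → Coprime (p ^ k) m
  prime-∤⇒coprime-^ {p} pp k ¬p∣m =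
    noCommonPrime⇒coprime (m^n>0 p {{prime⇒nonZero pp}} k) λ pq q∣p^k q∣m →
    ¬p∣m (subst (_∣ _) (prime∣prime⇒≡ pq pp (prime∣^⇒∣ pq p k q∣p^k)) q∣m)

  -- If p divides the cofactor of `m`, one p can be cancelled; otherwise the cofactor is a divisor
  -- of the prime power that is coprime to it, hence 1.
  ∣prime^suc : ∀ {p} → Prime p → ∀ j {m} → m ∣ p ^ suc j → m ∣ p ^ j ⊎ m ≡ p ^ suc j
  ∣prime^suc {p} pp j {m} (divides r eq) with p ∣? r
  ... | yes (divides s refl) = inj₁ (divides s (*-cancelˡ-≡ (p ^ j) (s * m) p {{prime⇒nonZero pp}}
          (trans eq (trans (cong (_* m) (*-comm s p)) (*-assoc p s m)))))
  ... | no ¬p∣r = inj₂ (trans (sym (*-identityˡ m)) (trans (cong (_* m) (sym r≡1)) (sym eq)))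
    where
    r≡1 : r ≡ 1
    r≡1 = prime-∤⇒coprime-^ pp (suc j) ¬p∣r (divides m (trans eq (*-comm r m)) , ∣-refl)

  record PrimePowerPart (p n : ℕ) : Set where
    constructor primePowerPart
    field
      exponent cofactor : ℕ
      factors  : n ≡ p ^ exponent * cofactor
      cofactor-∤ : ¬ p ∣ cofactor

  splitPrimePower : ∀ {p} → 2 ≤ p → ∀ n → 0 < n → PrimePowerPart p n
  splitPrimePower {p} 2≤p = <-rec (λ n → 0 < n → PrimePowerPart p n) step
    where
    step : ∀ n → (∀ {m} → m < n → 0 < m → PrimePowerPart p m) → 0 < n → PrimePowerPart p n
    step n rec 0<n with p ∣? n
    ... | no ¬p∣n = primePowerPart 0 n (sym (*-identityˡ n)) ¬p∣n
    ... | yes (divides m refl) with m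
    ...   | suc m′ with rec (m<m*n (suc m′) p 2≤p) (s≤s z≤n)
    ...     | primePowerPart v c eq ¬p∣c = primePowerPart (suc v) c
                (trans (*-comm (suc m′) p) (trans (cong (p *_) eq) (sym (*-assoc p (p ^ v) c)))) ¬p∣c

  n<2^n : ∀ n → n < 2 ^ n
  n<2^n zero    = ≤-refl
  n<2^n (suc n) = begin
    suc (suc n) ≤⟨ +-monoʳ-≤ 1 (n<2^n n) ⟩
    1 + 2 ^ n ≤⟨ +-monoˡ-≤ (2 ^ n) (m^n>0 2 n) ⟩
    2 ^ n + 2 ^ n ≡⟨ cong (2 ^ n +_) (+-identityʳ (2 ^ n)) ⟨
    2 * 2 ^ n ∎
    where open ≤-Reasoning

  n<m^n : ∀ {m} → 2 ≤ m → ∀ n → n < m ^ n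
  n<m^n 2≤m n = <-≤-trans (n<2^n n) (^-monoˡ-≤ n 2≤m)

  -- Coprimality gives a ∣ m and b ∣ n, and equal products leave no room. It will identify the
  -- orders of the torsion parts of a group of order m n.
  coprime-factors-≡ : ∀ {a b m n} → 0 < m → 0 < n → a * b ≡ m * n → Coprime a n → Coprime b m →
                      a ≡ m × b ≡ n
  coprime-factors-≡ {a} {b} {m@(suc _)} {n@(suc _)} _ _ eq a⊥n b⊥m = a≡m ,
      *-cancelˡ-≡ b n m (trans (cong (_* b) (sym a≡m)) eq)
    where
    a∣m : a ∣ m
    a∣m = coprime-divisor a⊥n (divides b (trans (*-comm n m) (trans (sym eq) (*-comm a b))))
    b∣n : b ∣ n
    b∣n = coprime-divisor b⊥m (divides a (sym eq))
    a≡m : a ≡ m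
    a≡m = ≤-antisym (∣⇒≤ a∣m) (*-cancelʳ-≤ m a n
      (≤-trans (≤-reflexive (sym eq)) (*-monoʳ-≤ a (∣⇒≤ b∣n))))

-- Finite abelian groups as setoids: embeddings, orders, subgroups, products.

module FiniteGroups where

  open import Defs using (AbelianGroupOn; _≅_; _≲_; IsSubgroup; subgroup)
  open import Algebra.Bundles using (AbelianGroup)
  import Algebra.Construct.DirectProduct as DirectProduct
  open import Algebra.Morphism.Structures using (module GroupMorphisms)
  import Algebra.Properties.CommutativeMonoid.Mult as Mult
  import Algebra.Properties.CommutativeMonoid.Sum as Sum
  import Algebra.Properties.Group as GroupProperties
  open import Data.Fin.Base using (Fin; combine; remQuot)
  open import Data.Fin.Permutation using (permutation)
  open import Data.Fin.Properties using (_≟_; any?; injective⇒≤; remQuot-combine; combine-remQuot)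
  open import Data.Fin.Subset using (_∈_)
  open import Data.List.Base using (List; []; _∷_; allFin; deduplicate; lookup; map)
  open import Data.List.Membership.Propositional using ()
  open import Data.List.Membership.Propositional.Properties using (∈-allFin; ∈-lookup)
  open import Data.List.Relation.Unary.All as All using ([]; _∷_)
  open import Data.List.Relation.Unary.AllPairs using (AllPairs; []; _∷_)
  open import Data.List.Relation.Unary.Any as Any using (Any; here; there; index)
  open import Data.List.Relation.Unary.Any.Properties using (lookup-index; deduplicate⁺; map⁺)
  import Data.List.Relation.Unary.Unique.DecSetoid.Properties as Unique
  open import Data.Nat.Base as ℕ using (ℕ; zero; suc)
  open import Data.Nat.DivMod
  import Data.Nat.Properties as ℕ
  open import Data.Product using (Σ; ∃; _×_; _,_; proj₁; proj₂)
  open import Data.Vec.Base using (tabulate)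
  open import Data.Vec.Properties using (lookup∘tabulate; lookup⇒[]=; []=⇒lookup)
  open import Level using (0ℓ)
  open import Relation.Binary.Bundles using (DecSetoid)
  open import Relation.Binary.PropositionalEquality as ≡ using (_≡_)
  open import Relation.Nullary using (¬_; Dec; yes; no; contradiction; does)
  open import Relation.Nullary.Decidable using (map′; dec-true)

  Group : Set₁
  Group = AbelianGroup 0ℓ 0ℓ


  module _ (X : Group) where
    open AbelianGroup X using (Carrier; _≈_; ε; commutativeMonoid)
    open Mult commutativeMonoid using () renaming (_×_ to _×ˣ_)

    multiple : ℕ → Carrier → Carrier
    multiple = _×ˣ_

    KilledBy : ℕ → Set
    KilledBy n = ∀ x → n ×ˣ x ≈ ε

    record Subgroup : Set₁ where
      open AbelianGroup X using (_∙_; _⁻¹)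
      field
        Member    : Carrier → Set
        member?   : ∀ x → Dec (Member x)
        resp      : ∀ {x y} → x ≈ y → Member x → Member y
        ε-closed  : Member ε
        ∙-closed  : ∀ {x y} → Member x → Member y → Member (x ∙ y)
        ⁻¹-closed : ∀ {x} → Member x → Member (x ⁻¹)

  module _ {X Y : Group} where
    private
      module X = AbelianGroup X
      module Y = AbelianGroup Y

    preserves-ε : (f : X.Carrier → Y.Carrier) → (∀ {x y} → x X.≈ y → f x Y.≈ f y) →
                  (∀ x y → f (x X.∙ y) Y.≈ f x Y.∙ f y) → f X.ε Y.≈ Y.ε
    preserves-ε f cong homo = begin
      f X.ε ≈⟨ Y.identityˡ _ ⟨
      Y.ε Y.∙ f X.ε ≈⟨ Y.∙-congʳ (Y.inverseˡ (f X.ε)) ⟨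
      f X.ε Y.⁻¹ Y.∙ f X.ε Y.∙ f X.ε ≈⟨ Y.assoc _ _ _ ⟩
      f X.ε Y.⁻¹ Y.∙ (f X.ε Y.∙ f X.ε)
        ≈⟨ Y.∙-congˡ (Y.trans (Y.sym (homo X.ε X.ε)) (cong (X.identityˡ X.ε))) ⟩
      f X.ε Y.⁻¹ Y.∙ f X.ε ≈⟨ Y.inverseˡ (f X.ε) ⟩
      Y.ε ∎
      where open import Relation.Binary.Reasoning.Setoid Y.setoid

  record Embedding (X Y : Group) : Set where
    private
      module X = AbelianGroup X
      module Y = AbelianGroup Y
    field
      to        : X.Carrier → Y.Carrier
      to-cong   : ∀ {x y} → x X.≈ y → to x Y.≈ to y
      homo      : ∀ x y → to (x X.∙ y) Y.≈ to x Y.∙ to y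
      injective : ∀ {x y} → to x Y.≈ to y → x X.≈ y

    ε-homo : to X.ε Y.≈ Y.ε
    ε-homo = preserves-ε {X} {Y} to to-cong homo

    ⁻¹-homo : ∀ x → to (x X.⁻¹) Y.≈ to x Y.⁻¹
    ⁻¹-homo x = GroupProperties.inverseˡ-unique Y.group _ _
      (Y.trans (Y.sym (homo (x X.⁻¹) x)) (Y.trans (to-cong (X.inverseˡ x)) ε-homo))

    ×-homo : ∀ n x → to (multiple X n x) Y.≈ multiple Y n (to x)
    ×-homo zero    x = ε-homo
    ×-homo (suc n) x = Y.trans (homo x _) (Y.∙-congˡ (×-homo n x))

  record Iso (X Y : Group) : Set where
    private
      module X = AbelianGroup X
      module Y = AbelianGroup Y
    field
      embedding : Embedding X Y
      from      : Y.Carrier → X.Carrier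
    open Embedding embedding public
    field
      to-from   : ∀ y → to (from y) Y.≈ y

    from-to : ∀ x → from (to x) X.≈ x
    from-to x = injective (to-from (to x))

    from-cong : ∀ {x y} → x Y.≈ y → from x X.≈ from y
    from-cong eq = injective (Y.trans (to-from _) (Y.trans eq (Y.sym (to-from _))))

  module _ {X Y : Group} where
    private
      module X = AbelianGroup X
      module Y = AbelianGroup Y

    kernel⇒embedding : (f : X.Carrier → Y.Carrier) → (∀ {x y} → x X.≈ y → f x Y.≈ f y) →
                       (∀ x y → f (x X.∙ y) Y.≈ f x Y.∙ f y) →
                       (∀ x → f x Y.≈ Y.ε → x X.≈ X.ε) → Embedding X Y
    kernel⇒embedding f cong homo kernel = record
      { to = f ; to-cong = cong ; homo = homo
      ; injective = λ {x} {y} eq → GroupProperties.x∙y⁻¹≈ε⇒x≈y X.group x y (kernel _ (begin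
          f (x X.∙ y X.⁻¹) ≈⟨ homo x (y X.⁻¹) ⟩
          f x Y.∙ f (y X.⁻¹) ≈⟨ Y.∙-congʳ eq ⟩
          f y Y.∙ f (y X.⁻¹) ≈⟨ homo y (y X.⁻¹) ⟨
          f (y X.∙ y X.⁻¹) ≈⟨ cong (X.inverseʳ y) ⟩
          f X.ε ≈⟨ preserves-ε {X} {Y} f cong homo ⟩
          Y.ε ∎))
      }
      where
      open import Relation.Binary.Reasoning.Setoid Y.setoid

  embedding-trans : ∀ {X Y Z} → Embedding X Y → Embedding Y Z → Embedding X Z
  embedding-trans {X} {Y} {Z} f g = record
    { to        = λ x → g.to (f.to x)
    ; to-cong   = λ eq → g.to-cong (f.to-cong eq)
    ; homo      = λ x y → AbelianGroup.trans Z (g.to-cong (f.homo x y)) (g.homo _ _)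
    ; injective = λ eq → f.injective (g.injective eq)
    }
    where
    module f = Embedding f
    module g = Embedding g

  iso-refl : ∀ {X} → Iso X X
  iso-refl {X} = record
    { embedding = record { to = λ x → x ; to-cong = λ eq → eq ; homo = λ _ _ → X.refl ; injective = λ eq → eq }
    ; from = λ x → x ; to-from = λ _ → X.refl }
    where module X = AbelianGroup X

  iso-sym : ∀ {X Y} → Iso X Y → Iso Y X
  iso-sym {X} {Y} f = record
    { embedding = record
      { to = from ; to-cong = from-cong
      ; homo = λ x y → injective (Y.trans (to-from _)
          (Y.sym (Y.trans (homo _ _) (Y.∙-cong (to-from x) (to-from y)))))
      ; injective = λ eq → Y.trans (Y.sym (to-from _)) (Y.trans (to-cong eq) (to-from _))
      }
    ; from = to ; to-from = from-to }
    where
    open Iso f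
    module Y = AbelianGroup Y

  iso-trans : ∀ {X Y Z} → Iso X Y → Iso Y Z → Iso X Z
  iso-trans {Z = Z} f g = record
    { embedding = embedding-trans f.embedding g.embedding
    ; from = λ z → f.from (g.from z)
    ; to-from = λ z → AbelianGroup.trans Z (g.to-cong (f.to-from (g.from z))) (g.to-from z) }
    where
    module f = Iso f
    module g = Iso g

  killedBy-embedding : ∀ {X Y} → Embedding X Y → ∀ n → KilledBy Y n → KilledBy X n
  killedBy-embedding {X} {Y} f n kill x =
    injective (Y.trans (×-homo n x) (Y.trans (kill (to x)) (Y.sym ε-homo)))
    where
    open Embedding f
    module Y = AbelianGroup Y

  ≅⇒iso : ∀ {X Y : Group} → X ≅ Y → Iso X Y
  ≅⇒iso {X} (f , iso) = record
    { embedding = record { to = f ; to-cong = ⟦⟧-cong ; homo = ∙-homo ; injective = injective }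
    ; from = λ y → proj₁ (surjective y)
    ; to-from = λ y → proj₂ (surjective y) (AbelianGroup.refl X) }
    where open GroupMorphisms.IsGroupIsomorphism iso

  iso⇒≅ : ∀ {X Y : Group} → Iso X Y → X ≅ Y
  iso⇒≅ {X} {Y} f = to , record
    { isGroupMonomorphism = record
      { isGroupHomomorphism = record
        { isMonoidHomomorphism = record
          { isMagmaHomomorphism = record { isRelHomomorphism = record { cong = to-cong } ; homo = homo }
          ; ε-homo = ε-homo
          }
        ; ⁻¹-homo = ⁻¹-homo
        }
      ; injective = injective
      }
    ; surjective = λ y → from y , λ eq → AbelianGroup.trans Y (to-cong eq) (to-from y)
    }
    where open Iso f

  open AbelianGroupOn using (abelianGroup)

  ≲⇒embedding : ∀ {m n} {H : AbelianGroupOn m} {G : AbelianGroupOn n} →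
                H ≲ G → Embedding (abelianGroup H) (abelianGroup G)
  ≲⇒embedding {H = H} {G} (S , S≤G , H≅S) = record
    { to = λ x → proj₁ (to x) ; to-cong = λ eq → to-cong eq ; homo = homo ; injective = injective }
    where open Iso (≅⇒iso {abelianGroup H} {subgroup G S S≤G} H≅S)

  embedding⇒≲ : ∀ {m n} {H : AbelianGroupOn m} {G : AbelianGroupOn n} →
                Embedding (abelianGroup H) (abelianGroup G) → H ≲ G
  embedding⇒≲ {m} {n} {H} {G} f = S , S≤G , iso⇒≅ {abelianGroup H} {subgroup G S S≤G} (record
    { embedding = record
      { to = λ x → to x , image⇒∈ (x , ≡.refl) ; to-cong = to-cong ; homo = homo ; injective = injective }
    ; from = λ y → proj₁ (∈⇒image (proj₂ y))
    ; to-from = λ y → proj₂ (∈⇒image (proj₂ y)) })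
    where
    open Embedding f
    module H = AbelianGroupOn H
    module G = AbelianGroupOn G
    image? : ∀ y → Dec (∃ λ x → to x ≡ y)
    image? y = any? λ x → to x ≟ y
    S = tabulate λ y → does (image? y)
    ∈⇒image : ∀ {y} → y ∈ S → ∃ λ x → to x ≡ y
    ∈⇒image {y} y∈S with image? y | ≡.trans (≡.sym (lookup∘tabulate (λ y → does (image? y)) y)) ([]=⇒lookup y∈S)
    ... | yes im | _ = im
    image⇒∈ : ∀ {y} → (∃ λ x → to x ≡ y) → y ∈ S
    image⇒∈ {y} im = lookup⇒[]= y S (≡.trans (lookup∘tabulate (λ y → does (image? y)) y) (dec-true (image? y) im))
    S≤G : IsSubgroup G S
    S≤G = record
      { ε-closed  = image⇒∈ (H.ε , ε-homo)
      ; ∙-closed  = λ x y x∈S y∈S → let a , fa≡x = ∈⇒image x∈S ; b , fb≡y = ∈⇒image y∈S in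
          image⇒∈ (a H.∙ b , ≡.trans (homo a b) (≡.cong₂ G._∙_ fa≡x fb≡y))
      ; ⁻¹-closed = λ x x∈S → let a , fa≡x = ∈⇒image x∈S in
          image⇒∈ (a H.⁻¹ , ≡.trans (⁻¹-homo a) (≡.cong G._⁻¹ fa≡x))
      }

  -- Torsion subgroups and cyclic groups carry an equality coarser than identity, so having n
  -- elements means a bijection of the classes with `Fin n`. It also makes the equality decidable.
  record Order (X : Group) (n : ℕ) : Set where
    private module X = AbelianGroup X
    field
      enum       : Fin n → X.Carrier
      code       : X.Carrier → Fin n
      code-cong  : ∀ {x y} → x X.≈ y → code x ≡ code y
      enum-code  : ∀ x → enum (code x) X.≈ x
      code-enum  : ∀ i → code (enum i) ≡ i

    code-injective : ∀ {x y} → code x ≡ code y → x X.≈ y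
    code-injective {x} {y} eq = X.trans (X.sym (enum-code x))
      (X.trans (X.reflexive (≡.cong enum eq)) (enum-code y))

    enum-injective : ∀ {i j} → enum i X.≈ enum j → i ≡ j
    enum-injective eq = ≡.trans (≡.sym (code-enum _)) (≡.trans (code-cong eq) (code-enum _))

    _≈?_ : ∀ x y → Dec (x X.≈ y)
    x ≈? y = map′ code-injective code-cong (code x ≟ code y)

  order-on : ∀ {n} (G : AbelianGroupOn n) → Order (abelianGroup G) n
  order-on G = record
    { enum = λ x → x ; code = λ x → x ; code-cong = λ eq → eq
    ; enum-code = λ _ → ≡.refl ; code-enum = λ _ → ≡.refl }

  embedding⇒≤ : ∀ {X Y m n} → Embedding X Y → Order X m → Order Y n → m ℕ.≤ n
  embedding⇒≤ f o p = injective⇒≤ {f = λ i → P.code (to (O.enum i))}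
    (λ eq → O.enum-injective (injective (P.code-injective eq)))
    where
    open Embedding f
    module O = Order o
    module P = Order p

  order-unique : ∀ {X Y m n} → Iso X Y → Order X m → Order Y n → m ≡ n
  order-unique f o p = ℕ.≤-antisym (embedding⇒≤ (Iso.embedding f) o p)
    (embedding⇒≤ (Iso.embedding (iso-sym f)) p o)

  order>0 : ∀ {X n} → Order X n → 0 ℕ.< n
  order>0 {X} {zero}  o with () ← Order.code o (AbelianGroup.ε X)
  order>0 {X} {suc n} o = ℕ.s≤s ℕ.z≤n

  module _ {X : Group} {n : ℕ} (o : Order X n) where
    open Order o
    private module X = AbelianGroup X

    realize : AbelianGroupOn n
    realize = record
      { _∙_ = _∙_ ; ε = ε ; _⁻¹ = _⁻¹
      ; isAbelianGroup = record
        { isGroup = record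
          { isMonoid = record
            { isSemigroup = record
              { isMagma = record { isEquivalence = ≡.isEquivalence ; ∙-cong = ≡.cong₂ _∙_ }
              ; assoc = λ i j k → code-cong (begin
                  enum (i ∙ j) X.∙ enum k ≈⟨ X.∙-congʳ (enum-code _) ⟩
                  enum i X.∙ enum j X.∙ enum k ≈⟨ X.assoc _ _ _ ⟩
                  enum i X.∙ (enum j X.∙ enum k) ≈⟨ X.∙-congˡ (enum-code _) ⟨
                  enum i X.∙ enum (j ∙ k) ∎)
              }
            ; identity =
                (λ i → ≡.trans (code-cong (X.trans (X.∙-congʳ (enum-code _)) (X.identityˡ _))) (code-enum i)) ,
                (λ i → ≡.trans (code-cong (X.trans (X.∙-congˡ (enum-code _)) (X.identityʳ _))) (code-enum i))
            }
          ; inverse =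
              (λ i → code-cong (X.trans (X.∙-congʳ (enum-code _)) (X.inverseˡ _))) ,
              (λ i → code-cong (X.trans (X.∙-congˡ (enum-code _)) (X.inverseʳ _)))
          ; ⁻¹-cong = ≡.cong _⁻¹
          }
        ; comm = λ i j → code-cong (X.comm _ _)
        }
      }
      where
      open import Relation.Binary.Reasoning.Setoid X.setoid
      _∙_ : Fin n → Fin n → Fin n
      i ∙ j = code (enum i X.∙ enum j)
      ε : Fin n
      ε = code X.ε
      _⁻¹ : Fin n → Fin n
      i ⁻¹ = code (enum i X.⁻¹)

    realize-iso : Iso X (abelianGroup realize)
    realize-iso = record
      { embedding = record
        { to = code ; to-cong = code-cong
        ; homo = λ x y → code-cong (X.sym (X.∙-cong (enum-code x) (enum-code y)))
        ; injective = code-injective }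
      ; from = enum ; to-from = code-enum }

  lookup-injective : ∀ {a ℓ} {A : Set a} {_≈_ : A → A → Set ℓ} → (∀ {x y} → x ≈ y → y ≈ x) →
                     ∀ {xs} → AllPairs (λ x y → ¬ x ≈ y) xs →
                     ∀ i j → lookup xs i ≈ lookup xs j → i ≡ j
  lookup-injective sym (px ∷ u) Fin.zero    Fin.zero    _  = ≡.refl
  lookup-injective sym (px ∷ u) Fin.zero    (Fin.suc j) eq = contradiction eq (All.lookup px (∈-lookup j))
  lookup-injective sym (px ∷ u) (Fin.suc i) Fin.zero    eq = contradiction (sym eq) (All.lookup px (∈-lookup i))
  lookup-injective sym (px ∷ u) (Fin.suc i) (Fin.suc j) eq = ≡.cong Fin.suc (lookup-injective sym u i j eq)

  -- Deduplication leaves pairwise inequivalent representatives, so positions in the shortened list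
  -- are well-defined codes.
  finite-order : ∀ {X} → (∀ x y → Dec (AbelianGroup._≈_ X x y)) →
                 ∀ xs → (∀ x → Any (AbelianGroup._≈_ X x) xs) → ∃ (Order X)
  finite-order {X} _≈?_ xs complete = _ , record
    { enum = lookup reps
    ; code = λ x → index (cover x)
    ; code-cong = λ {x} {y} x≈y → lookup-injective X.sym unique _ _
        (X.trans (X.sym (lookup-index (cover x))) (X.trans x≈y (lookup-index (cover y))))
    ; enum-code = λ x → X.sym (lookup-index (cover x))
    ; code-enum = λ i → lookup-injective X.sym unique _ i (X.sym (lookup-index (cover (lookup reps i)))) }
    where
    module X = AbelianGroup X
    S : DecSetoid 0ℓ 0ℓ
    S = record { isDecEquivalence = record { isEquivalence = X.isEquivalence ; _≟_ = _≈?_ } }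
    reps = deduplicate _≈?_ xs
    unique = Unique.deduplicate-! S xs
    cover : ∀ x → Any (x X.≈_) reps
    cover x = deduplicate⁺ _≈?_ (λ y≈z x≈z → X.trans x≈z (X.sym y≈z)) (complete x)

  gather : ∀ {a p} {A : Set a} {P : A → Set p} → (∀ x → Dec (P x)) → List A → List (Σ A P)
  gather P? [] = []
  gather P? (x ∷ xs) with P? x
  ... | yes p = (x , p) ∷ gather P? xs
  ... | no  _ = gather P? xs

  gather⁺ : ∀ {a p q} {A : Set a} {P : A → Set p} {Q : A → Set q} (P? : ∀ x → Dec (P x)) {xs} →
            Any (λ x → P x × Q x) xs → Any (λ y → Q (proj₁ y)) (gather P? xs)
  gather⁺ P? {x ∷ xs} (here (p , q)) with P? x
  ... | yes _ = here q
  ... | no ¬p = contradiction p ¬p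
  gather⁺ P? {x ∷ xs} (there any) with P? x
  ... | yes _ = there (gather⁺ P? any)
  ... | no  _ = gather⁺ P? any

  module _ {X : Group} (K : Subgroup X) where
    open AbelianGroup X
    open Subgroup K

    subgroupᵍ : Group
    subgroupᵍ = record
      { Carrier = Σ Carrier Member
      ; _≈_     = λ x y → proj₁ x ≈ proj₁ y
      ; _∙_     = λ x y → proj₁ x ∙ proj₁ y , ∙-closed (proj₂ x) (proj₂ y)
      ; ε       = ε , ε-closed
      ; _⁻¹     = λ x → proj₁ x ⁻¹ , ⁻¹-closed (proj₂ x)
      ; isAbelianGroup = record
        { isGroup = record
          { isMonoid = record
            { isSemigroup = record
              { isMagma = record
                { isEquivalence = record { refl = refl ; sym = sym ; trans = trans }
                ; ∙-cong = ∙-cong }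
              ; assoc = λ _ _ _ → assoc _ _ _
              }
            ; identity = (λ _ → identityˡ _) , (λ _ → identityʳ _)
            }
          ; inverse = (λ _ → inverseˡ _) , (λ _ → inverseʳ _)
          ; ⁻¹-cong = ⁻¹-cong
          }
        ; comm = λ _ _ → comm _ _
        }
      }

    inclusion : Embedding subgroupᵍ X
    inclusion = record
      { to = proj₁ ; to-cong = λ eq → eq ; homo = λ _ _ → refl ; injective = λ eq → eq }

    subgroup-order : ∀ {n} → Order X n → ∃ (Order subgroupᵍ)
    subgroup-order {n} o = finite-order (λ x y → proj₁ x ≈? proj₁ y)
      (gather member? (map enum (allFin n)))
      λ (x , k) → gather⁺ {Q = x ≈_} member? (map⁺ (Any.map
        (λ { ≡.refl → resp (sym (enum-code x)) k , sym (enum-code x) }) (∈-allFin (code x))))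
      where open Order o

  infixr 5 _×ᵍ_

  _×ᵍ_ : Group → Group → Group
  _×ᵍ_ = DirectProduct.abelianGroup

  embedding-× : ∀ {X X′ Y Y′} → Embedding X Y → Embedding X′ Y′ → Embedding (X ×ᵍ X′) (Y ×ᵍ Y′)
  embedding-× f g = record
    { to = λ (x , y) → f.to x , g.to y
    ; to-cong = λ (p , q) → f.to-cong p , g.to-cong q
    ; homo = λ (x , y) (x′ , y′) → f.homo x x′ , g.homo y y′
    ; injective = λ (p , q) → f.injective p , g.injective q }
    where
    module f = Embedding f
    module g = Embedding g

  iso-× : ∀ {X X′ Y Y′} → Iso X Y → Iso X′ Y′ → Iso (X ×ᵍ X′) (Y ×ᵍ Y′)
  iso-× f g = record
    { embedding = embedding-× f.embedding g.embedding
    ; from = λ (x , y) → f.from x , g.from y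
    ; to-from = λ (x , y) → f.to-from x , g.to-from y }
    where
    module f = Iso f
    module g = Iso g

  order-× : ∀ {X Y m n} → Order X m → Order Y n → Order (X ×ᵍ Y) (m ℕ.* n)
  order-× {X} {Y} {m} {n} o p = record
    { enum = λ k → O.enum (proj₁ (remQuot n k)) , P.enum (proj₂ (remQuot {m} n k))
    ; code = λ (x , y) → combine (O.code x) (P.code y)
    ; code-cong = λ (eq , eq′) → ≡.cong₂ combine (O.code-cong eq) (P.code-cong eq′)
    ; enum-code = λ (x , y) →
        X.trans (X.reflexive (≡.cong (λ z → O.enum (proj₁ z)) (remQuot-combine (O.code x) (P.code y)))) (O.enum-code x) ,
        Y.trans (Y.reflexive (≡.cong (λ z → P.enum (proj₂ z)) (remQuot-combine (O.code x) (P.code y)))) (P.enum-code y)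
    ; code-enum = λ k → ≡.trans (≡.cong₂ combine (O.code-enum _) (P.code-enum _)) (combine-remQuot {m} n k) }
    where
    module X = AbelianGroup X
    module Y = AbelianGroup Y
    module O = Order o
    module P = Order p

  inclusionˡ : ∀ {X Y} → Embedding X (X ×ᵍ Y)
  inclusionˡ {X} {Y} = record
    { to = λ x → x , Y.ε ; to-cong = λ eq → eq , Y.refl
    ; homo = λ _ _ → X.refl , Y.sym (Y.identityˡ Y.ε) ; injective = proj₁ }
    where
    module X = AbelianGroup X
    module Y = AbelianGroup Y

  ×-swap : ∀ {X Y} → Iso (X ×ᵍ Y) (Y ×ᵍ X)
  ×-swap {X} {Y} = record
    { embedding = record
      { to = λ (x , y) → y , x ; to-cong = λ (p , q) → q , p
      ; homo = λ _ _ → Y.refl , X.refl ; injective = λ (p , q) → q , p }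
    ; from = λ (y , x) → x , y ; to-from = λ _ → Y.refl , X.refl }
    where
    module X = AbelianGroup X
    module Y = AbelianGroup Y

  -- The sum of all elements is not changed by a translation.
  lagrange : ∀ {X n} → Order X n → KilledBy X n
  lagrange {X} {n} o x = begin
    n · x ≈⟨ identityʳ _ ⟨
    n · x ∙ ε ≈⟨ ∙-congˡ (inverseʳ (sum enum)) ⟨
    n · x ∙ (sum enum ∙ sum enum ⁻¹) ≈⟨ assoc _ _ _ ⟨
    n · x ∙ sum enum ∙ sum enum ⁻¹ ≈⟨ ∙-congʳ (∙-congʳ (sum-replicate n)) ⟨
    sum {n} (λ _ → x) ∙ sum enum ∙ sum enum ⁻¹ ≈⟨ ∙-congʳ (∑-distrib-+ (λ _ → x) enum) ⟨
    sum (λ i → x ∙ enum i) ∙ sum enum ⁻¹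
      ≈⟨ ∙-congʳ (sum-cong-≋ {n} (λ i → sym (enum-code (x ∙ enum i)))) ⟩
    sum (λ i → enum (code (x ∙ enum i))) ∙ sum enum ⁻¹ ≈⟨ ∙-congʳ (sum-permute enum π) ⟨
    sum enum ∙ sum enum ⁻¹ ≈⟨ inverseʳ (sum enum) ⟩
    ε ∎
    where
    open AbelianGroup X
    open Order o
    open Mult commutativeMonoid renaming (_×_ to _·_)
    open Sum commutativeMonoid using (sum; sum-replicate; ∑-distrib-+; sum-cong-≋; sum-permute)
    open import Relation.Binary.Reasoning.Setoid setoid
    cancel : ∀ a b c → a ∙ b ≈ ε → a ∙ (b ∙ c) ≈ c
    cancel a b c eq = trans (sym (assoc a b c)) (trans (∙-congʳ eq) (identityˡ c))
    inverted : ∀ a b → a ∙ b ≈ ε → ∀ i → code (a ∙ enum (code (b ∙ enum i))) ≡ i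
    inverted a b eq i = ≡.trans (code-cong (trans (∙-congˡ (enum-code _)) (cancel a b (enum i) eq))) (code-enum i)
    π = permutation (λ i → code (x ∙ enum i)) (λ i → code (x ⁻¹ ∙ enum i))
          (inverted x (x ⁻¹) (inverseʳ x)) (inverted (x ⁻¹) x (inverseˡ x))

-- Cyclic groups, torsion subgroups and the splitting into coprime parts.

module Torsion where

  open Arithmetic
  open FiniteGroups
  open import Algebra.Bundles using (AbelianGroup)
  import Algebra.Properties.CommutativeMonoid.Mult as Mult
  import Algebra.Properties.Group as GroupProperties
  import Algebra.Solver.CommutativeMonoid as Solver
  open import Data.Fin.Base using (toℕ; fromℕ<)
  open import Data.Fin.Properties using (toℕ-fromℕ<; toℕ-injective; toℕ<n)
  open import Data.Nat.Base as ℕ using (ℕ; zero; suc; NonZero)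
  open import Data.Nat.Coprimality as Coprime using (Coprime; coprime-Bézout)
  open import Data.Nat.DivMod
  open import Data.Nat.Divisibility
  open import Data.Nat.GCD using (module Bézout)
  import Data.Nat.Properties as ℕ
  open import Data.Product using (Σ; _×_; _,_; proj₁; proj₂)
  open import Relation.Binary.PropositionalEquality as ≡ using (_≡_)
  open import Relation.Nullary using (Dec)

  -- ℤ/q on the carrier ℕ, with congruence as equality; multiplication by q - 1 provides negatives
  -- without subtraction.
  cyclic : ∀ q .{{_ : NonZero q}} → Group
  cyclic q = record
    { Carrier = ℕ
    ; _≈_ = λ a b → a % q ≡ b % q
    ; _∙_ = ℕ._+_
    ; ε = 0
    ; _⁻¹ = λ a → a ℕ.* ℕ.pred q
    ; isAbelianGroup = record
      { isGroup = record
        { isMonoid = record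
          { isSemigroup = record
            { isMagma = record
              { isEquivalence = record { refl = ≡.refl ; sym = ≡.sym ; trans = ≡.trans }
              ; ∙-cong = λ {a} {b} {c} {d} eq eq′ → ≡.trans (%-distribˡ-+ a c q)
                  (≡.trans (≡.cong₂ (λ r s → (r ℕ.+ s) % q) eq eq′) (≡.sym (%-distribˡ-+ b d q))) }
            ; assoc = λ a b c → ≡.cong (_% q) (ℕ.+-assoc a b c)
            }
          ; identity = (λ _ → ≡.refl) , λ a → ≡.cong (_% q) (ℕ.+-identityʳ a)
          }
        ; inverse = (λ a → ≡.trans (≡.cong (_% q) (ℕ.+-comm (a ℕ.* ℕ.pred q) a)) (inverse a)) , inverse
        ; ⁻¹-cong = λ {a} {b} eq → ≡.trans (%-distribˡ-* a (ℕ.pred q) q)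
            (≡.trans (≡.cong (λ r → (r ℕ.* (ℕ.pred q % q)) % q) eq) (≡.sym (%-distribˡ-* b (ℕ.pred q) q)))
        }
      ; comm = λ a b → ≡.cong (_% q) (ℕ.+-comm a b)
      }
    }
    where
    inverse : ∀ a → (a ℕ.+ a ℕ.* ℕ.pred q) % q ≡ 0 % q
    inverse a = ≡.trans (≡.cong (_% q) (≡.trans (≡.sym (ℕ.*-suc a (ℕ.pred q)))
        (≡.cong (a ℕ.*_) (ℕ.suc-pred q)))) (≡.trans (m*n%n≡0 a q) (≡.sym (m*n%n≡0 0 q)))

  cyclic-order : ∀ q .{{_ : NonZero q}} → Order (cyclic q) q
  cyclic-order q = record
    { enum = toℕ
    ; code = λ a → fromℕ< (m%n<n a q)
    ; code-cong = λ eq → toℕ-injective (≡.trans (toℕ-fromℕ< _) (≡.trans eq (≡.sym (toℕ-fromℕ< _))))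
    ; enum-code = λ a → ≡.trans (≡.cong (_% q) (toℕ-fromℕ< (m%n<n a q))) (m%n%n≡m%n a q)
    ; code-enum = λ i → toℕ-injective (≡.trans (toℕ-fromℕ< _) (m<n⇒m%n≡m (toℕ<n i))) }

  cyclic-embedding : ∀ d e .{{_ : NonZero d}} .{{_ : NonZero e}} .{{_ : NonZero (d ℕ.* e)}} →
                     Embedding (cyclic d) (cyclic (d ℕ.* e))
  cyclic-embedding d e = record
    { to = ℕ._* e
    ; to-cong = λ {a} {b} eq → ≡.trans (≡.sym (m%n*o≡m*o%[n*o] a d e))
        (≡.trans (≡.cong (ℕ._* e) eq) (m%n*o≡m*o%[n*o] b d e))
    ; homo = λ a b → ≡.cong (_% (d ℕ.* e)) (ℕ.*-distribʳ-+ e a b)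
    ; injective = λ {a} {b} eq → ℕ.*-cancelʳ-≡ (a % d) (b % d) e
        (≡.trans (m%n*o≡m*o%[n*o] a d e) (≡.trans eq (≡.sym (m%n*o≡m*o%[n*o] b d e)))) }

  module _ (X : Group) where
    open AbelianGroup X
    open Mult commutativeMonoid renaming (_×_ to _·_)
    open GroupProperties group
    open import Relation.Binary.Reasoning.Setoid setoid

    ·-ε : ∀ n → n · ε ≈ ε
    ·-ε zero    = refl
    ·-ε (suc n) = trans (identityˡ _) (·-ε n)

    ·-killed : ∀ {q x} → q · x ≈ ε → ∀ {a} → q ∣ a → a · x ≈ ε
    ·-killed {q} {x} qx (divides r ≡.refl) = trans (sym (×-assocˡ x r q)) (trans (×-congʳ r qx) (·-ε r))

    coprime-killed : ∀ {m n x} → Coprime m n → m · x ≈ ε → n · x ≈ ε → x ≈ ε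
    coprime-killed {m} {n} {x} m⊥n mx nx with coprime-Bézout m⊥n
    ... | Bézout.+- a b eq = begin
      x ≈⟨ identityʳ x ⟨
      x ∙ ε ≈⟨ ∙-congˡ (·-killed nx (divides b ≡.refl)) ⟨
      (1 ℕ.+ b ℕ.* n) · x ≈⟨ ×-congˡ eq ⟩
      (a ℕ.* m) · x ≈⟨ ·-killed mx (divides a ≡.refl) ⟩
      ε ∎
    ... | Bézout.-+ a b eq = begin
      x ≈⟨ identityʳ x ⟨
      x ∙ ε ≈⟨ ∙-congˡ (·-killed mx (divides a ≡.refl)) ⟨
      (1 ℕ.+ a ℕ.* m) · x ≈⟨ ×-congˡ eq ⟩
      (b ℕ.* n) · x ≈⟨ ·-killed nx (divides b ≡.refl) ⟩
      ε ∎

    ⁻¹-· : ∀ n x → n · (x ⁻¹) ≈ (n · x) ⁻¹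
    ⁻¹-· n x = inverseˡ-unique _ _ (trans (sym (×-distrib-+ (x ⁻¹) x n)) (trans (×-congʳ n (inverseˡ x)) (·-ε n)))

    torsion : (∀ x y → Dec (x ≈ y)) → ℕ → Subgroup X
    torsion _≈?_ m = record
      { Member    = λ x → m · x ≈ ε
      ; member?   = λ x → (m · x) ≈? ε
      ; resp      = λ x≈y mx → trans (×-congʳ m (sym x≈y)) mx
      ; ε-closed  = ·-ε m
      ; ∙-closed  = λ {x} {y} mx my → trans (×-distrib-+ x y m) (trans (∙-cong mx my) (identityˡ ε))
      ; ⁻¹-closed = λ {x} mx → trans (⁻¹-· m x) (trans (⁻¹-cong mx) ε⁻¹≈ε)
      }

    torsion-killed : ∀ (_≈?_ : ∀ x y → Dec (x ≈ y)) m → KilledBy (subgroupᵍ (torsion _≈?_ m)) m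
    torsion-killed _≈?_ m (x , mx) = trans (Embedding.×-homo (inclusion (torsion _≈?_ m)) m (x , mx)) mx

    -- The map is (x, y) ↦ x ∙ y. If x ∙ y is trivial, then x is killed by n as well as by m, hence
    -- trivial. Bézout writes z as a multiple of n z combined with a multiple of m z, one of them
    -- inverted; these lie in the m- and the n-torsion.
    primary-decomposition : (_≈?_ : ∀ x y → Dec (x ≈ y)) → ∀ {m n} → Coprime m n → KilledBy X (m ℕ.* n) →
      Iso (subgroupᵍ (torsion _≈?_ m) ×ᵍ subgroupᵍ (torsion _≈?_ n)) X
    primary-decomposition _≈?_ {m} {n} m⊥n kill = record
      { embedding = kernel⇒embedding (λ ((x , _) , (y , _)) → x ∙ y)
          (λ (p , q) → ∙-cong p q)
          (λ ((x , _) , (y , _)) ((x′ , _) , (y′ , _)) →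
            solve 4 (λ a b c d → (a ⊕ b) ⊕ (c ⊕ d) ⊜ (a ⊕ c) ⊕ (b ⊕ d)) refl x x′ y y′)
          (λ ((x , mx) , (y , ny)) xy≈ε →
            let x≈ε = coprime-killed m⊥n mx (begin
                  n · x ≈⟨ identityʳ _ ⟨
                  n · x ∙ ε ≈⟨ ∙-congˡ ny ⟨
                  n · x ∙ n · y ≈⟨ ×-distrib-+ x y n ⟨
                  n · (x ∙ y) ≈⟨ ×-congʳ n xy≈ε ⟩
                  n · ε ≈⟨ ·-ε n ⟩
                  ε ∎)
            in x≈ε , trans (sym (identityˡ y)) (trans (∙-congʳ (sym x≈ε)) xy≈ε))
      ; from = λ z → proj₁ (split z) , proj₁ (proj₂ (split z))
      ; to-from = λ z → proj₂ (proj₂ (split z))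
      }
      where
      open Solver commutativeMonoid
      Tor : ℕ → Set
      Tor m = Σ Carrier λ x → m · x ≈ ε
      partₙ : ∀ a z → n · ((a ℕ.* m) · z) ≈ ε
      partₙ a z = trans (×-assocˡ z n (a ℕ.* m)) (·-killed (kill z)
        (divides a (≡.trans (ℕ.*-comm n (a ℕ.* m)) (ℕ.*-assoc a m n))))
      partₘ : ∀ b z → m · ((b ℕ.* n) · z) ≈ ε
      partₘ b z = trans (×-assocˡ z m (b ℕ.* n)) (·-killed (kill z)
        (divides b (≡.trans (≡.sym (ℕ.*-assoc m b n)) (≡.trans (≡.cong (ℕ._* n) (ℕ.*-comm m b)) (ℕ.*-assoc b m n)))))
      split : ∀ z → Σ (Tor m) λ x → Σ (Tor n) λ y → proj₁ x ∙ proj₁ y ≈ z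
      split z with coprime-Bézout m⊥n
      ... | Bézout.+- a b eq =
        (((b ℕ.* n) · z) ⁻¹ , Subgroup.⁻¹-closed (torsion _≈?_ m) (partₘ b z)) , ((a ℕ.* m) · z , partₙ a z) , (begin
          ((b ℕ.* n) · z) ⁻¹ ∙ (a ℕ.* m) · z ≈⟨ ∙-congˡ (×-congˡ (≡.sym eq)) ⟩
          ((b ℕ.* n) · z) ⁻¹ ∙ (z ∙ (b ℕ.* n) · z) ≈⟨ ∙-congˡ (comm z _) ⟩
          ((b ℕ.* n) · z) ⁻¹ ∙ ((b ℕ.* n) · z ∙ z) ≈⟨ \\-leftDividesʳ _ z ⟩
          z ∎)
      ... | Bézout.-+ a b eq =
        ((b ℕ.* n) · z , partₘ b z) , (((a ℕ.* m) · z) ⁻¹ , Subgroup.⁻¹-closed (torsion _≈?_ n) (partₙ a z)) , (begin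
          (b ℕ.* n) · z ∙ ((a ℕ.* m) · z) ⁻¹ ≈⟨ ∙-congʳ (×-congˡ (≡.sym eq)) ⟩
          z ∙ (a ℕ.* m) · z ∙ ((a ℕ.* m) · z) ⁻¹ ≈⟨ //-rightDividesʳ _ z ⟩
          z ∎)

  torsion-embedding : ∀ {X Y} (f : Embedding X Y) (_≈?_ : ∀ x y → Dec (AbelianGroup._≈_ X x y))
                      (_≈?′_ : ∀ x y → Dec (AbelianGroup._≈_ Y x y)) m →
                      Embedding (subgroupᵍ (torsion X _≈?_ m)) (subgroupᵍ (torsion Y _≈?′_ m))
  torsion-embedding {Y = Y} f _ _ m = record
    { to = λ (x , mx) → to x , Y.trans (Y.sym (×-homo m x)) (Y.trans (to-cong mx) ε-homo)
    ; to-cong = to-cong ; homo = λ (x , _) (y , _) → homo x y ; injective = injective }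
    where
    open Embedding f
    module Y = AbelianGroup Y

  coprime-homo-trivial : ∀ {X Y m n} → Coprime m n → KilledBy X m → KilledBy Y n → ∀ {Z} (f : Embedding X (Z ×ᵍ Y)) →
                         ∀ x → AbelianGroup._≈_ Y (proj₂ (Embedding.to f x)) (AbelianGroup.ε Y)
  coprime-homo-trivial {X} {Y} {m} m⊥n killX killY {Z} f x = coprime-killed Y m⊥n
      (Y.trans (Y.sym (proj₂-· m (to x))) (proj₂ (Z×Y.trans (Z×Y.sym (×-homo m x)) (Z×Y.trans (to-cong (killX x)) ε-homo))))
      (killY _)
    where
    open Embedding f
    module Y = AbelianGroup Y
    module Z×Y = AbelianGroup (Z ×ᵍ Y)
    proj₂-· : ∀ k z → proj₂ (multiple (Z ×ᵍ Y) k z) Y.≈ multiple Y k (proj₂ z)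
    proj₂-· zero    z = Y.refl
    proj₂-· (suc k) z = Y.∙-congˡ (proj₂-· k z)

  -- The isomorphism carries X into the part of the product with trivial Y′-component, since that
  -- component is killed by both m and n; its inverse does the same to Y. So both restrict to the
  -- first factors.
  cancel-coprime-× : ∀ {X X′ Y Y′ m n} → Coprime m n → KilledBy X m → KilledBy Y m →
                     KilledBy X′ n → KilledBy Y′ n → Iso (X ×ᵍ X′) (Y ×ᵍ Y′) → Iso X Y
  cancel-coprime-× {X} {X′} {Y} {Y′} m⊥n killX killY killX′ killY′ f = record
    { embedding = record
      { to = λ x → proj₁ (i.to x) ; to-cong = λ eq → proj₁ (i.to-cong eq)
      ; homo = λ x y → proj₁ (i.homo x y)
      ; injective = λ eq → i.injective (eq , Y′.trans (coprime-homo-trivial m⊥n killX killY′ i _)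
          (Y′.sym (coprime-homo-trivial m⊥n killX killY′ i _))) }
    ; from = λ y → proj₁ (j.to y)
    ; to-from = λ y → proj₁ (Y×Y′.trans
        (f.to-cong (X.refl , X′.sym (coprime-homo-trivial m⊥n killY killX′ j y)))
        (f.to-from (y , Y′.ε)))
    }
    where
    module f = Iso f
    module i = Embedding (embedding-trans (inclusionˡ {X} {X′}) (Iso.embedding f))
    module j = Embedding (embedding-trans (inclusionˡ {Y} {Y′}) (Iso.embedding (iso-sym f)))
    i = embedding-trans (inclusionˡ {X} {X′}) (Iso.embedding f)
    j = embedding-trans (inclusionˡ {Y} {Y′}) (Iso.embedding (iso-sym f))
    module X = AbelianGroup X
    module X′ = AbelianGroup X′
    module Y′ = AbelianGroup Y′
    module Y×Y′ = AbelianGroup (Y ×ᵍ Y′)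

-- An element whose order is the exponent of the group generates a direct factor.

module CyclicFactors where

  open Arithmetic
  open FiniteGroups
  open Torsion
  open import Algebra.Bundles using (AbelianGroup)
  import Algebra.Properties.CommutativeMonoid.Mult as Mult
  import Algebra.Properties.Group as GroupProperties
  import Algebra.Properties.AbelianGroup as AbelianGroupProperties
  import Algebra.Solver.CommutativeMonoid as Solver
  open import Data.Fin.Base using (toℕ; fromℕ<)
  open import Data.Fin.Properties using (any?; toℕ-fromℕ<)
  open import Data.List.Base using ([]; _∷_; allFin; map)
  open import Data.List.Relation.Unary.All as All using (All; []; _∷_)
  import Data.List.Relation.Unary.All.Properties as All
  open import Data.List.Membership.Propositional.Properties using (∈-allFin)
  open import Data.Nat.Base as ℕ using (ℕ; zero; suc; NonZero)
  open import Data.Nat.DivMod using (_%_; _/_; m%n<n; m≡m%n+[m/n]*n; m*n%n≡0)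
  open import Data.Nat.Divisibility
  import Data.Nat.Properties as ℕ
  open import Data.Product using (Σ; ∃; _×_; _,_; proj₁; proj₂)
  open import Relation.Binary.PropositionalEquality as ≡ using (_≡_)
  open import Relation.Nullary using (contradiction)
  open import Relation.Nullary.Decidable using (map′)

  module Splitting (X : Group) {q : ℕ} .{{q≢0 : NonZero q}} (kill : KilledBy X q) where
    open AbelianGroup X
    open Mult commutativeMonoid renaming (_×_ to _·_)
    open GroupProperties group
    open AbelianGroupProperties X using (⁻¹-∙-comm)
    open Solver commutativeMonoid using (solve; _⊕_; _⊜_)
    open Subgroup
    open import Relation.Binary.Reasoning.Setoid setoid

    ·-mod : ∀ b y → (b % q) · y ≈ b · y
    ·-mod b y = begin
      (b % q) · y ≈⟨ identityʳ _ ⟨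
      (b % q) · y ∙ ε
        ≈⟨ ∙-congˡ (·-killed X (kill y) (divides (b / q) ≡.refl)) ⟨
      (b % q) · y ∙ (b / q ℕ.* q) · y ≈⟨ ×-homo-+ y (b % q) _ ⟨
      (b % q ℕ.+ b / q ℕ.* q) · y ≈⟨ ×-congˡ (m≡m%n+[m/n]*n b q) ⟨
      b · y ∎

    ·-pred : ∀ b y → (b ℕ.* ℕ.pred q) · y ≈ (b · y) ⁻¹
    ·-pred b y = inverseʳ-unique _ _ (begin
      b · y ∙ (b ℕ.* ℕ.pred q) · y ≈⟨ ×-homo-+ y b _ ⟨
      (b ℕ.+ b ℕ.* ℕ.pred q) · y
        ≈⟨ ×-congˡ (≡.trans (≡.sym (ℕ.*-suc b _)) (≡.cong (b ℕ.*_) (ℕ.suc-pred q))) ⟩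
      (b ℕ.* q) · y ≈⟨ ·-killed X (kill y) (divides b ≡.refl) ⟩
      ε ∎)

    ·-closed : ∀ (K : Subgroup X) {z} n → Member K z → Member K (n · z)
    ·-closed K zero    k = ε-closed K
    ·-closed K (suc n) k = ∙-closed K k (·-closed K n k)

    -- The sign of b does not matter since X has finite exponent.
    adjoin : Subgroup X → Carrier → Subgroup X
    adjoin K y = record
      { Member    = λ z → ∃ λ b → Member K (z ∙ b · y)
      ; member?   = λ z → map′
          (λ (b , k) → toℕ b , k)
          (λ (b , k) → fromℕ< (m%n<n b q) , resp K (∙-congˡ (trans (sym (·-mod b y))
            (×-congˡ (≡.sym (toℕ-fromℕ< (m%n<n b q)))))) k)
          (any? {q} λ b → member? K (z ∙ toℕ b · y))
      ; resp      = λ eq (b , k) → b , resp K (∙-congʳ eq) k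
      ; ε-closed  = 0 , resp K (sym (identityˡ ε)) (ε-closed K)
      ; ∙-closed  = λ {z} {w} (b , k) (c , l) → b ℕ.+ c , resp K
          (trans (solve 4 (λ z b w c → (z ⊕ b) ⊕ (w ⊕ c) ⊜ (z ⊕ w) ⊕ (b ⊕ c)) refl z (b · y) w (c · y))
            (∙-congˡ (sym (×-homo-+ y b c)))) (∙-closed K k l)
      ; ⁻¹-closed = λ {z} (b , k) → b ℕ.* ℕ.pred q , resp K
          (trans (sym (⁻¹-∙-comm z (b · y))) (∙-congˡ (sym (·-pred b y)))) (⁻¹-closed K k)
      }

    _⊆_ : Subgroup X → Subgroup X → Set
    K ⊆ L = ∀ {z} → Member K z → Member L z

    adjoin-⊇ : ∀ (K : Subgroup X) y → K ⊆ adjoin K y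
    adjoin-⊇ K y {z} k = 0 , resp K (sym (identityʳ z)) k

    cancelʳ : ∀ (K : Subgroup X) {z w} → Member K w → Member K (z ∙ w) → Member K z
    cancelʳ K {z} {w} l k = resp K (//-rightDividesʳ w z) (∙-closed K k (⁻¹-closed K l))

    module _ (x : Carrier) where

      -- Since q kills x, this says at once that x has order q and that K meets the subgroup
      -- generated by x trivially.
      Independent : Subgroup X → Set
      Independent K = ∀ a → Member K (a · x) → q ∣ a

      Enlargement : Subgroup X → Carrier → Set₁
      Enlargement K y = Σ (Subgroup X) λ L → Independent L × K ⊆ L × Member (adjoin L x) y

      module _ (K : Subgroup X) (ind : Independent K) (y : Carrier) where

        private
          Q : ℕ → Set
          Q m = Member (adjoin K x) (m · y)

        -- If M y is the least multiple of y in K + ⟨x⟩, say M y + a x ∈ K, then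
        -- M ∣ a, as q kills y, and K + ⟨y + (a / M) x⟩ is still independent of x.
        enlargeBy : ∀ m → Q (suc m) → (∀ b → Q b → suc m ∣ b) → suc m ∣ q → Enlargement K y
        enlargeBy m (a , k) M∣ (divides zero    eq) = contradiction eq (ℕ.≢-nonZero⁻¹ q)
        enlargeBy m (a , k) M∣ (divides (suc r) eq) =
          adjoin K y′ , ind′ , adjoin-⊇ K y′ , a′ , ℕ.pred q , resp K (sym y′-killed) (ε-closed K)
          where
          M = suc m
          M∣a : M ∣ a
          M∣a = *-cancelˡ-∣ (suc r) (≡.subst (_∣ suc r ℕ.* a) eq
            (ind (suc r ℕ.* a) (resp K (begin
              suc r · (M · y ∙ a · x) ≈⟨ ×-distrib-+ _ _ (suc r) ⟩
              suc r · (M · y) ∙ suc r · (a · x)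
                ≈⟨ ∙-cong (×-assocˡ y (suc r) M) (×-assocˡ x (suc r) a) ⟩
              (suc r ℕ.* M) · y ∙ (suc r ℕ.* a) · x
                ≈⟨ ∙-congʳ (trans (×-congˡ (≡.sym eq)) (kill y)) ⟩
              ε ∙ (suc r ℕ.* a) · x ≈⟨ identityˡ _ ⟩
              (suc r ℕ.* a) · x ∎) (·-closed K (suc r) k))))
          a′ = quotient M∣a
          y′ = y ∙ a′ · x
          y′-killed : y ∙ a′ · x ∙ ℕ.pred q · y′ ≈ ε
          y′-killed = trans (×-congˡ (ℕ.suc-pred q)) (kill y′)
          My′ : Member K (M · y′)
          My′ = resp K (sym (begin
            M · (y ∙ a′ · x) ≈⟨ ×-distrib-+ y _ M ⟩
            M · y ∙ M · (a′ · x) ≈⟨ ∙-congˡ (×-assocˡ x M a′) ⟩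
            M · y ∙ (M ℕ.* a′) · x ≈⟨ ∙-congˡ (×-congˡ (≡.sym (m∣n⇒n≡m*quotient M∣a))) ⟩
            M · y ∙ a · x ∎)) k
          by′ : ∀ b → M ∣ b → Member K (b · y′)
          by′ b (divides s ≡.refl) = resp K (×-assocˡ y′ s M) (·-closed K s My′)
          ind′ : Independent (adjoin K y′)
          ind′ c (b , l) = ind c (cancelʳ K (by′ b (M∣ b (c ℕ.+ b ℕ.* a′ , resp K (begin
            c · x ∙ b · (y ∙ a′ · x) ≈⟨ ∙-congˡ (×-distrib-+ y _ b) ⟩
            c · x ∙ (b · y ∙ b · (a′ · x)) ≈⟨ ∙-congˡ (∙-congˡ (×-assocˡ x b a′)) ⟩
            c · x ∙ (b · y ∙ (b ℕ.* a′) · x)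
              ≈⟨ solve 3 (λ c b d → c ⊕ (b ⊕ d) ⊜ b ⊕ (c ⊕ d)) refl _ _ _ ⟩
            b · y ∙ (c · x ∙ (b ℕ.* a′) · x) ≈⟨ ∙-congˡ (×-homo-+ x c (b ℕ.* a′)) ⟨
            b · y ∙ (c ℕ.+ b ℕ.* a′) · x ∎) l))) l)

        -- The m with m y in K + ⟨x⟩ form an ideal containing q, as q kills y. Its generator is the
        -- M of `enlargeBy`, and it divides q.
        enlarge : Enlargement K y
        enlarge =
          let m , Qm , M∣ = idealGenerator {Q} (λ m → member? (adjoin K x) (m · y))
                (λ a b qa qb → resp (adjoin K x) (sym (×-homo-+ y a b)) (∙-closed (adjoin K x) {a · y} {b · y} qa qb))
                (λ a b qb qab → cancelʳ (adjoin K x) {a · y} {b · y} qb (resp (adjoin K x) (×-homo-+ y a b) qab))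
                (ℕ.pred q) (≡.subst Q (≡.sym (ℕ.suc-pred q)) Qq)
          in enlargeBy m Qm M∣ (M∣ q Qq)
          where
          Qq : Q q
          Qq = resp (adjoin K x) (sym (kill y)) (ε-closed (adjoin K x))

      enlargeAll : ∀ K → Independent K → ∀ ys → Σ (Subgroup X) λ L →
                   Independent L × K ⊆ L × All (Member (adjoin L x)) ys
      enlargeAll K ind []       = K , ind , (λ k → k) , []
      enlargeAll K ind (y ∷ ys) =
        let L , ind′ , K⊆L , (b , l) = enlarge K ind y
            N , ind″ , L⊆N , all = enlargeAll L ind′ ys
        in N , ind″ , (λ k → L⊆N (K⊆L k)) , (b , L⊆N l) ∷ all

      -- The complement grows from the trivial subgroup: each element of the enumeration of X is
      -- absorbed in turn while independence of x is kept. At the end every y has some y + a x in K,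
      -- and y = (-a) x + (y + a x) is its decomposition.
      splitCyclic : ∀ {n} → Order X n → (∀ a → a · x ≈ ε → q ∣ a) →
                    Σ (Subgroup X) λ K → Iso (cyclic q ×ᵍ subgroupᵍ K) X
      splitCyclic o order-x = K , record
        { embedding = kernel⇒embedding (λ (a , (k , _)) → a · x ∙ k)
            (λ {(a , _)} {(b , _)} (eq , eq′) → ∙-cong
              (trans (sym (·-mod a x)) (trans (×-congˡ eq) (·-mod b x))) eq′)
            (λ (a , (k , _)) (b , (l , _)) → trans (∙-congʳ (×-homo-+ x a b))
              (solve 4 (λ a b k l → (a ⊕ b) ⊕ (k ⊕ l) ⊜ (a ⊕ k) ⊕ (b ⊕ l)) refl (a · x) (b · x) k l))
            (λ (a , (k , m)) eq →
              let q∣a = ind a (resp K (sym (inverseˡ-unique _ _ eq)) (⁻¹-closed K m))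
              in ≡.trans (n∣m⇒m%n≡0 a q q∣a) (≡.sym (m*n%n≡0 0 q)) ,
                 trans (sym (identityˡ k)) (trans (∙-congʳ (sym (·-killed X (kill x) q∣a))) eq))
        ; from = λ y → proj₁ (split y) ℕ.* ℕ.pred q , (y ∙ proj₁ (split y) · x , proj₂ (split y))
        ; to-from = λ y → let a = proj₁ (split y) in begin
            (a ℕ.* ℕ.pred q) · x ∙ (y ∙ a · x) ≈⟨ ∙-cong (·-pred a x) (comm y _) ⟩
            (a · x) ⁻¹ ∙ (a · x ∙ y) ≈⟨ \\-leftDividesʳ _ y ⟩
            y ∎
        }
        where
        open Order o
        trivial : Subgroup X
        trivial = record
          { Member = _≈ ε ; member? = _≈? ε ; resp = λ eq z → trans (sym eq) z ; ε-closed = refl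
          ; ∙-closed = λ p r → trans (∙-cong p r) (identityˡ ε) ; ⁻¹-closed = λ p → trans (⁻¹-cong p) ε⁻¹≈ε }
        result = enlargeAll trivial order-x (map enum (allFin _))
        K = proj₁ result
        ind = proj₁ (proj₂ result)
        split : ∀ y → Member (adjoin K x) y
        split y = resp (adjoin K x) (enum-code y)
          (All.lookup (All.map⁻ (proj₂ (proj₂ (proj₂ result)))) (∈-allFin (code y)))

-- Types of abelian p-groups and the orders of torsion subgroups.

module PGroups where

  open Arithmetic
  open FiniteGroups
  open Torsion
  open CyclicFactors
  open import Algebra.Bundles using (AbelianGroup)
  import Algebra.Properties.CommutativeMonoid.Mult as Mult
  open import Data.Bool.Base using (if_then_else_)
  open import Data.Fin.Properties using (any?)
  open import Data.List.Base using (List; []; _∷_; _++_; map)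
  open import Data.List.Relation.Unary.Any as Any using (Any; here)
  open import Data.List.Relation.Unary.Any.Properties using (++⁺ˡ; ++⁺ʳ; map⁺)
  open import Data.Nat.Base as ℕ using (ℕ; zero; suc; NonZero; _^_; _≤_; _<_; s≤s; z≤n)
  open import Data.Nat.Coprimality as Coprime using (Coprime)
  open import Data.Nat.Divisibility using (_∣_; ∣-trans; divides)
  open import Data.Nat.Induction using (<-rec)
  open import Data.Nat.Primality
  open import Data.Nat.DivMod using (n%1≡0)
  import Data.Nat.Properties as ℕ
  open import Data.Product using (∃; _×_; _,_; proj₁; proj₂)
  open import Data.Sum.Base using (_⊎_; inj₁; inj₂)
  open import Relation.Binary.PropositionalEquality as ≡ using (_≡_)
  open import Relation.Nullary using (¬_; Dec; yes; no; contradiction; does; ¬?)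
  open import Relation.Nullary.Decidable using (dec-true; decidable-stable)

  -- The partitions of k with parts at most j and at most n parts, in
  -- nonincreasing order (all partitions with parts at most j if n ≥ k).
  partitions : (j n k : ℕ) → List (List ℕ)
  partitions zero    n       zero    = [] ∷ []
  partitions zero    n       (suc k) = []
  partitions (suc j) zero    k       = partitions j zero k
  partitions (suc j) (suc n) k       = partitions j (suc n) k ++
    (if does (suc j ℕ.≤? k) then map (suc j ∷_) (partitions (suc j) n (k ℕ.∸ suc j)) else [])

  partitions-⊆ : ∀ {p} {P : List ℕ → Set p} j n k → Any P (partitions j n k) → Any P (partitions (suc j) n k)
  partitions-⊆ j zero    k any = any
  partitions-⊆ j (suc n) k any = ++⁺ˡ any

  partitions-∷ : ∀ {p} {P : List ℕ → Set p} j n k → Any (λ c → P (suc j ∷ c)) (partitions (suc j) n k) →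
                 Any P (partitions (suc j) (suc n) (suc j ℕ.+ k))
  partitions-∷ {P = P} j n k any = ++⁺ʳ (partitions j (suc n) (suc j ℕ.+ k))
    (≡.subst (λ b → Any P (if b then map (suc j ∷_) (partitions (suc j) n (suc j ℕ.+ k ℕ.∸ suc j)) else []))
      (≡.sym (dec-true (suc j ℕ.≤? suc j ℕ.+ k) (ℕ.m≤m+n (suc j) k)))
      (map⁺ (≡.subst (λ k → Any (λ c → P (suc j ∷ c)) (partitions (suc j) n k)) (≡.sym (ℕ.m+n∸m≡n (suc j) k)) any)))

  killedBy-1 : ∀ {X} → KilledBy X 1 → Iso X (cyclic 1)
  killedBy-1 {X} kill = record
    { embedding = record
      { to = λ _ → 0 ; to-cong = λ _ → ≡.refl ; homo = λ _ _ → ≡.refl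
      ; injective = λ {x} {y} _ → X.trans (trivial x) (X.sym (trivial y)) }
    ; from = λ _ → X.ε
    ; to-from = λ n → ≡.sym (n%1≡0 n) }
    where
    module X = AbelianGroup X
    trivial : ∀ x → x X.≈ X.ε
    trivial x = X.trans (X.sym (X.identityʳ x)) (kill x)

  module _ {p : ℕ} (pp : Prime p) where
    private instance
      p≢0 : NonZero p
      p≢0 = prime⇒nonZero pp
    p^≢0 : ∀ k → NonZero (p ^ k)
    p^≢0 k = ℕ.m^n≢0 p k

    ofType : List ℕ → Group
    ofType []      = cyclic 1
    ofType (a ∷ c) = cyclic (p ^ a) {{p^≢0 a}} ×ᵍ ofType c

    -- The bound n on the number of parts is left free because each part uses up one unit of it: the
    -- complement of a cyclic factor is needed with n - 1.
    HasType : Group → ℕ → ℕ → Set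
    HasType X j i = ∀ n → i ≤ n → Any (λ c → Iso X (ofType c)) (partitions j n i)

    -- The order of x divides p^(j + 1) but not p^j, so it is p^(j + 1).
    exact-order : ∀ X {n} → Order X n → (let open AbelianGroup X) → ∀ j x →
                  multiple X (p ^ suc j) x ≈ ε → ¬ multiple X (p ^ j) x ≈ ε →
                  ∀ a → multiple X a x ≈ ε → p ^ suc j ∣ a
    exact-order X o j x qx ¬q′x a ax =
      let m , Qm , M∣ = idealGenerator {λ a → a · x ≈ ε} (λ a → (a · x) ≈? ε)
            (λ a b ax bx → trans (×-homo-+ x a b) (trans (∙-cong ax bx) (identityˡ ε)))
            (λ a b bx abx → trans (sym (trans (∙-congˡ bx) (identityʳ _))) (trans (sym (×-homo-+ x a b)) abx))
            (ℕ.pred (p ^ suc j)) (trans (×-congˡ (ℕ.suc-pred (p ^ suc j) {{p^≢0 (suc j)}})) qx)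
      in ≡.subst (_∣ a) (M≡q Qm (∣prime^suc pp j (M∣ (p ^ suc j) qx))) (M∣ a ax)
      where
      open AbelianGroup X
      open Mult commutativeMonoid renaming (_×_ to _·_)
      open Order o
      M≡q : ∀ {M} → M · x ≈ ε → M ∣ p ^ j ⊎ M ≡ p ^ suc j → M ≡ p ^ suc j
      M≡q Mx (inj₁ M∣q′) = contradiction (·-killed X Mx M∣q′) ¬q′x
      M≡q Mx (inj₂ eq)   = eq

    PGroupType : ℕ → Set₁
    PGroupType N = ∀ j X → Order X N → KilledBy X (p ^ j) → ∃ λ i → N ≡ p ^ i × HasType X j i

    -- The complement has smaller order and is still killed by p^(j + 1), so its parts are at most j
    -- + 1 and the new part may stand in front of them.
    split-type : ∀ {N} → (∀ {m} → m < N → PGroupType m) → ∀ j {X} → Order X N → KilledBy X (p ^ suc j) →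
                 (∃ λ K → Iso (cyclic (p ^ suc j) {{p^≢0 (suc j)}} ×ᵍ subgroupᵍ {X} K) X) →
                 ∃ λ i → N ≡ p ^ i × HasType X (suc j) i
    split-type {N} rec j {X} o kill (K , iso) = combine (subgroup-order K o)
      where
      instance _ = p^≢0 (suc j)
      1<q : 1 < p ^ suc j
      1<q = ℕ.≤-<-trans (s≤s z≤n) (n<m^n (2≤prime pp) (suc j))
      combine : ∃ (Order (subgroupᵍ K)) → ∃ λ i → N ≡ p ^ i × HasType X (suc j) i
      combine (M , oK) with order-unique (iso-sym iso) o (order-× (cyclic-order (p ^ suc j)) oK)
      ... | N≡ with rec (≡.subst (M <_) (≡.trans (ℕ.*-comm M (p ^ suc j)) (≡.sym N≡))
                          (ℕ.m<m*n M (p ^ suc j) {{ℕ.>-nonZero (order>0 oK)}} 1<q))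
                        (suc j) (subgroupᵍ K) oK (killedBy-embedding (inclusion K) (p ^ suc j) kill)
      ...   | i , M≡ , type = suc j ℕ.+ i ,
        ≡.trans N≡ (≡.trans (≡.cong (p ^ suc j ℕ.*_) M≡) (≡.sym (ℕ.^-distribˡ-+-* p (suc j) i))) ,
        λ { (suc n) (s≤s j+i≤n) → partitions-∷ j n i
              (Any.map (λ K≅c → iso-trans (iso-sym iso) (iso-× iso-refl K≅c))
                (type n (ℕ.≤-trans (ℕ.m≤n+m i j) j+i≤n))) }

    -- Induction on the order, and inside it on the exponent p^j: either p^(j - 1) kills the group
    -- already, or an element of order p^j splits off. That the order is a power of p comes out of
    -- the same induction.
    p-group-type : ∀ N → PGroupType N
    p-group-type = <-rec PGroupType λ N rec → step N λ {m} → rec {m}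
      where
      step : ∀ N → (∀ {m} → m < N → PGroupType m) → PGroupType N
      step N rec zero X o kill = 0 , order-unique (killedBy-1 kill) o (cyclic-order 1) , λ _ _ → here (killedBy-1 kill)
      step N rec (suc j) X o kill = decide (any? λ i → ¬? (multiple X (p ^ j) (enum i) ≈? ε))
        where
        open Order o
        open AbelianGroup X
        open Mult commutativeMonoid using (×-congʳ)
        decide : Dec (∃ λ i → ¬ multiple X (p ^ j) (enum i) ≈ ε) → ∃ λ i → N ≡ p ^ i × HasType X (suc j) i
        decide (no none) =
          let i , eq , type = step N rec j X o λ x → trans (×-congʳ (p ^ j) (sym (enum-code x)))
                (decidable-stable (_ ≈? _) (λ ¬q → none (code x , ¬q)))
          in i , eq , λ n i≤n → partitions-⊆ j n i (type n i≤n)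
        decide (yes (k , ¬q′x)) = split-type rec j o kill
          (Splitting.splitCyclic X {{p^≢0 (suc j)}} kill (enum k) o
            (exact-order X o j (enum k) (kill (enum k)) ¬q′x))

  -- Strong induction on m. For a prime q ∣ m the q-primary part has order a power of q, by
  -- `p-group-type`; the complementary part is killed by the cofactor, which is smaller than m.
  prime∣order : ∀ m → 0 < m → ∀ {X N p} → KilledBy X m → Order X N → Prime p → p ∣ N → p ∣ m
  prime∣order m 0<m = <-rec Claim (λ m rec → step m λ {k} → rec {k}) m 0<m _ _
    where
    Claim : ℕ → Set₁
    Claim m = 0 < m → ∀ X N {p} → KilledBy X m → Order X N → Prime p → p ∣ N → p ∣ m
    step : ∀ m → (∀ {k} → k < m → Claim k) → Claim m
    step (suc zero) rec _ _ _ kill o pp p∣N =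
      ≡.subst (_ ∣_) (order-unique (killedBy-1 kill) o (cyclic-order 1)) p∣N
    step m@(suc (suc _)) rec 0<m X N {p} kill o pp p∣N =
      let q , pq , q∣m = primeDivisor m (s≤s (s≤s z≤n)) in viaPrime pq q∣m (splitPrimePower (2≤prime pq) m 0<m)
      where
      _≈?_ = Order._≈?_ o
      viaPrime : ∀ {q} → Prime q → q ∣ m → PrimePowerPart q m → p ∣ m
      viaPrime {q} pq q∣m (primePowerPart zero    c m≡ ¬q∣c) =
        contradiction (≡.subst (q ∣_) (≡.trans m≡ (ℕ.*-identityˡ c)) q∣m) ¬q∣c
      viaPrime {q} pq q∣m (primePowerPart (suc a) c m≡ ¬q∣c) =
        finish (subgroup-order (torsion X _≈?_ (q ^ suc a)) o) (subgroup-order (torsion X _≈?_ c) o)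
        where
        0<c : 0 < c
        0<c = ℕ.n≢0⇒n>0 λ c≡0 → contradiction
          (≡.trans m≡ (≡.trans (≡.cong (q ^ suc a ℕ.*_) c≡0) (ℕ.*-zeroʳ (q ^ suc a)))) λ ()
        c<m : c < m
        c<m = ≡.subst (c <_) (≡.trans (ℕ.*-comm c (q ^ suc a)) (≡.sym m≡))
          (ℕ.m<m*n c (q ^ suc a) {{ℕ.>-nonZero 0<c}} (ℕ.≤-<-trans (s≤s z≤n) (n<m^n (2≤prime pq) (suc a))))
        iso = primary-decomposition X _≈?_ {q ^ suc a} {c}
          (prime-∤⇒coprime-^ pq (suc a) ¬q∣c) (≡.subst (KilledBy X) m≡ kill)
        finish : ∃ (Order (subgroupᵍ (torsion X _≈?_ (q ^ suc a)))) → ∃ (Order (subgroupᵍ (torsion X _≈?_ c))) → p ∣ m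
        finish (M , oM) (L , oL) = cases (euclidsLemma M L pp (≡.subst (p ∣_) (order-unique (iso-sym iso) o (order-× oM oL)) p∣N))
          where
          cases : p ∣ M ⊎ p ∣ L → p ∣ m
          cases (inj₁ p∣M) = let i , M≡ , _ = p-group-type pq M (suc a) _ oM (torsion-killed X _≈?_ (q ^ suc a)) in
            ≡.subst (_∣ m) (≡.sym (prime∣prime⇒≡ pp pq (prime∣^⇒∣ pp q i (≡.subst (p ∣_) M≡ p∣M)))) q∣m
          cases (inj₂ p∣L) = ∣-trans (rec c<m 0<c _ _ (torsion-killed X _≈?_ c) oL pp p∣L) (divides (q ^ suc a) m≡)

  -- The two orders multiply to m n by the decomposition, and by `prime∣order` the primes of the
  -- first divide m and those of the second divide n. So they are m and n.
  torsion-order : ∀ {X m n} → 0 < m → 0 < n → Coprime m n → (o : Order X (m ℕ.* n)) →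
                  Order (subgroupᵍ (torsion X (Order._≈?_ o) m)) m × Order (subgroupᵍ (torsion X (Order._≈?_ o) n)) n
  torsion-order {X} {m} {n} 0<m 0<n m⊥n o =
    ≡.subst (Order Xₘ) (proj₁ orders) oₘ , ≡.subst (Order Xₙ) (proj₂ orders) oₙ
    where
    _≈?_ = Order._≈?_ o
    Xₘ = subgroupᵍ (torsion X _≈?_ m)
    Xₙ = subgroupᵍ (torsion X _≈?_ n)
    oₘ = proj₂ (subgroup-order (torsion X _≈?_ m) o)
    oₙ = proj₂ (subgroup-order (torsion X _≈?_ n) o)
    noCommon : ∀ {a b p} → Coprime a b → Prime p → p ∣ a → ¬ p ∣ b
    noCommon a⊥b pp p∣a p∣b = ¬prime[1] (≡.subst Prime (a⊥b (p∣a , p∣b)) pp)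
    orders = coprime-factors-≡ 0<m 0<n
      (order-unique (primary-decomposition X _≈?_ m⊥n (lagrange o)) (order-× oₘ oₙ) o)
      (noCommonPrime⇒coprime (order>0 oₘ) λ pp p∣ → noCommon m⊥n pp (prime∣order m 0<m (torsion-killed X _≈?_ m) oₘ pp p∣))
      (noCommonPrime⇒coprime (order>0 oₙ) λ pp p∣ → noCommon (Coprime.sym m⊥n) pp (prime∣order n 0<n (torsion-killed X _≈?_ n) oₙ pp p∣))

-- A n as the number of classes of pairs of a group and a subgroup.

module SubgroupPairs where

  open FiniteGroups
  open import Defs using (AbelianGroupOn; groups; isoClasses; subgroupClasses; A; _≅_; _≅?_; _≲_; _≲?_; isAbelianGroup?)
  import Algebra.Morphism.GroupMonomorphism as GroupMonomorphism
  open import Algebra.Structures using (IsAbelianGroup)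
  open import Data.Fin.Base using (Fin; finToFun; funToFin)
  open import Data.Fin.Properties using (injective⇒≤; finToFun-funToFin)
  open import Data.List.Base using (List; []; _∷_; map; concatMap; filter; length; lookup; upTo; cartesianProduct)
  open import Data.List.Membership.Propositional using (lose)
  open import Data.List.Membership.Propositional.Properties using (∈-allFin; ∈-cartesianProduct⁺; ∈-upTo⁺)
  open import Data.List.Properties using (length-++; length-map; map-cong)
  open import Data.List.Relation.Unary.All as All using (All; []; _∷_)
  import Data.List.Relation.Unary.All.Properties as All
  open import Data.List.Relation.Unary.AllPairs as AllPairs using (AllPairs; []; _∷_)
  import Data.List.Relation.Unary.AllPairs.Properties as AllPairs
  open import Data.List.Relation.Unary.Any as Any using (Any; index)
  import Data.List.Relation.Unary.Any.Properties as Any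
  import Data.List.Relation.Unary.Unique.DecSetoid.Properties as UniqueDec
  open import Data.List.Relation.Unary.Unique.Propositional.Properties using (upTo⁺)
  import Data.Maybe.Base as Maybe
  import Data.Maybe.Relation.Unary.Any as MaybeAny
  open import Data.Nat.Base as ℕ using (ℕ; suc; _≤_; s≤s)
  open import Data.Nat.ListAction using (sum)
  open import Data.Nat.Primality
  import Data.Nat.Properties as ℕ
  open import Data.Product using (_×_; _,_; proj₁)
  open import Function.Base using (_∘_)
  open import Level using (0ℓ)
  open import Relation.Binary.Bundles using (Setoid; DecSetoid)
  open import Relation.Binary.PropositionalEquality as ≡ using (_≡_)
  open import Relation.Nullary using (¬_; Dec; yes; no; contradiction)
  open import Relation.Nullary.Decidable using (dec⇒maybe)

  open AbelianGroupOn using (abelianGroup)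

  -- Every comparison of numbers of classes rests on this. It takes a relation instead of a
  -- function, since a class corresponds only up to isomorphism to an entry of the other list.
  pigeonhole : ∀ {a b r e} {A : Set a} {B : Set b} {E : A → A → Set e} (R : A → B → Set r) →
               (∀ {x y} → E x y → E y x) → (∀ {x y z} → R x z → R y z → E x y) →
               ∀ {xs ys} → AllPairs (λ x y → ¬ E x y) xs → (∀ x → Any (R x) ys) → length xs ≤ length ys
  pigeonhole {E = E} R sym common {xs} {ys} distinct cover =
    injective⇒≤ {f = λ i → index (cover (lookup xs i))} λ {i} {j} eq →
      lookup-injective sym distinct i j (common (Any.lookup-index (cover (lookup xs i)))
        (≡.subst (λ k → R (lookup xs j) (lookup ys k)) (≡.sym eq) (Any.lookup-index (cover (lookup xs j)))))

  module _ {a b} {A : Set a} {B : Set b} where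

    length-concatMap : ∀ (f : A → List B) xs → length (concatMap f xs) ≡ sum (map (length ∘ f) xs)
    length-concatMap f []       = ≡.refl
    length-concatMap f (x ∷ xs) = ≡.trans (length-++ (f x)) (≡.cong (length (f x) ℕ.+_) (length-concatMap f xs))

    length-cartesianProduct : ∀ (xs : List A) (ys : List B) → length (cartesianProduct xs ys) ≡ length xs ℕ.* length ys
    length-cartesianProduct []       ys = ≡.refl
    length-cartesianProduct (x ∷ xs) ys = ≡.trans (length-++ (map (x ,_) ys))
      (≡.cong₂ ℕ._+_ (length-map (x ,_) ys) (length-cartesianProduct xs ys))

    -- `Tag` remembers the source of an element, so that elements with different sources can be told
    -- apart by them.
    concatMap-AllPairs : ∀ {r s t} {R : A → A → Set r} {S : B → B → Set s} (Tag : A → B → Set t) →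
      (f : A → List B) → (∀ x → All (Tag x) (f x)) → (∀ x → AllPairs S (f x)) →
      (∀ {x y b c} → R x y → Tag x b → Tag y c → S b c) →
      ∀ {xs} → AllPairs R xs → AllPairs S (concatMap f xs)
    concatMap-AllPairs Tag f tag pairs across {xs} R-xs = AllPairs.concat⁺
      (All.map⁺ (All.universal pairs xs))
      (AllPairs.map⁺ (AllPairs.map (λ {x} {y} Rxy → All.map (λ t → All.map (across Rxy t) (tag y)) (tag x)) R-xs))

  module _ {a p} {A : Set a} {P : A → Set p} (P? : ∀ x → Dec (P x)) where

    length-gather : ∀ xs → length (gather P? xs) ≡ length (filter P? xs)
    length-gather [] = ≡.refl
    length-gather (x ∷ xs) with P? x
    ... | yes _ = ≡.cong suc (length-gather xs)
    ... | no  _ = length-gather xs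

    gather-All : ∀ {q} {Q : A → Set q} {xs} → All Q xs → All (Q ∘ proj₁) (gather P? xs)
    gather-All [] = []
    gather-All {xs = x ∷ xs} (q ∷ qs) with P? x
    ... | yes _ = q ∷ gather-All qs
    ... | no  _ = gather-All qs

    gather-AllPairs : ∀ {r} {R : A → A → Set r} {xs} → AllPairs R xs → AllPairs (λ y z → R (proj₁ y) (proj₁ z)) (gather P? xs)
    gather-AllPairs [] = []
    gather-AllPairs {xs = x ∷ xs} (r ∷ rs) with P? x
    ... | yes _ = gather-All r ∷ gather-AllPairs rs
    ... | no  _ = gather-AllPairs rs

  iso-setoid : ℕ → DecSetoid 0ℓ 0ℓ
  iso-setoid n = record
    { Carrier = AbelianGroupOn n
    ; _≈_ = λ G H → abelianGroup G ≅ abelianGroup H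
    ; isDecEquivalence = record
      { isEquivalence = record
        { refl  = λ {G} → iso⇒≅ (iso-refl {abelianGroup G})
        ; sym   = λ {G} {H} G≅H → iso⇒≅ (iso-sym (≅⇒iso {abelianGroup G} {abelianGroup H} G≅H))
        ; trans = λ {G} {H} {K} G≅H H≅K → iso⇒≅ (iso-trans (≅⇒iso {abelianGroup G} {abelianGroup H} G≅H)
                    (≅⇒iso {abelianGroup H} {abelianGroup K} H≅K))
        }
      ; _≟_ = _≅?_ } }

  isoClasses-distinct : ∀ n → AllPairs (λ G H → ¬ abelianGroup G ≅ abelianGroup H) (isoClasses n)
  isoClasses-distinct n = UniqueDec.deduplicate-! (iso-setoid n) (groups n)

  module _ {n} (G : AbelianGroupOn n) where
    private module G = AbelianGroupOn G

    -- Coding the operations by elements of `Fin` and decoding them returns the same functions only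
    -- pointwise; the group axioms are therefore transported along the identity map.
    module Pointwise (_∙_ : Fin n → Fin n → Fin n) (_⁻¹ : Fin n → Fin n)
                     (∙≗ : ∀ x y → x ∙ y ≡ x G.∙ y) (⁻¹≗ : ∀ x → x ⁻¹ ≡ x G.⁻¹) where

      isAbelianGroup : IsAbelianGroup _≡_ _∙_ G.ε _⁻¹
      isAbelianGroup = GroupMonomorphism.isAbelianGroup (record
        { isGroupHomomorphism = record
          { isMonoidHomomorphism = record
            { isMagmaHomomorphism = record { isRelHomomorphism = record { cong = λ eq → eq } ; homo = ∙≗ }
            ; ε-homo = ≡.refl }
          ; ⁻¹-homo = ⁻¹≗ }
        ; injective = λ eq → eq }) G.isAbelianGroup

      iso : ∀ isAbelianGroup → Iso (abelianGroup G)
        (abelianGroup (record { _∙_ = _∙_ ; ε = G.ε ; _⁻¹ = _⁻¹ ; isAbelianGroup = isAbelianGroup }))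
      iso _ = record
        { embedding = record { to = λ x → x ; to-cong = λ eq → eq ; homo = λ x y → ≡.sym (∙≗ x y) ; injective = λ eq → eq }
        ; from = λ x → x ; to-from = λ _ → ≡.refl }

    private
      anyJust : ∀ {a b p} {Q : Set a} {B : Set b} {P : B → Set p} (mk : Q → B) (d : Dec Q) → Q → (∀ q → P (mk q)) →
                MaybeAny.Any P (Maybe.map mk (dec⇒maybe d))
      anyJust mk (yes q) _ h = MaybeAny.just (h q)
      anyJust mk (no ¬q) q h = contradiction q ¬q

    groups-complete : Any (λ H → Iso (abelianGroup G) (abelianGroup H)) (groups n)
    groups-complete = Any.mapMaybe⁺ _ _ (Any.map⁺ (lose
      (∈-cartesianProduct⁺ (∈-allFin op) (∈-cartesianProduct⁺ (∈-allFin G.ε) (∈-allFin inv)))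
      (anyJust _ (isAbelianGroup? _ _ _) isAbelianGroup iso)))
      where
      op  = funToFin (λ x → funToFin (x G.∙_))
      inv = funToFin G._⁻¹
      open Pointwise (λ x → finToFun (finToFun op x)) (finToFun inv)
        (λ x y → ≡.trans (≡.cong (λ c → finToFun c y) (finToFun-funToFin (λ x → funToFin (x G.∙_)) x))
          (finToFun-funToFin (x G.∙_) y))
        (finToFun-funToFin G._⁻¹)

    isoClasses-complete : Any (λ H → Iso (abelianGroup G) (abelianGroup H)) (isoClasses n)
    isoClasses-complete = Any.deduplicate⁺ _≅?_
      (λ {H} {K} K≅H G≅H → iso-trans G≅H (iso-sym (≅⇒iso {abelianGroup K} {abelianGroup H} K≅H))) groups-complete

  record PairOf (n : ℕ) : Set where
    constructor pairOf
    field
      group    : AbelianGroupOn n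
      size     : ℕ
      sub      : AbelianGroupOn size
      sub≲     : sub ≲ group

    G S : Group
    G = abelianGroup group
    S = abelianGroup sub

    embedding : Embedding S G
    embedding = ≲⇒embedding sub≲

  open PairOf using (G; S; group; size; sub)

  infix 4 _≈ₚ_

  -- The two isomorphisms are not asked to be compatible with the embeddings: this is the meaning of
  -- counting isomorphic subgroups once.
  _≈ₚ_ : ∀ {n} → PairOf n → PairOf n → Set
  p ≈ₚ q = Iso (G p) (G q) × Iso (S p) (S q)

  ≈ₚ-sym : ∀ {n} {p q : PairOf n} → p ≈ₚ q → q ≈ₚ p
  ≈ₚ-sym (f , g) = iso-sym f , iso-sym g

  pairSetoid : ℕ → Setoid 0ℓ 0ℓ
  pairSetoid n = record
    { Carrier = PairOf n
    ; _≈_ = _≈ₚ_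
    ; isEquivalence = record
      { refl = iso-refl , iso-refl ; sym = λ {p} {q} → ≈ₚ-sym {n} {p} {q}
      ; trans = λ (f , g) (f′ , g′) → iso-trans f f′ , iso-trans g g′ } }

  subgroupsOfOrder : ∀ {n} → AbelianGroupOn n → ℕ → List (PairOf n)
  subgroupsOfOrder K m = map (λ (H , H≲K) → pairOf K m H H≲K) (gather (_≲? K) (isoClasses m))

  subgroupPairs : ∀ {n} → AbelianGroupOn n → List (PairOf n)
  subgroupPairs {n} K = concatMap (subgroupsOfOrder K) (upTo (suc n))

  pairs : ∀ n → List (PairOf n)
  pairs n = concatMap subgroupPairs (isoClasses n)

  length-pairs : ∀ n → length (pairs n) ≡ A n
  length-pairs n = ≡.trans (length-concatMap subgroupPairs (isoClasses n))
    (≡.cong sum (map-cong length-subgroupPairs (isoClasses n)))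
    where
    length-subgroupPairs : ∀ (K : AbelianGroupOn n) → length (subgroupPairs K) ≡ subgroupClasses K
    length-subgroupPairs K = ≡.trans (length-concatMap (subgroupsOfOrder K) (upTo (suc n)))
      (≡.cong sum (map-cong (λ m → ≡.trans (length-map _ (gather (_≲? K) (isoClasses m)))
        (length-gather (_≲? K) (isoClasses m))) (upTo (suc n))))

  pairs-distinct : ∀ n → AllPairs (λ p q → ¬ p ≈ₚ q) (pairs n)
  pairs-distinct n = concatMap-AllPairs (λ K p → K ≡ group p) subgroupPairs
    (λ K → All.concat⁺ (All.map⁺ {f = subgroupsOfOrder K} (All.universal (group-tag K) (upTo (suc n)))))
    distinct
    (λ { {b = p} {q} K≇L ≡.refl ≡.refl (f , _) → K≇L (iso⇒≅ f) })
    (isoClasses-distinct n)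
    where
    group-tag : ∀ (K : AbelianGroupOn n) m → All (λ p → K ≡ group p) (subgroupsOfOrder K m)
    group-tag K m = All.map⁺ (All.universal (λ _ → ≡.refl) _)
    distinct : ∀ (K : AbelianGroupOn n) → AllPairs (λ p q → ¬ p ≈ₚ q) (subgroupPairs K)
    distinct K = concatMap-AllPairs (λ m p → m ≡ size p) (subgroupsOfOrder K)
      (λ m → All.map⁺ (All.universal (λ _ → ≡.refl) _))
      (λ m → AllPairs.map⁺ (AllPairs.map (λ ¬eq (_ , g) → ¬eq (iso⇒≅ g))
        (gather-AllPairs (_≲? K) (isoClasses-distinct m))))
      (λ { {b = p} {q} m≢m′ ≡.refl ≡.refl (_ , g) → m≢m′ (order-unique g (order-on (sub p)) (order-on (sub q))) })
      (upTo⁺ (suc n))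

  -- Lets groups that are constructed abstractly (torsion parts, products, cyclic groups) be
  -- counted: both are moved to their representatives, and the embedding bounds the order of Y by
  -- that of X, within the range of the list.
  pairs-complete : ∀ {X Y m n} → Order X n → Order Y m → Embedding Y X →
                   Any (λ p → Iso X (G p) × Iso Y (S p)) (pairs n)
  pairs-complete {X} {Y} {m} {n} o o′ f = Any.concatMap⁺ subgroupPairs (Any.map
    (λ {K} X≅K → Any.concatMap⁺ (subgroupsOfOrder K) (lose (∈-upTo⁺ (s≤s (embedding⇒≤ f o′ o))) (Any.map⁺
      (gather⁺ {Q = λ H → Iso X (abelianGroup K) × Iso Y (abelianGroup H)} (_≲? K) (Any.map
        (λ {H} Y≅H → embedding⇒≲ (embedding-trans (Iso.embedding (iso-sym (iso-trans (realize-iso o′) Y≅H)))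
          (embedding-trans f (Iso.embedding (iso-trans (realize-iso o) X≅K)))) ,
          iso-trans (realize-iso o) X≅K , iso-trans (realize-iso o′) Y≅H)
        (isoClasses-complete (realize o′)))))))
    (isoClasses-complete (realize o)))

-- Multiplicativity of A, its upper bound at prime powers, its lower bound d.

module Counting where

  open Arithmetic
  open FiniteGroups
  open Torsion
  open PGroups
  open SubgroupPairs
  open import Defs using (A)
  open import Data.List.Base using (List; length; map; concatMap; upTo; cartesianProduct)
  open import Data.List.Membership.Propositional using (lose)
  open import Data.List.Membership.Propositional.Properties using (∈-upTo⁺)
  open import Data.List.Relation.Unary.Any as Any using (Any)
  import Data.List.Relation.Unary.Any.Properties as Any
  import Data.List.Relation.Unary.Unique.Setoid.Properties as Unique
  open import Data.List.Relation.Unary.Unique.Propositional.Properties using (upTo⁺)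
  open import Data.Nat.Base as ℕ using (ℕ; suc; NonZero; _^_; _≤_; _<_; s≤s)
  open import Data.Nat.Coprimality as Coprime using (Coprime)
  open import Data.Nat.Divisibility using (_∣_; _∣?_; divides)
  open import Data.Nat.Primality
  import Data.Nat.Properties as ℕ
  open import Data.Product using (Σ; ∃; _×_; _,_; proj₁; proj₂)
  open import Relation.Binary.Definitions using (tri<; tri≈; tri>)
  open import Relation.Binary.PropositionalEquality as ≡ using (_≡_)
  open import Relation.Nullary using (contradiction)

  open PairOf using (G; S; group; size; sub)

  G-order : ∀ {n} (p : PairOf n) → Order (G p) n
  G-order p = order-on (group p)

  S-order : ∀ {n} (p : PairOf n) → Order (S p) (size p)
  S-order p = order-on (sub p)

  G-killed : ∀ {n} (p : PairOf n) → KilledBy (G p) n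
  G-killed p = lagrange (G-order p)

  S-killed : ∀ {n} (p : PairOf n) → KilledBy (S p) n
  S-killed {n} p = killedBy-embedding (PairOf.embedding p) n (G-killed p)

  module _ {m n : ℕ} (0<m : 0 < m) (0<n : 0 < n) (m⊥n : Coprime m n) where

    Product : PairOf (m ℕ.* n) → PairOf m × PairOf n → Set
    Product p (q , r) = Iso (G p) (G q ×ᵍ G r) × Iso (S p) (S q ×ᵍ S r)

    -- The embedding of S in G restricts to the torsion parts. In G these have orders m and n by
    -- `torsion-order`; for S it is enough that they have some order.
    decompose : ∀ p → Any (Product p) (cartesianProduct (pairs m) (pairs n))
    decompose p = parts (subgroup-order (torsion (S p) (_≈?_ oS) m) oS) (subgroup-order (torsion (S p) (_≈?_ oS) n) oS)
      where
      open Order using (_≈?_)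
      oG = G-order p
      oS = S-order p
      parts : ∃ (Order (subgroupᵍ (torsion (S p) (_≈?_ oS) m))) → ∃ (Order (subgroupᵍ (torsion (S p) (_≈?_ oS) n))) →
              Any (Product p) (cartesianProduct (pairs m) (pairs n))
      parts (_ , oSₘ) (_ , oSₙ) = Any.map
        (λ ((f , g) , (f′ , g′)) →
          iso-trans (iso-sym (primary-decomposition (G p) (_≈?_ oG) m⊥n (G-killed p))) (iso-× f f′) ,
          iso-trans (iso-sym (primary-decomposition (S p) (_≈?_ oS) m⊥n (S-killed p))) (iso-× g g′))
        (Any.cartesianProduct⁺
          (pairs-complete (proj₁ oGₘₙ) oSₘ (torsion-embedding (PairOf.embedding p) (_≈?_ oS) (_≈?_ oG) m))
          (pairs-complete (proj₂ oGₘₙ) oSₙ (torsion-embedding (PairOf.embedding p) (_≈?_ oS) (_≈?_ oG) n)))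
        where oGₘₙ = torsion-order 0<m 0<n m⊥n oG

    compose : ∀ (qr : PairOf m × PairOf n) → Any (λ p → Product p qr) (pairs (m ℕ.* n))
    compose (q , r) = Any.map (λ (f , g) → iso-sym f , iso-sym g)
      (pairs-complete (order-× (G-order q) (G-order r)) (order-× (S-order q) (S-order r))
        (embedding-× (PairOf.embedding q) (PairOf.embedding r)))

    -- The relation `Product` is used in both directions: the parts determine a pair up to
    -- isomorphism, and a pair determines its parts by `cancel-coprime-×`, applied as it stands and
    -- with the factors swapped.
    A-* : A (m ℕ.* n) ≡ A m ℕ.* A n
    A-* = begin
      A (m ℕ.* n) ≡⟨ length-pairs (m ℕ.* n) ⟨
      length (pairs (m ℕ.* n)) ≡⟨ ℕ.≤-antisym upper lower ⟩
      length (cartesianProduct (pairs m) (pairs n)) ≡⟨ length-cartesianProduct (pairs m) (pairs n) ⟩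
      length (pairs m) ℕ.* length (pairs n)
        ≡⟨ ≡.cong₂ ℕ._*_ (length-pairs m) (length-pairs n) ⟩
      A m ℕ.* A n ∎
      where
      open ≡.≡-Reasoning
      upper : length (pairs (m ℕ.* n)) ≤ length (cartesianProduct (pairs m) (pairs n))
      upper = pigeonhole {E = _≈ₚ_} Product (λ {x} {y} → ≈ₚ-sym {p = x} {y})
        (λ (f , g) (f′ , g′) → iso-trans f (iso-sym f′) , iso-trans g (iso-sym g′))
        (pairs-distinct (m ℕ.* n)) decompose
      lower : length (cartesianProduct (pairs m) (pairs n)) ≤ length (pairs (m ℕ.* n))
      lower = pigeonhole {E = λ (q , r) (q′ , r′) → q ≈ₚ q′ × r ≈ₚ r′} (λ qr p → Product p qr)
        (λ { {q , r} {q′ , r′} (e , e′) → ≈ₚ-sym {p = q} {q′} e , ≈ₚ-sym {p = r} {r′} e′ })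
        (λ { {q , r} {q′ , r′} (f , g) (f′ , g′) →
          let h = iso-trans (iso-sym f) f′
              k = iso-trans (iso-sym g) g′
              n⊥m = Coprime.sym m⊥n
              swapped : ∀ {X Y Z W} → Iso (X ×ᵍ Y) (Z ×ᵍ W) → Iso (Y ×ᵍ X) (W ×ᵍ Z)
              swapped i = iso-trans ×-swap (iso-trans i ×-swap)
          in ( cancel-coprime-× m⊥n (G-killed q) (G-killed q′) (G-killed r) (G-killed r′) h
             , cancel-coprime-× m⊥n (S-killed q) (S-killed q′) (S-killed r) (S-killed r′) k )
           , ( cancel-coprime-× n⊥m (G-killed r) (G-killed r′) (G-killed q) (G-killed q′) (swapped h)
             , cancel-coprime-× n⊥m (S-killed r) (S-killed r′) (S-killed q) (S-killed q′) (swapped k) ) })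
        (Unique.cartesianProduct⁺ (pairSetoid m) (pairSetoid n) (pairs-distinct m) (pairs-distinct n)) compose

  partitionsOf : ℕ → List (List ℕ)
  partitionsOf k = partitions k k k

  partitionsUpTo : ℕ → List (List ℕ)
  partitionsUpTo k = concatMap partitionsOf (upTo (suc k))

  module _ {p : ℕ} (pp : Prime p) where

    ^-injectiveʳ : ∀ i j → p ^ i ≡ p ^ j → i ≡ j
    ^-injectiveʳ i j eq with ℕ.<-cmp i j
    ... | tri< i<j _ _ = contradiction eq (ℕ.<⇒≢ (ℕ.^-monoʳ-< p (2≤prime pp) i<j))
    ... | tri≈ _ i≡j _ = i≡j
    ... | tri> _ _ j<i = contradiction (≡.sym eq) (ℕ.<⇒≢ (ℕ.^-monoʳ-< p (2≤prime pp) j<i))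

    order-p^k-type : ∀ {X} k → Order X (p ^ k) → Any (λ c → Iso X (ofType pp c)) (partitionsOf k)
    order-p^k-type {X} k o = fromType (p-group-type pp (p ^ k) k X o (lagrange o))
      where
      fromType : (∃ λ i → p ^ k ≡ p ^ i × HasType pp X k i) → Any (λ c → Iso X (ofType pp c)) (partitionsOf k)
      fromType (i , eq , type) with ≡.refl ← ^-injectiveʳ k i eq = type k ℕ.≤-refl

    -- The types of G and S determine the class; whether the second type fits into the first is
    -- ignored. The bound is still sharp for k = 0 and k = 1, where it gives 1 and 2.
    A-^-≤ : ∀ k → A (p ^ k) ≤ length (partitionsOf k) ℕ.* length (partitionsUpTo k)
    A-^-≤ k = ≡.subst₂ _≤_ (length-pairs (p ^ k)) (length-cartesianProduct (partitionsOf k) (partitionsUpTo k))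
      (pigeonhole {E = _≈ₚ_} (λ q (c , d) → Iso (G q) (ofType pp c) × Iso (S q) (ofType pp d))
        (λ {x} {y} → ≈ₚ-sym {p = x} {y})
        (λ (f , g) (f′ , g′) → iso-trans f (iso-sym f′) , iso-trans g (iso-sym g′))
        (pairs-distinct (p ^ k)) cover)
      where
      cover : ∀ q → Any (λ (c , d) → Iso (G q) (ofType pp c) × Iso (S q) (ofType pp d))
                        (cartesianProduct (partitionsOf k) (partitionsUpTo k))
      cover q = Any.cartesianProduct⁺ (order-p^k-type k (G-order q))
        (sub-type (p-group-type pp (size q) k (S q) (S-order q) (S-killed q)))
        where
        sub-type : (∃ λ i → size q ≡ p ^ i × HasType pp (S q) k i) → Any (λ c → Iso (S q) (ofType pp c)) (partitionsUpTo k)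
        sub-type (i , eq , _) = Any.concatMap⁺ partitionsOf (lose (∈-upTo⁺ (s≤s i≤k)) (order-p^k-type i oS))
          where
          oS = ≡.subst (Order (S q)) eq (S-order q)
          i≤k : i ≤ k
          i≤k = ℕ.≮⇒≥ λ k<i → contradiction (embedding⇒≤ (PairOf.embedding q) oS (G-order q))
            (ℕ.<⇒≱ (ℕ.^-monoʳ-< p (2≤prime pp) k<i))

  divisors : ∀ n → List (Σ ℕ λ i → suc i ∣ n)
  divisors n = gather (λ i → suc i ∣? n) (upTo n)

  -- The cyclic group alone contributes a cyclic subgroup for every divisor of its order, and these
  -- are told apart by their orders.
  length-divisors-≤-A : ∀ n → length (divisors (suc n)) ≤ A (suc n)
  length-divisors-≤-A n = ≡.subst (length (divisors (suc n)) ≤_) (length-pairs (suc n))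
    (pigeonhole {E = λ d e → proj₁ d ≡ proj₁ e}
      (λ (i , _) p → Iso (cyclic (suc n)) (G p) × Iso (cyclic (suc i)) (S p)) ≡.sym
      (λ { {i , _} {j , _} (_ , g) (_ , g′) → ℕ.suc-injective
        (order-unique (iso-trans g (iso-sym g′)) (cyclic-order (suc i)) (cyclic-order (suc j))) })
      (gather-AllPairs (λ i → suc i ∣? suc n) (upTo⁺ (suc n)))
      λ (i , d∣n) → pairs-complete (cyclic-order (suc n)) (cyclic-order (suc i)) (embed i d∣n))
    where
    embed : ∀ i → suc i ∣ suc n → Embedding (cyclic (suc i)) (cyclic (suc n))
    embed i (divides (suc e) eq) = ≡.subst (λ N → (nz : NonZero N) → Embedding (cyclic (suc i)) (cyclic N {{nz}}))
      (≡.trans (ℕ.*-comm (suc i) (suc e)) (≡.sym eq))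
      (λ nz → cyclic-embedding (suc i) (suc e) {{_}} {{_}} {{nz}}) _

-- Harmonic numbers, and sums approximated by multiples of x H x.

module Approximation where

  open import Defs using (fromℕ; fromℕ-+; fromℕ-*; 0≤fromℕ; 0<fromℕ; fromℕ-mono-≤; *-pos; *-nonNeg; *-mono-≤; archimedean; recip; 0<recip; recip-inverseʳ; recip-≤; half; halves; ∣-∣-triangle; ∑; ∑-+; ∑-const)
  open import Data.Integer.Base using (+_)
  open import Data.Nat.Base as ℕ using (ℕ; zero; suc)
  import Data.Nat.DivMod as ℕ
  import Data.Nat.Properties as ℕ
  open import Data.Product using (∃; _×_; _,_; proj₁; proj₂)
  open import Data.Rational.Base
  open import Data.Rational.Properties
  open import Data.Rational.Solver using (module +-*-Solver)
  open import Data.Sum.Base using (inj₁; inj₂)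
  open import Relation.Binary.PropositionalEquality using (_≡_; refl; sym; trans; cong; cong₂; subst; subst₂)
  open +-*-Solver using (solve; _:=_; _:+_; _:*_; _:-_; :-_; con)

  *-monoˡ : ∀ {c p q} → 0ℚ ≤ c → p ≤ q → c * p ≤ c * q
  *-monoˡ {c} 0≤c = *-monoˡ-≤-nonNeg c {{nonNegative 0≤c}}

  *-monoʳ : ∀ {c p q} → 0ℚ ≤ c → p ≤ q → p * c ≤ q * c
  *-monoʳ {c} 0≤c = *-monoʳ-≤-nonNeg c {{nonNegative 0≤c}}

  *-cancelˡ : ∀ {c p q} → 0ℚ < c → c * p ≤ c * q → p ≤ q
  *-cancelˡ {c} 0<c = *-cancelˡ-≤-pos c {{positive 0<c}}

  0≤+ : ∀ {p q} → 0ℚ ≤ p → 0ℚ ≤ q → 0ℚ ≤ p + q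
  0≤+ = +-mono-≤

  p≤p+q : ∀ p {q} → 0ℚ ≤ q → p ≤ p + q
  p≤p+q p {q} 0≤q = subst (_≤ p + q) (+-identityʳ p) (+-monoʳ-≤ p 0≤q)

  p-q≤p : ∀ p {q} → 0ℚ ≤ q → p - q ≤ p
  p-q≤p p {q} 0≤q = subst (p - q ≤_) (+-identityʳ p) (+-monoʳ-≤ p (neg-antimono-≤ 0≤q))

  p≤q+r⇒p-q≤r : ∀ {p q r} → p ≤ q + r → p - q ≤ r
  p≤q+r⇒p-q≤r {p} {q} {r} h = subst (p - q ≤_) (solve 2 (λ q r → q :+ r :- q := r) refl q r) (+-monoˡ-≤ (- q) h)

  ∣p-q∣≤ : ∀ {p q r} → p ≤ q + r → q ≤ p + r → ∣ p - q ∣ ≤ r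
  ∣p-q∣≤ {p} {q} {r} h k with ∣p∣≡p∨∣p∣≡-p (p - q)
  ... | inj₁ eq = subst (_≤ r) (sym eq) (p≤q+r⇒p-q≤r h)
  ... | inj₂ eq = subst (_≤ r) (sym (trans eq (solve 2 (λ p q → :- (p :- q) := q :- p) refl p q))) (p≤q+r⇒p-q≤r k)

  ∑-mono : ∀ n {f g} → (∀ i → i ℕ.< n → f i ≤ g i) → ∑ n f ≤ ∑ n g
  ∑-mono zero    h = ≤-refl
  ∑-mono (suc n) h = +-mono-≤ (∑-mono n (λ i i<n → h i (ℕ.m<n⇒m<1+n i<n))) (h n ℕ.≤-refl)

  ∑-cong : ∀ n {f g} → (∀ i → i ℕ.< n → f i ≡ g i) → ∑ n f ≡ ∑ n g
  ∑-cong zero    h = refl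
  ∑-cong (suc n) h = cong₂ _+_ (∑-cong n (λ i i<n → h i (ℕ.m<n⇒m<1+n i<n))) (h n ℕ.≤-refl)

  ∑-zero : ∀ n → ∑ n (λ _ → 0ℚ) ≡ 0ℚ
  ∑-zero zero    = refl
  ∑-zero (suc n) = trans (+-identityʳ _) (∑-zero n)

  0≤∑ : ∀ n {f} → (∀ i → i ℕ.< n → 0ℚ ≤ f i) → 0ℚ ≤ ∑ n f
  0≤∑ n {f} h = subst (_≤ ∑ n f) (∑-zero n) (∑-mono n h)

  ∑-scale : ∀ n c f → ∑ n (λ i → c * f i) ≡ c * ∑ n f
  ∑-scale zero    c f = sym (*-zeroʳ c)
  ∑-scale (suc n) c f = trans (cong (_+ c * f n) (∑-scale n c f)) (sym (*-distribˡ-+ c (∑ n f) (f n)))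

  ∑-distrib : ∀ n f g → ∑ n (λ i → f i + g i) ≡ ∑ n f + ∑ n g
  ∑-distrib zero    f g = refl
  ∑-distrib (suc n) f g = trans (cong (_+ (f n + g n)) (∑-distrib n f g))
    (solve 4 (λ a b c d → (a :+ b) :+ (c :+ d) := (a :+ c) :+ (b :+ d)) refl (∑ n f) (∑ n g) (f n) (g n))

  ∑-swap : ∀ m n (f : ℕ → ℕ → ℚ) → ∑ m (λ i → ∑ n (f i)) ≡ ∑ n (λ j → ∑ m (λ i → f i j))
  ∑-swap zero    n f = sym (∑-zero n)
  ∑-swap (suc m) n f = trans (cong (_+ ∑ n (f m)) (∑-swap m n f))
    (sym (∑-distrib n (λ j → ∑ m (λ i → f i j)) (f m)))

  ∣∑∣≤∑ : ∀ n f → ∣ ∑ n f ∣ ≤ ∑ n (λ i → ∣ f i ∣)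
  ∣∑∣≤∑ zero    f = ≤-refl
  ∣∑∣≤∑ (suc n) f = ≤-trans (∣p+q∣≤∣p∣+∣q∣ (∑ n f) (f n)) (+-monoˡ-≤ ∣ f n ∣ (∣∑∣≤∑ n f))

  ∑-truncate : ∀ {m n} f → m ℕ.≤ n → (∀ i → m ℕ.≤ i → i ℕ.< n → f i ≡ 0ℚ) → ∑ m f ≡ ∑ n f
  ∑-truncate {m} {n} f m≤n h = sym (begin
    ∑ n f ≡⟨ cong (λ k → ∑ k f) (ℕ.m+[n∸m]≡n m≤n) ⟨
    ∑ (m ℕ.+ (n ℕ.∸ m)) f ≡⟨ ∑-+ m (n ℕ.∸ m) f ⟩
    ∑ m f + ∑ (n ℕ.∸ m) (λ j → f (m ℕ.+ j)) ≡⟨ cong (λ z → ∑ m f + z) (trans (∑-cong (n ℕ.∸ m)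
         (λ j j< → h (m ℕ.+ j) (ℕ.m≤m+n m j) (below j j<)))
         (∑-zero (n ℕ.∸ m))) ⟩
    ∑ m f + 0ℚ ≡⟨ +-identityʳ _ ⟩
    ∑ m f ∎)
    where
    open Relation.Binary.PropositionalEquality.≡-Reasoning
    below : ∀ j → j ℕ.< n ℕ.∸ m → m ℕ.+ j ℕ.< n
    below j j< = ℕ.<-≤-trans (ℕ.+-monoʳ-< m j<) (ℕ.≤-reflexive (ℕ.m+[n∸m]≡n m≤n))

  -- The value is 1 / (n + 1), so that `H n` below is the n-th harmonic number.
  ν : ℕ → ℚ
  ν n = recip (0<fromℕ n)

  0<ν : ∀ n → 0ℚ < ν n
  0<ν n = 0<recip (0<fromℕ n)

  0≤ν : ∀ n → 0ℚ ≤ ν n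
  0≤ν n = <⇒≤ (0<ν n)

  *ν : ∀ n → fromℕ (suc n) * ν n ≡ 1ℚ
  *ν n = recip-inverseʳ (0<fromℕ n)

  ν-anti : ∀ {m n} → m ℕ.≤ n → ν n ≤ ν m
  ν-anti {m} {n} m≤n = recip-≤ (0<fromℕ n) (subst (_≤ fromℕ (suc n) * ν m) (*ν m)
    (*-monoʳ (0≤ν m) (fromℕ-mono-≤ (ℕ.s≤s m≤n))))

  ν-limit : ∀ ε → 0ℚ < ε → ∃ λ N → ∀ n → N ℕ.≤ n → ν n ≤ ε
  ν-limit ε 0<ε = N , λ n N≤n → *-cancelˡ (0<fromℕ n) (begin
      fromℕ (suc n) * ν n ≡⟨ *ν n ⟩
      1ℚ ≤⟨ proj₂ (archimedean 1ℚ 0<ε) ⟩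
      fromℕ N * ε ≤⟨ *-monoʳ (<⇒≤ 0<ε) (fromℕ-mono-≤ (ℕ.m≤n⇒m≤1+n N≤n)) ⟩
      fromℕ (suc n) * ε ∎)
    where
    open ≤-Reasoning
    N = proj₁ (archimedean 1ℚ 0<ε)

  H : ℕ → ℚ
  H n = ∑ n ν

  0≤H : ∀ n → 0ℚ ≤ H n
  0≤H n = 0≤∑ n (λ i _ → 0≤ν i)

  H-+ : ∀ m d → H (m ℕ.+ d) ≡ H m + ∑ d (λ j → ν (m ℕ.+ j))
  H-+ m d = ∑-+ m d ν

  H-mono : ∀ {m n} → m ℕ.≤ n → H m ≤ H n
  H-mono {m} {n} m≤n = subst (λ k → H m ≤ H k) (ℕ.m+[n∸m]≡n m≤n)
    (subst (H m ≤_) (sym (H-+ m (n ℕ.∸ m))) (p≤p+q (H m) (0≤∑ (n ℕ.∸ m) (λ j _ → 0≤ν (m ℕ.+ j)))))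

  H-upper : ∀ m d → H (m ℕ.+ d) ≤ H m + fromℕ d * ν m
  H-upper m d = subst₂ _≤_ (sym (H-+ m d)) (cong (λ z → H m + z) (∑-const d (ν m)))
    (+-monoʳ-≤ (H m) (∑-mono d (λ j _ → ν-anti (ℕ.m≤m+n m j))))

  -- Each of the M new terms is at least 1 / (2M + 1) ≥ 1 / (3M).
  H-doubling : ∀ m → H (suc m) + (+ 1 / 3) ≤ H (suc m ℕ.+ suc m)
  H-doubling m = subst (H M + (+ 1 / 3) ≤_) (sym (H-+ M M)) (+-monoʳ-≤ (H M) (begin
    + 1 / 3 ≡⟨ *-identityʳ (+ 1 / 3) ⟨
    (+ 1 / 3) * 1ℚ ≡⟨ cong ((+ 1 / 3) *_) (*ν (M ℕ.+ M)) ⟨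
    (+ 1 / 3) * (fromℕ (suc (M ℕ.+ M)) * ν (M ℕ.+ M))
      ≤⟨ *-monoˡ (nonNegative⁻¹ (+ 1 / 3)) (*-monoʳ (0≤ν (M ℕ.+ M)) (fromℕ-mono-≤ {suc (M ℕ.+ M)} {3 ℕ.* M}
           (ℕ.≤-trans (ℕ.+-monoˡ-≤ (M ℕ.+ M) (ℕ.s≤s (ℕ.z≤n {m}))) (ℕ.≤-reflexive (cong (M ℕ.+_) (cong (M ℕ.+_) (sym (ℕ.+-identityʳ M)))))))) ⟩
    (+ 1 / 3) * (fromℕ (3 ℕ.* M) * ν (M ℕ.+ M))
      ≡⟨ cong (λ z → (+ 1 / 3) * (z * ν (M ℕ.+ M))) (fromℕ-* 3 M) ⟩
    (+ 1 / 3) * (fromℕ 3 * fromℕ M * ν (M ℕ.+ M))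
      ≡⟨ solve 2 (λ m v → con (+ 1 / 3) :* (con (fromℕ 3) :* m :* v) := m :* v) refl (fromℕ M) (ν (M ℕ.+ M)) ⟩
    fromℕ M * ν (M ℕ.+ M) ≡⟨ ∑-const M (ν (M ℕ.+ M)) ⟨
    ∑ M (λ _ → ν (M ℕ.+ M))
      ≤⟨ ∑-mono M (λ j j<M → ν-anti (ℕ.+-monoʳ-≤ M (ℕ.<⇒≤ j<M))) ⟩
    ∑ M (λ j → ν (M ℕ.+ j)) ∎))
    where
    open ≤-Reasoning
    M = suc m

  H-unbounded : ∀ K → ∃ λ N → ∀ n → N ℕ.≤ n → fromℕ K ≤ H n
  H-unbounded K = N , λ n N≤n → ≤-trans bound (H-mono N≤n)
    where
    open ≤-Reasoning
    double : ℕ → ℕ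
    double zero    = 0
    double (suc k) = suc (double k ℕ.+ double k ℕ.+ 1)
    growth : ∀ k → fromℕ k * (+ 1 / 3) ≤ H (suc (double k))
    growth zero    = subst (_≤ H 1) (sym (*-zeroˡ (+ 1 / 3))) (0≤H 1)
    growth (suc k) = begin
      fromℕ (suc k) * (+ 1 / 3) ≡⟨ cong (_* (+ 1 / 3)) (fromℕ-+ 1 k) ⟩
      (1ℚ + fromℕ k) * (+ 1 / 3)
        ≡⟨ solve 1 (λ k → (con 1ℚ :+ k) :* con (+ 1 / 3) := k :* con (+ 1 / 3) :+ con (+ 1 / 3)) refl (fromℕ k) ⟩
      fromℕ k * (+ 1 / 3) + (+ 1 / 3) ≤⟨ +-monoˡ-≤ (+ 1 / 3) (growth k) ⟩
      H (suc (double k)) + (+ 1 / 3) ≤⟨ H-doubling (double k) ⟩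
      H (suc (double k) ℕ.+ suc (double k))
        ≤⟨ H-mono (ℕ.≤-trans (ℕ.≤-reflexive (cong suc (trans (ℕ.+-suc d d) (ℕ.+-comm 1 (d ℕ.+ d))))) (ℕ.n≤1+n _)) ⟩
      H (suc (double (suc k))) ∎
      where d = double k
    N = suc (double (3 ℕ.* K))
    bound : fromℕ K ≤ H N
    bound = subst (_≤ H N) (trans (cong (_* (+ 1 / 3)) (fromℕ-* 3 K))
      (solve 1 (λ k → con (fromℕ 3) :* k :* con (+ 1 / 3) := k) refl (fromℕ K))) (growth (3 ℕ.* K))

  W : ℕ → ℚ
  W n = fromℕ n * H n

  0≤W : ∀ n → 0ℚ ≤ W n
  0≤W n = *-nonNeg (0≤fromℕ n) (0≤H n)

  W-mono : ∀ {m n} → m ℕ.≤ n → W m ≤ W n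
  W-mono {m} {n} m≤n = *-mono-≤ (0≤fromℕ m) (0≤H n) (fromℕ-mono-≤ m≤n) (H-mono m≤n)

  -- An upper bound o(W), as a record so that `T` can be inferred from the type.
  record Small (T : ℕ → ℚ) : Set where
    field below : ∀ ε → 0ℚ < ε → ∃ λ X → ∀ x → X ℕ.≤ x → T x ≤ ε * W x
  open Small public

  small-id : Small fromℕ
  small-id .below ε 0<ε = proj₁ (H-unbounded K) , λ x X≤x → begin
    fromℕ x ≡⟨ *-identityʳ (fromℕ x) ⟨
    fromℕ x * 1ℚ
      ≤⟨ *-monoˡ (0≤fromℕ x) (≤-trans (proj₂ (archimedean 1ℚ 0<ε)) (*-monoʳ (<⇒≤ 0<ε) (proj₂ (H-unbounded K) x X≤x))) ⟩
    fromℕ x * (H x * ε)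
      ≡⟨ solve 3 (λ x h e → x :* (h :* e) := e :* (x :* h)) refl (fromℕ x) (H x) ε ⟩
    ε * W x ∎
    where
    open ≤-Reasoning
    K = proj₁ (archimedean 1ℚ 0<ε)

  small-H : Small H
  small-H .below ε 0<ε = proj₁ (archimedean 1ℚ 0<ε) , λ x X≤x → begin
    H x ≡⟨ *-identityʳ (H x) ⟨
    H x * 1ℚ
      ≤⟨ *-monoˡ (0≤H x) (≤-trans (proj₂ (archimedean 1ℚ 0<ε)) (*-monoʳ (<⇒≤ 0<ε) (fromℕ-mono-≤ X≤x))) ⟩
    H x * (fromℕ x * ε)
      ≡⟨ solve 3 (λ x h e → h :* (x :* e) := e :* (x :* h)) refl (fromℕ x) (H x) ε ⟩
    ε * W x ∎
    where open ≤-Reasoning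

  small-+ : ∀ {S T} → Small S → Small T → Small (λ x → S x + T x)
  small-+ {S} {T} s t .below ε 0<ε =
    let X , h = s .below (ε * ½) (half 0<ε)
        Y , k = t .below (ε * ½) (half 0<ε)
    in X ℕ.⊔ Y , λ x le → ≤-trans
         (+-mono-≤ (h x (ℕ.m⊔n≤o⇒m≤o X Y le)) (k x (ℕ.m⊔n≤o⇒n≤o X Y le)))
         (≤-reflexive (trans (sym (*-distribʳ-+ (W x) (ε * ½) (ε * ½))) (cong (_* W x) (halves ε))))

  module _ {c : ℚ} (0≤c : 0ℚ ≤ c) where
    private
      0<c+1 : 0ℚ < c + 1ℚ
      0<c+1 = +-mono-≤-< 0≤c (positive⁻¹ 1ℚ)

    -- This is ε / (c + 1); the added 1 covers c = 0.
    shrink : ℚ → ℚ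
    shrink ε = ε * recip 0<c+1

    0<shrink : ∀ {ε} → 0ℚ < ε → 0ℚ < shrink ε
    0<shrink 0<ε = *-pos 0<ε (0<recip 0<c+1)

    *-shrink : ∀ {ε} → 0ℚ < ε → c * shrink ε ≤ ε
    *-shrink {ε} 0<ε = begin
      c * (ε * recip 0<c+1) ≤⟨ *-monoʳ (<⇒≤ (0<shrink 0<ε)) (p≤p+q c (nonNegative⁻¹ 1ℚ)) ⟩
      (c + 1ℚ) * (ε * recip 0<c+1)
        ≡⟨ solve 3 (λ c e r → c :* (e :* r) := e :* (c :* r)) refl (c + 1ℚ) ε (recip 0<c+1) ⟩
      ε * ((c + 1ℚ) * recip 0<c+1) ≡⟨ trans (cong (ε *_) (recip-inverseʳ 0<c+1)) (*-identityʳ ε) ⟩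
      ε ∎
      where open ≤-Reasoning

    small-* : ∀ {T} → Small T → Small (λ x → c * T x)
    small-* {T} t .below ε 0<ε = proj₁ (t .below (shrink ε) (0<shrink 0<ε)) , λ x X≤x → begin
      c * T x ≤⟨ *-monoˡ 0≤c (proj₂ (t .below (shrink ε) (0<shrink 0<ε)) x X≤x) ⟩
      c * (shrink ε * W x) ≡⟨ *-assoc c (shrink ε) (W x) ⟨
      c * shrink ε * W x ≤⟨ *-monoʳ (0≤W x) (*-shrink 0<ε) ⟩
      ε * W x ∎
      where open ≤-Reasoning

  _∼_·W : (ℕ → ℚ) → ℚ → ℚ → Set
  (S ∼ c ·W) ε = ∃ λ X → ∀ x → X ℕ.≤ x → ∣ S x - c * W x ∣ ≤ ε * W x

  -- Says that S is asymptotic to a real multiple of W without mentioning a real number: the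
  -- rational c may depend on the precision.
  record Approximable (S : ℕ → ℚ) : Set where
    field approximate : ∀ ε → 0ℚ < ε → ∃ λ c → (S ∼ c ·W) ε
  open Approximable public

  -- Closure under limits relative to W. It is used for the infinite sum over the powers of one
  -- prime and again for the passage to all primes.
  approximable-limit : ∀ {S} → (∀ ε → 0ℚ < ε → ∃ λ T → Approximable T × ∃ λ X → ∀ x → X ℕ.≤ x → ∣ S x - T x ∣ ≤ ε * W x) →
                       Approximable S
  approximable-limit {S} h .approximate ε 0<ε =
    let T , approx , X , close = h (ε * ½) (half 0<ε)
        c , Y , k = approx .approximate (ε * ½) (half 0<ε)
    in c , X ℕ.⊔ Y , λ x le → begin
      ∣ S x - c * W x ∣ ≤⟨ ∣-∣-triangle (S x) (T x) (c * W x) ⟩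
      ∣ S x - T x ∣ + ∣ T x - c * W x ∣
        ≤⟨ +-mono-≤ (close x (ℕ.m⊔n≤o⇒m≤o X Y le)) (k x (ℕ.m⊔n≤o⇒n≤o X Y le)) ⟩
      ε * ½ * W x + ε * ½ * W x
        ≡⟨ trans (sym (*-distribʳ-+ (W x) (ε * ½) (ε * ½))) (cong (_* W x) (halves ε)) ⟩
      ε * W x ∎
    where open ≤-Reasoning

  approximable-small : ∀ {S} c → Small (λ x → ∣ S x - c * W x ∣) → Approximable S
  approximable-small c small .approximate ε 0<ε = c , small .below ε 0<ε

  approximable-cong : ∀ {S T} → (∀ x → S x ≡ T x) → Approximable S → Approximable T
  approximable-cong eq s .approximate ε 0<ε = let c , X , h = s .approximate ε 0<ε in
    c , X , λ x X≤x → subst (λ y → ∣ y - c * W x ∣ ≤ ε * W x) (eq x) (h x X≤x)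

  approximable-+ : ∀ {S T} → Approximable S → Approximable T → Approximable (λ x → S x + T x)
  approximable-+ {S} {T} s t .approximate ε 0<ε =
    let c , X , h = s .approximate (ε * ½) (half 0<ε)
        d , Y , k = t .approximate (ε * ½) (half 0<ε)
    in c + d , X ℕ.⊔ Y , λ x le → begin
      ∣ S x + T x - (c + d) * W x ∣
        ≡⟨ cong ∣_∣ (solve 5 (λ s t c d w → s :+ t :- (c :+ d) :* w := (s :- c :* w) :+ (t :- d :* w)) refl (S x) (T x) c d (W x)) ⟩
      ∣ (S x - c * W x) + (T x - d * W x) ∣
        ≤⟨ ∣p+q∣≤∣p∣+∣q∣ (S x - c * W x) (T x - d * W x) ⟩
      ∣ S x - c * W x ∣ + ∣ T x - d * W x ∣
        ≤⟨ +-mono-≤ (h x (ℕ.m⊔n≤o⇒m≤o X Y le)) (k x (ℕ.m⊔n≤o⇒n≤o X Y le)) ⟩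
      ε * ½ * W x + ε * ½ * W x
        ≡⟨ trans (sym (*-distribʳ-+ (W x) (ε * ½) (ε * ½))) (cong (_* W x) (halves ε)) ⟩
      ε * W x ∎
    where open ≤-Reasoning

  approximable-* : ∀ {S} a → Approximable S → Approximable (λ x → a * S x)
  approximable-* {S} a s .approximate ε 0<ε =
    let c , X , h = s .approximate (shrink (0≤∣p∣ a) ε) (0<shrink (0≤∣p∣ a) 0<ε)
    in a * c , X , λ x X≤x → begin
      ∣ a * S x - a * c * W x ∣
        ≡⟨ cong ∣_∣ (solve 4 (λ a s c w → a :* s :- a :* c :* w := a :* (s :- c :* w)) refl a (S x) c (W x)) ⟩
      ∣ a * (S x - c * W x) ∣ ≡⟨ ∣p*q∣≡∣p∣*∣q∣ a (S x - c * W x) ⟩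
      ∣ a ∣ * ∣ S x - c * W x ∣ ≤⟨ *-monoˡ (0≤∣p∣ a) (h x X≤x) ⟩
      ∣ a ∣ * (shrink (0≤∣p∣ a) ε * W x) ≡⟨ *-assoc ∣ a ∣ _ (W x) ⟨
      ∣ a ∣ * shrink (0≤∣p∣ a) ε * W x ≤⟨ *-monoʳ (0≤W x) (*-shrink (0≤∣p∣ a) 0<ε) ⟩
      ε * W x ∎
    where open ≤-Reasoning

  approximable-∑ : ∀ n {S : ℕ → ℕ → ℚ} → (∀ i → Approximable (S i)) → Approximable (λ x → ∑ n (λ i → S i x))
  approximable-∑ zero    h .approximate ε 0<ε = 0ℚ , 0 , λ x _ → subst (_≤ ε * W x)
    (sym (cong (λ z → ∣ 0ℚ - z ∣) (*-zeroˡ (W x)))) (*-nonNeg (<⇒≤ 0<ε) (0≤W x))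
  approximable-∑ (suc n) h = approximable-+ (approximable-∑ n h) (h n)

  module _ (m : ℕ) where
    private M = suc m

    fromℕ-/ : ∀ x → fromℕ (x ℕ./ M) ≤ fromℕ x * ν m
    fromℕ-/ x = *-cancelˡ (0<fromℕ m) (begin
      fromℕ M * fromℕ (x ℕ./ M) ≡⟨ fromℕ-* M (x ℕ./ M) ⟨
      fromℕ (M ℕ.* (x ℕ./ M))
        ≤⟨ fromℕ-mono-≤ (ℕ.≤-trans (ℕ.≤-reflexive (ℕ.*-comm M (x ℕ./ M))) (ℕ.m/n*n≤m x M)) ⟩
      fromℕ x ≡⟨ *-identityʳ (fromℕ x) ⟨
      fromℕ x * 1ℚ ≡⟨ cong (fromℕ x *_) (*ν m) ⟨
      fromℕ x * (fromℕ M * ν m)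
        ≡⟨ solve 3 (λ x m v → x :* (m :* v) := m :* (x :* v)) refl (fromℕ x) (fromℕ M) (ν m) ⟩
      fromℕ M * (fromℕ x * ν m) ∎)
      where open ≤-Reasoning

    x<[1+x/M]M : ∀ x → x ℕ.≤ suc (x ℕ./ M) ℕ.* M
    x<[1+x/M]M x = ℕ.≤-trans (ℕ.≤-reflexive (ℕ.m≡m%n+[m/n]*n x M))
      (ℕ.+-monoˡ-≤ (x ℕ./ M ℕ.* M) (ℕ.m%n≤n x M))

    /-fromℕ : ∀ x → fromℕ x * ν m ≤ fromℕ (x ℕ./ M) + 1ℚ
    /-fromℕ x = begin
      fromℕ x * ν m ≤⟨ *-monoʳ (0≤ν m) (fromℕ-mono-≤ (x<[1+x/M]M x)) ⟩
      fromℕ (suc (x ℕ./ M) ℕ.* M) * ν m ≡⟨ cong (_* ν m) (fromℕ-* (suc (x ℕ./ M)) M) ⟩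
      fromℕ (suc (x ℕ./ M)) * fromℕ M * ν m ≡⟨ *-assoc (fromℕ (suc (x ℕ./ M))) (fromℕ M) (ν m) ⟩
      fromℕ (suc (x ℕ./ M)) * (fromℕ M * ν m)
        ≡⟨ trans (cong (fromℕ (suc (x ℕ./ M)) *_) (*ν m)) (*-identityʳ (fromℕ (suc (x ℕ./ M)))) ⟩
      fromℕ (suc (x ℕ./ M)) ≡⟨ fromℕ-+ 1 (x ℕ./ M) ⟩
      1ℚ + fromℕ (x ℕ./ M) ≡⟨ +-comm 1ℚ (fromℕ (x ℕ./ M)) ⟩
      fromℕ (x ℕ./ M) + 1ℚ ∎
      where open ≤-Reasoning

    W-/-≤ : ∀ x → W (x ℕ./ M) ≤ ν m * W x
    W-/-≤ x = begin
      fromℕ (x ℕ./ M) * H (x ℕ./ M)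
        ≤⟨ *-mono-≤ (0≤fromℕ (x ℕ./ M)) (0≤H x) (fromℕ-/ x) (H-mono (ℕ.m/n≤m x M)) ⟩
      fromℕ x * ν m * H x
        ≡⟨ solve 3 (λ x v h → x :* v :* h := v :* (x :* h)) refl (fromℕ x) (ν m) (H x) ⟩
      ν m * W x ∎
      where open ≤-Reasoning

    -- With y the quotient, x ≤ (y + 1) M. There are at most (y + 1) M terms beyond the first y,
    -- each at most 1 / (y + 1).
    H-/ : ∀ x → H x ≤ H (x ℕ./ M) + fromℕ M
    H-/ x = begin
      H x ≤⟨ H-mono (x<[1+x/M]M x) ⟩
      H (suc y ℕ.* M) ≡⟨ cong H (ℕ.m+[n∸m]≡n y≤) ⟨
      H (y ℕ.+ d) ≤⟨ H-upper y d ⟩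
      H y + fromℕ d * ν y
        ≤⟨ +-monoʳ-≤ (H y) (*-monoʳ (0≤ν y) (fromℕ-mono-≤ (ℕ.m∸n≤m (suc y ℕ.* M) y))) ⟩
      H y + fromℕ (suc y ℕ.* M) * ν y ≡⟨ cong (λ z → H y + z * ν y) (fromℕ-* (suc y) M) ⟩
      H y + fromℕ (suc y) * fromℕ M * ν y
        ≡⟨ cong (λ z → H y + z) (trans (solve 3 (λ a b c → a :* b :* c := a :* c :* b) refl (fromℕ (suc y)) (fromℕ M) (ν y))
             (trans (cong (_* fromℕ M) (*ν y)) (*-identityˡ (fromℕ M)))) ⟩
      H y + fromℕ M ∎
      where
      open ≤-Reasoning
      y = x ℕ./ M
      d = suc y ℕ.* M ℕ.∸ y
      y≤ : y ℕ.≤ suc y ℕ.* M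
      y≤ = ℕ.≤-trans (ℕ.n≤1+n y) (ℕ.m≤m*n (suc y) M)

    W-/-≥ : ∀ x → ν m * W x ≤ W (x ℕ./ M) + (fromℕ x + H x)
    W-/-≥ x = begin
      ν m * (fromℕ x * H x)
        ≡⟨ solve 3 (λ v x h → v :* (x :* h) := (x :* v) :* h) refl (ν m) (fromℕ x) (H x) ⟩
      fromℕ x * ν m * H x ≤⟨ *-monoʳ (0≤H x) (/-fromℕ x) ⟩
      (fromℕ y + 1ℚ) * H x
        ≡⟨ solve 2 (λ y h → (y :+ con 1ℚ) :* h := y :* h :+ h) refl (fromℕ y) (H x) ⟩
      fromℕ y * H x + H x ≤⟨ +-monoˡ-≤ (H x) (*-monoˡ (0≤fromℕ y) (H-/ x)) ⟩
      fromℕ y * (H y + fromℕ M) + H x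
        ≡⟨ solve 4 (λ y h m k → y :* (h :+ m) :+ k := y :* h :+ (y :* m :+ k)) refl (fromℕ y) (H y) (fromℕ M) (H x) ⟩
      W y + (fromℕ y * fromℕ M + H x)
        ≤⟨ +-monoʳ-≤ (W y) (+-monoˡ-≤ (H x) (subst (_≤ fromℕ x) (fromℕ-* y M) (fromℕ-mono-≤ (ℕ.m/n*n≤m x M)))) ⟩
      W y + (fromℕ x + H x) ∎
      where
      open ≤-Reasoning
      y = x ℕ./ M

    small-W-/ : Small (λ x → ∣ W (x ℕ./ M) - ν m * W x ∣)
    small-W-/ .below ε 0<ε = proj₁ small , λ x X≤x → ≤-trans
      (∣p-q∣≤ (≤-trans (W-/-≤ x) (p≤p+q (ν m * W x) (0≤+ (0≤fromℕ x) (0≤H x)))) (W-/-≥ x)) (proj₂ small x X≤x)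
      where small = small-+ small-id small-H .below ε 0<ε

    -- W (x / M) differs from W x / M by at most x + H x, which is o(W); so a constant c for S turns
    -- into c / M.
    approximable-/ : ∀ {S} → Approximable S → Approximable (λ x → S (x ℕ./ M))
    approximable-/ {S} s = approximable-limit λ ε 0<ε →
      let c , X , h = s .approximate ε 0<ε in
      (λ x → c * W (x ℕ./ M)) , approximable-* c (approximable-small (ν m) small-W-/) , X ℕ.* M , λ x le →
        ≤-trans (h (x ℕ./ M) (subst (ℕ._≤ x ℕ./ M) (ℕ.m*n/n≡m X M) (ℕ./-monoˡ-≤ M le)))
          (*-monoˡ (<⇒≤ 0<ε) (W-mono (ℕ.m/n≤m x M)))

-- The divisor function: its summatory function and its values at prime powers.

module DivisorSums where

  open Arithmetic
  open FiniteGroups using (gather)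
  open Counting
  open Approximation
  open import Defs using (A; fromℕ; fromℕ-+; fromℕ-mono-≤; ∑; ∑-const)
  open import Data.List.Base using ([]; _∷_; _++_; length; upTo; _∷ʳ_)
  open import Data.List.Properties using (upTo-∷ʳ)
  open import Data.Nat.Base as ℕ using (ℕ; zero; suc; NonZero; _^_; _≤_; _<_; s≤s; z≤n)
  open import Data.Nat.Coprimality using (coprime-divisor)
  open import Data.Nat.DivMod using (_/_; m*n/n≡m; m/n*n≤m; m≡m%n+[m/n]*n; m%n<n; /-congˡ)
  open import Data.Nat.Divisibility
  open import Data.Nat.Primality
  import Data.Nat.Properties as ℕ
  open import Data.Rational.Base as ℚ using (ℚ; 0ℚ; 1ℚ; _+_; _*_)
  open import Data.Rational.Properties using (+-identityʳ; +-identityˡ; *-identityʳ; *-identityˡ; *-assoc; *-comm)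
  open import Data.Rational.Solver using (module +-*-Solver)
  open import Relation.Binary.PropositionalEquality using (_≡_; refl; sym; trans; cong; cong₂; subst; module ≡-Reasoning)
  open import Relation.Nullary using (¬_; Dec; yes; no; contradiction)
  open +-*-Solver using (solve; _:=_; _:+_; _:*_; _:-_; con)

  partial : (ℕ → ℚ) → ℕ → ℚ
  partial f x = ∑ x (λ i → f (suc i))

  -- The Dirichlet convolution of f with the point mass at q.
  divTerm : ℕ → (ℕ → ℚ) → ℕ → ℚ
  divTerm q f n with q ∣? n
  ... | yes (divides m _) = f m
  ... | no _              = 0ℚ

  divTerm-* : ∀ q .{{_ : NonZero q}} f m → divTerm q f (m ℕ.* q) ≡ f m
  divTerm-* q f m with q ∣? (m ℕ.* q)
  ... | yes (divides k eq) = cong f (sym (ℕ.*-cancelʳ-≡ m k q eq))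
  ... | no ¬q∣             = contradiction (n∣m*n m) ¬q∣

  divTerm-∤ : ∀ q f n → ¬ q ∣ n → divTerm q f n ≡ 0ℚ
  divTerm-∤ q f n ¬q∣n with q ∣? n
  ... | yes q∣n = contradiction q∣n ¬q∣n
  ... | no _    = refl

  -- The quotient of x by q enters through the inequalities that characterise it, which are easy to
  -- maintain in an induction on x.
  partial-divTerm′ : ∀ q .{{_ : NonZero q}} f x m → m ℕ.* q ≤ x → x < q ℕ.+ m ℕ.* q →
                     partial (divTerm q f) x ≡ partial f m
  partial-divTerm′ q f zero    zero    _    _  = refl
  partial-divTerm′ q f zero    (suc m) mq≤0 _  = contradiction mq≤0 (ℕ.<⇒≱ (ℕ.≤-trans (ℕ.>-nonZero⁻¹ q) (ℕ.m≤m+n q (m ℕ.* q))))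
  partial-divTerm′ q f (suc x) m mq≤x x<mq = step (q ∣? suc x)
    where
    open ≡-Reasoning
    step : Dec (q ∣ suc x) → partial (divTerm q f) (suc x) ≡ partial f m
    step (no ¬q∣) = begin
      partial (divTerm q f) x + divTerm q f (suc x)
        ≡⟨ cong (partial (divTerm q f) x +_) (divTerm-∤ q f (suc x) ¬q∣) ⟩
      partial (divTerm q f) x + 0ℚ ≡⟨ +-identityʳ _ ⟩
      partial (divTerm q f) x
        ≡⟨ partial-divTerm′ q f x m (ℕ.≤-pred (ℕ.≤∧≢⇒< mq≤x (λ eq → ¬q∣ (divides m (sym eq))))) (ℕ.<-trans (ℕ.n<1+n x) x<mq) ⟩
      partial f m ∎
    step (yes (divides k eq)) = last m (ℕ.≤-antisym
        (ℕ.*-cancelʳ-≤ m k q (subst (m ℕ.* q ≤_) eq mq≤x))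
        (ℕ.≤-pred (ℕ.*-cancelʳ-< q k (suc m) (subst (_< q ℕ.+ m ℕ.* q) eq x<mq)))) mq≤x
      where
      last : ∀ m → m ≡ k → m ℕ.* q ≤ suc x → partial (divTerm q f) (suc x) ≡ partial f m
      last zero    refl _ = contradiction eq λ ()
      last (suc m) refl mq≤x = begin
        partial (divTerm q f) x + divTerm q f (suc x)
          ≡⟨ cong (λ n → partial (divTerm q f) x + divTerm q f n) eq ⟩
        partial (divTerm q f) x + divTerm q f (suc m ℕ.* q)
          ≡⟨ cong (partial (divTerm q f) x +_) (divTerm-* q f (suc m)) ⟩
        partial (divTerm q f) x + f (suc m)
          ≡⟨ cong (_+ f (suc m)) (partial-divTerm′ q f x m mq≤x′ (ℕ.≤-reflexive eq)) ⟩
        partial f m + f (suc m) ∎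
        where
        mq≤x′ : m ℕ.* q ≤ x
        mq≤x′ = ℕ.≤-pred (ℕ.<-≤-trans (ℕ.m<n+m (m ℕ.* q) (ℕ.>-nonZero⁻¹ q)) mq≤x)

  partial-divTerm : ∀ q .{{_ : NonZero q}} f x → partial (divTerm q f) x ≡ partial f (x / q)
  partial-divTerm q f x = partial-divTerm′ q f x (x / q) (m/n*n≤m x q)
    (subst (_< q ℕ.+ x / q ℕ.* q) (sym (m≡m%n+[m/n]*n x q)) (ℕ.+-monoˡ-< (x / q ℕ.* q) (m%n<n x q)))

  partial-const : ∀ x → partial (λ _ → 1ℚ) x ≡ fromℕ x
  partial-const x = trans (∑-const x 1ℚ) (*-identityʳ (fromℕ x))

  indicator : ℕ → ℕ → ℚ
  indicator i = divTerm i (λ _ → 1ℚ)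

  indicator-∣ : ∀ {i n} → i ∣ n → indicator i n ≡ 1ℚ
  indicator-∣ {i} {n} i∣n with i ∣? n
  ... | yes _   = refl
  ... | no ¬i∣n = contradiction i∣n ¬i∣n

  d : ℕ → ℚ
  d n = ∑ n (λ i → indicator (suc i) n)

  d-extend : ∀ {n N} → n ≤ N → 0 < n → d n ≡ ∑ N (λ i → indicator (suc i) n)
  d-extend {n} n≤N 0<n = ∑-truncate (λ i → indicator (suc i) n) n≤N
    λ i n≤i _ → divTerm-∤ (suc i) _ n (>⇒∤ {{ℕ.>-nonZero 0<n}} (s≤s n≤i))

  partial-d : ∀ x → partial d x ≡ ∑ x (λ i → fromℕ (x / suc i))
  partial-d x = begin
    ∑ x (λ n → d (suc n))
      ≡⟨ ∑-cong x (λ n n<x → d-extend n<x (s≤s z≤n)) ⟩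
    ∑ x (λ n → ∑ x (λ i → indicator (suc i) (suc n)))
      ≡⟨ ∑-swap x x (λ n i → indicator (suc i) (suc n)) ⟩
    ∑ x (λ i → partial (indicator (suc i)) x)
      ≡⟨ ∑-cong x (λ i _ → trans (partial-divTerm (suc i) (λ _ → 1ℚ) x) (partial-const (x / suc i))) ⟩
    ∑ x (λ i → fromℕ (x / suc i)) ∎
    where open ≡-Reasoning

  length-gather-++ : ∀ {P : ℕ → Set} (P? : ∀ i → Dec (P i)) xs ys →
                     length (gather P? (xs ++ ys)) ≡ length (gather P? xs) ℕ.+ length (gather P? ys)
  length-gather-++ P? []       ys = refl
  length-gather-++ P? (x ∷ xs) ys with P? x
  ... | yes _ = cong suc (length-gather-++ P? xs ys)
  ... | no  _ = length-gather-++ P? xs ys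

  d-length : ∀ n → d n ≡ fromℕ (length (divisors n))
  d-length n = count n
    where
    P? = λ i → suc i ∣? n
    one : ∀ i → indicator (suc i) n ≡ fromℕ (length (gather P? (i ∷ [])))
    one i with suc i ∣? n
    ... | yes _ = refl
    ... | no  _ = refl
    count : ∀ x → ∑ x (λ i → indicator (suc i) n) ≡ fromℕ (length (gather P? (upTo x)))
    count zero    = refl
    count (suc x) = begin
      ∑ x (λ i → indicator (suc i) n) + indicator (suc x) n
        ≡⟨ cong₂ _+_ (count x) (one x) ⟩
      fromℕ (length (gather P? (upTo x))) + fromℕ (length (gather P? (x ∷ [])))
        ≡⟨ fromℕ-+ (length (gather P? (upTo x))) (length (gather P? (x ∷ []))) ⟨
      fromℕ (length (gather P? (upTo x)) ℕ.+ length (gather P? (x ∷ [])))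
        ≡⟨ cong fromℕ (length-gather-++ P? (upTo x) (x ∷ [])) ⟨
      fromℕ (length (gather P? (upTo x ∷ʳ x)))
        ≡⟨ cong (λ xs → fromℕ (length (gather P? xs))) (upTo-∷ʳ x) ⟩
      fromℕ (length (gather P? (upTo (suc x)))) ∎
      where open ≡-Reasoning

  d≤A : ∀ n → d (suc n) ℚ.≤ fromℕ (A (suc n))
  d≤A n = subst (ℚ._≤ fromℕ (A (suc n))) (sym (d-length (suc n))) (fromℕ-mono-≤ (length-divisors-≤-A n))

  module _ {p : ℕ} (pp : Prime p) where
    private
      instance
        p≢0 : NonZero p
        p≢0 = prime⇒nonZero pp
      p^≢0 : ∀ k → NonZero (p ^ k)
      p^≢0 k = ℕ.m^n≢0 p k

    ^-∣-cancel : ∀ {m} → ¬ p ∣ m → ∀ k v → p ^ k ∣ p ^ v ℕ.* m → k ≤ v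
    ^-∣-cancel ¬p∣m zero    v       _ = z≤n
    ^-∣-cancel {m} ¬p∣m (suc k) zero    h =
      contradiction (∣-trans (m∣m*n (p ^ k)) (subst (p ^ suc k ∣_) (ℕ.*-identityˡ m) h)) ¬p∣m
    ^-∣-cancel {m} ¬p∣m (suc k) (suc v) h =
      s≤s (^-∣-cancel ¬p∣m k v (*-cancelˡ-∣ p (subst (p ^ suc k ∣_) (ℕ.*-assoc p (p ^ v) m) h)))

    module _ {m : ℕ} (¬p∣m : ¬ p ∣ m) (0<m : 0 < m) where

      private
        0<p^*m : ∀ k → 0 < p ^ k ℕ.* m
        0<p^*m k = ℕ.≤-trans 0<m (ℕ.m≤n*m m (p ^ k) {{p^≢0 k}})

      -- The divisors of p ^ (k + 1) * m that do not divide p ^ k * m are the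
      -- p ^ (k + 1) * e with e ∣ m.
      indicator-split : ∀ k i → indicator (suc i) (p ^ suc k ℕ.* m) ≡
                        indicator (suc i) (p ^ k ℕ.* m) + divTerm (p ^ suc k) (λ e → indicator e m) (suc i)
      indicator-split k i = cases (p ^ suc k ∣? suc i) (suc i ∣? (p ^ suc k ℕ.* m))
        where
        open ≡-Reasoning
        N = p ^ suc k ℕ.* m
        pN : ∀ r → p ℕ.* r ≡ N → r ≡ p ^ k ℕ.* m
        pN r eq = ℕ.*-cancelˡ-≡ r (p ^ k ℕ.* m) p (trans eq (ℕ.*-assoc p (p ^ k) m))
        lower⇒upper : suc i ∣ p ^ k ℕ.* m → suc i ∣ N
        lower⇒upper h = subst (suc i ∣_) (sym (ℕ.*-assoc p (p ^ k) m)) (∣n⇒∣m*n p h)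
        multiple-∤ : ∀ e → ¬ (e ℕ.* p ^ suc k ∣ p ^ k ℕ.* m)
        multiple-∤ e h = ℕ.<⇒≱ ℕ.≤-refl (^-∣-cancel ¬p∣m (suc k) k (∣-trans (n∣m*n e) h))
        coprime-lower : ¬ (p ^ suc k ∣ suc i) → suc i ∣ N → suc i ∣ p ^ k ℕ.* m
        coprime-lower ¬h (divides r eq) with p ∣? r
        ... | yes (divides s refl) = divides s (sym (pN (s ℕ.* suc i) (trans (sym (ℕ.*-assoc p s (suc i)))
                (trans (cong (ℕ._* suc i) (ℕ.*-comm p s)) (sym eq)))))
        ... | no ¬p∣r = contradiction (coprime-divisor (prime-∤⇒coprime-^ pp (suc k) ¬p∣r) (subst (p ^ suc k ∣_) eq (m∣m*n m))) ¬h
        cases : Dec (p ^ suc k ∣ suc i) → Dec (suc i ∣ N) → indicator (suc i) N ≡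
                indicator (suc i) (p ^ k ℕ.* m) + divTerm (p ^ suc k) (λ e → indicator e m) (suc i)
        cases (yes (divides e eq)) i∣N? = begin
          indicator (suc i) N ≡⟨ agree i∣N? ⟩
          indicator e m
            ≡⟨ divTerm-* (p ^ suc k) {{p^≢0 (suc k)}} (λ e → indicator e m) e ⟨
          divTerm (p ^ suc k) (λ e → indicator e m) (e ℕ.* p ^ suc k)
            ≡⟨ cong (divTerm (p ^ suc k) (λ e → indicator e m)) eq ⟨
          divTerm (p ^ suc k) (λ e → indicator e m) (suc i) ≡⟨ +-identityˡ _ ⟨
          0ℚ + divTerm (p ^ suc k) (λ e → indicator e m) (suc i)
            ≡⟨ cong (_+ divTerm (p ^ suc k) (λ e → indicator e m) (suc i)) (divTerm-∤ (suc i) _ (p ^ k ℕ.* m)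
                 (λ h → multiple-∤ e (subst (_∣ p ^ k ℕ.* m) eq h))) ⟨
          indicator (suc i) (p ^ k ℕ.* m) + divTerm (p ^ suc k) (λ e → indicator e m) (suc i) ∎
          where
          cancel : suc i ∣ N → e ∣ m
          cancel h = *-cancelʳ-∣ (p ^ suc k) {{p^≢0 (suc k)}} (subst (_∣ m ℕ.* p ^ suc k) eq (subst (suc i ∣_) (ℕ.*-comm (p ^ suc k) m) h))
          agree : Dec (suc i ∣ N) → indicator (suc i) N ≡ indicator e m
          agree (yes h) = trans (indicator-∣ h) (sym (indicator-∣ (cancel h)))
          agree (no ¬h) = trans (divTerm-∤ (suc i) _ N ¬h) (sym (divTerm-∤ e _ m (λ e∣m →
            ¬h (subst (_∣ N) (sym eq) (subst (_∣ N) (ℕ.*-comm (p ^ suc k) e) (*-monoʳ-∣ (p ^ suc k) e∣m))))))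
        cases (no ¬h) i∣N? = begin
          indicator (suc i) N ≡⟨ agree i∣N? ⟩
          indicator (suc i) (p ^ k ℕ.* m) ≡⟨ +-identityʳ _ ⟨
          indicator (suc i) (p ^ k ℕ.* m) + 0ℚ
            ≡⟨ cong (indicator (suc i) (p ^ k ℕ.* m) +_) (divTerm-∤ (p ^ suc k) _ (suc i) ¬h) ⟨
          indicator (suc i) (p ^ k ℕ.* m) + divTerm (p ^ suc k) (λ e → indicator e m) (suc i) ∎
          where
          agree : Dec (suc i ∣ N) → indicator (suc i) N ≡ indicator (suc i) (p ^ k ℕ.* m)
          agree (yes i∣N) = trans (indicator-∣ i∣N) (sym (indicator-∣ (coprime-lower ¬h i∣N)))
          agree (no ¬i∣N) = trans (divTerm-∤ (suc i) _ N ¬i∣N)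
            (sym (divTerm-∤ (suc i) _ (p ^ k ℕ.* m) (λ h → ¬i∣N (lower⇒upper h))))

      d-suc : ∀ k → d (p ^ suc k ℕ.* m) ≡ d (p ^ k ℕ.* m) + d m
      d-suc k = begin
        ∑ N (λ i → indicator (suc i) N)
          ≡⟨ ∑-cong N (λ i _ → indicator-split k i) ⟩
        ∑ N (λ i → indicator (suc i) (p ^ k ℕ.* m) + divTerm q (λ e → indicator e m) (suc i))
          ≡⟨ ∑-distrib N (λ i → indicator (suc i) (p ^ k ℕ.* m)) (λ i → divTerm q (λ e → indicator e m) (suc i)) ⟩
        ∑ N (λ i → indicator (suc i) (p ^ k ℕ.* m)) + partial (divTerm q (λ e → indicator e m)) N
          ≡⟨ cong₂ _+_ (sym (d-extend (ℕ.*-monoˡ-≤ m (ℕ.m≤n*m (p ^ k) p)) (0<p^*m k)))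
               (partial-divTerm q {{p^≢0 (suc k)}} (λ e → indicator e m) N) ⟩
        d (p ^ k ℕ.* m) + partial (λ e → indicator e m) ((N / q) {{p^≢0 (suc k)}})
          ≡⟨ cong (λ x → d (p ^ k ℕ.* m) + partial (λ e → indicator e m) x)
               (trans (/-congˡ {{p^≢0 (suc k)}} (ℕ.*-comm q m)) (m*n/n≡m m q {{p^≢0 (suc k)}})) ⟩
        d (p ^ k ℕ.* m) + d m ∎
        where
        open ≡-Reasoning
        q = p ^ suc k
        N = q ℕ.* m

      d-^-* : ∀ k → d (p ^ k ℕ.* m) ≡ fromℕ (suc k) * d m
      d-^-* zero    = trans (cong d (ℕ.*-identityˡ m)) (sym (*-identityˡ (d m)))
      d-^-* (suc k) = begin
        d (p ^ suc k ℕ.* m) ≡⟨ d-suc k ⟩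
        d (p ^ k ℕ.* m) + d m ≡⟨ cong (_+ d m) (d-^-* k) ⟩
        fromℕ (suc k) * d m + d m
          ≡⟨ solve 2 (λ k d → k :* d :+ d := (con 1ℚ :+ k) :* d) refl (fromℕ (suc k)) (d m) ⟩
        (1ℚ + fromℕ (suc k)) * d m ≡⟨ cong (_* d m) (fromℕ-+ 1 (suc k)) ⟨
        fromℕ (suc (suc k)) * d m ∎
        where open ≡-Reasoning

-- Exchanging the values at the powers of one prime by convolution.

module SieveFunctions where

  open Arithmetic
  open Approximation
  open DivisorSums
  open import Defs using (fromℕ; fromℕ-+; ∑)
  open import Data.Nat.Base as ℕ using (ℕ; zero; suc; NonZero; _^_; _≤_; _<_; s≤s; z≤n; _∸_)
  open import Data.Nat.Coprimality as Coprime using (Coprime)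
  open import Data.Nat.DivMod using (_/_)
  open import Data.Nat.Divisibility
  open import Data.Nat.Primality
  import Data.Nat.Properties as ℕ
  open import Data.Product using (_,_)
  open import Data.Rational.Base as ℚ using (ℚ; 0ℚ; 1ℚ; _+_; _*_; _-_; -_)
  import Data.Rational.Properties as ℚ
  open import Data.Rational.Solver using (module +-*-Solver)
  open import Data.Sum.Base using (inj₁; inj₂)
  open import Relation.Binary.PropositionalEquality using (_≡_; refl; sym; trans; cong; cong₂; subst; module ≡-Reasoning)
  open import Relation.Nullary using (¬_; Dec; yes; no; contradiction)
  open +-*-Solver using (solve; _:=_; _:+_; _:*_; _:-_; con)

  -- Dirichlet convolution of f with the function p ^ k ↦ γ k.
  conv : ℕ → (ℕ → ℚ) → (ℕ → ℚ) → ℕ → ℚ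
  conv p γ f n = ∑ (suc n) (λ k → γ k * divTerm (p ^ k) f n)

  module _ {p : ℕ} (2≤p : 2 ≤ p) (γ f : ℕ → ℚ) where
    private
      p^≢0 : ∀ k → NonZero (p ^ k)
      p^≢0 k = ℕ.m^n≢0 p k {{ℕ.>-nonZero (ℕ.≤-trans (s≤s z≤n) 2≤p)}}

    -- For k > n the power p^k exceeds n and the term vanishes. A common range for all n ≤ N permits
    -- the exchange of sums in `partial-conv`.
    conv-extend : ∀ {n N} → 0 < n → n ≤ N → conv p γ f n ≡ ∑ (suc N) (λ k → γ k * divTerm (p ^ k) f n)
    conv-extend {n} 0<n n≤N = ∑-truncate (λ k → γ k * divTerm (p ^ k) f n) (s≤s n≤N) λ k n<k _ →
      trans (cong (γ k *_) (divTerm-∤ (p ^ k) f n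
        (>⇒∤ {{ℕ.>-nonZero 0<n}} (ℕ.<-trans n<k (n<m^n 2≤p k))))) (ℚ.*-zeroʳ (γ k))

    partial-conv : ∀ x → partial (conv p γ f) x ≡ ∑ (suc x) (λ k → γ k * partial f ((x / p ^ k) {{p^≢0 k}}))
    partial-conv x = begin
      ∑ x (λ i → conv p γ f (suc i))
        ≡⟨ ∑-cong x (λ i i<x → conv-extend (s≤s z≤n) i<x) ⟩
      ∑ x (λ i → ∑ (suc x) (λ k → γ k * divTerm (p ^ k) f (suc i)))
        ≡⟨ ∑-swap x (suc x) (λ i k → γ k * divTerm (p ^ k) f (suc i)) ⟩
      ∑ (suc x) (λ k → ∑ x (λ i → γ k * divTerm (p ^ k) f (suc i)))
        ≡⟨ ∑-cong (suc x) (λ k _ → trans (∑-scale x (γ k) (λ i → divTerm (p ^ k) f (suc i)))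
             (cong (γ k *_) (partial-divTerm (p ^ k) {{p^≢0 k}} f x))) ⟩
      ∑ (suc x) (λ k → γ k * partial f ((x / p ^ k) {{p^≢0 k}})) ∎
      where open ≡-Reasoning

    conv-^-* : Prime p → ∀ v {m} → ¬ p ∣ m → 0 < m →
               conv p γ f (p ^ v ℕ.* m) ≡ ∑ (suc v) (λ k → γ k * f (p ^ (v ∸ k) ℕ.* m))
    conv-^-* pp v {m} ¬p∣m 0<m = begin
      ∑ (suc n) (λ k → γ k * divTerm (p ^ k) f n)
        ≡⟨ ∑-truncate (λ k → γ k * divTerm (p ^ k) f n) (s≤s v≤n) beyond ⟨
      ∑ (suc v) (λ k → γ k * divTerm (p ^ k) f n)
        ≡⟨ ∑-cong (suc v) (λ k k<1+v → cong (γ k *_) (term k (ℕ.≤-pred k<1+v))) ⟩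
      ∑ (suc v) (λ k → γ k * f (p ^ (v ∸ k) ℕ.* m)) ∎
      where
      open ≡-Reasoning
      n = p ^ v ℕ.* m
      v≤n : v ≤ n
      v≤n = ℕ.≤-trans (ℕ.<⇒≤ (n<m^n 2≤p v)) (ℕ.m≤m*n (p ^ v) m {{ℕ.>-nonZero 0<m}})
      beyond : ∀ k → suc v ≤ k → k < suc n → γ k * divTerm (p ^ k) f n ≡ 0ℚ
      beyond k v<k _ = trans (cong (γ k *_) (divTerm-∤ (p ^ k) f n
        (λ h → ℕ.<⇒≱ v<k (^-∣-cancel pp ¬p∣m k v h)))) (ℚ.*-zeroʳ (γ k))
      term : ∀ k → k ≤ v → divTerm (p ^ k) f n ≡ f (p ^ (v ∸ k) ℕ.* m)
      term k k≤v = trans (cong (divTerm (p ^ k) f) n≡) (divTerm-* (p ^ k) {{p^≢0 k}} f (p ^ (v ∸ k) ℕ.* m))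
        where
        n≡ : n ≡ p ^ (v ∸ k) ℕ.* m ℕ.* p ^ k
        n≡ = begin
          p ^ v ℕ.* m ≡⟨ cong (λ w → p ^ w ℕ.* m) (ℕ.m∸n+n≡m k≤v) ⟨
          p ^ (v ∸ k ℕ.+ k) ℕ.* m ≡⟨ cong (ℕ._* m) (ℕ.^-distribˡ-+-* p (v ∸ k) k) ⟩
          p ^ (v ∸ k) ℕ.* p ^ k ℕ.* m ≡⟨ ℕ.*-assoc (p ^ (v ∸ k)) (p ^ k) m ⟩
          p ^ (v ∸ k) ℕ.* (p ^ k ℕ.* m) ≡⟨ cong (p ^ (v ∸ k) ℕ.*_) (ℕ.*-comm (p ^ k) m) ⟩
          p ^ (v ∸ k) ℕ.* (m ℕ.* p ^ k) ≡⟨ ℕ.*-assoc (p ^ (v ∸ k)) m (p ^ k) ⟨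
          p ^ (v ∸ k) ℕ.* m ℕ.* p ^ k ∎

  -- The coefficients of (1 - t)² ∑ α k tᵏ.
  secondDifference : (ℕ → ℚ) → ℕ → ℚ
  secondDifference α zero          = α 0
  secondDifference α (suc zero)    = α 1 - fromℕ 2 * α 0
  secondDifference α (suc (suc k)) = α (suc (suc k)) - fromℕ 2 * α (suc k) + α k

  ∑-secondDifference : ∀ α v → ∑ (suc (suc v)) (secondDifference α) ≡ α (suc v) - α v
  ∑-secondDifference α zero    = solve 2 (λ a b → con 0ℚ :+ a :+ (b :- con (fromℕ 2) :* a) := b :- a) refl (α 0) (α 1)
  ∑-secondDifference α (suc v) = trans (cong (_+ secondDifference α (suc (suc v))) (∑-secondDifference α v))
    (solve 3 (λ a b c → (b :- a) :+ (c :- con (fromℕ 2) :* b :+ a) := c :- b) refl (α v) (α (suc v)) (α (suc (suc v))))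

  -- The identity (1 - t)² ∑ (k + 1) t^k = 1, read on coefficients. From v to v + 1 the left side
  -- grows by a plain sum of second differences, which is a first difference.
  ∑-secondDifference-* : ∀ α v → ∑ (suc v) (λ k → secondDifference α k * fromℕ (suc (v ∸ k))) ≡ α v
  ∑-secondDifference-* α zero    = solve 1 (λ a → con 0ℚ :+ a :* con 1ℚ := a) refl (α 0)
  ∑-secondDifference-* α (suc v) = begin
    ∑ (suc v) (λ k → γ k * fromℕ (suc (suc v ∸ k))) + γ (suc v) * fromℕ (suc (suc v ∸ suc v))
      ≡⟨ cong₂ _+_ (trans (∑-cong (suc v) (λ k k<1+v → shift k (ℕ.≤-pred k<1+v))) (∑-distrib (suc v) _ γ)) last ⟩
    ∑ (suc v) (λ k → γ k * fromℕ (suc (v ∸ k))) + ∑ (suc v) γ + γ (suc v)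
      ≡⟨ ℚ.+-assoc (∑ (suc v) (λ k → γ k * fromℕ (suc (v ∸ k)))) (∑ (suc v) γ) (γ (suc v)) ⟩
    ∑ (suc v) (λ k → γ k * fromℕ (suc (v ∸ k))) + ∑ (suc (suc v)) γ
      ≡⟨ cong₂ _+_ (∑-secondDifference-* α v) (∑-secondDifference α v) ⟩
    α v + (α (suc v) - α v)
      ≡⟨ solve 2 (λ a b → a :+ (b :- a) := b) refl (α v) (α (suc v)) ⟩
    α (suc v) ∎
    where
    open ≡-Reasoning
    γ = secondDifference α
    last : γ (suc v) * fromℕ (suc (suc v ∸ suc v)) ≡ γ (suc v)
    last = trans (cong (λ w → γ (suc v) * fromℕ (suc w)) (ℕ.n∸n≡0 v)) (ℚ.*-identityʳ (γ (suc v)))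
    shift : ∀ k → k ≤ v → γ k * fromℕ (suc (suc v ∸ k)) ≡ γ k * fromℕ (suc (v ∸ k)) + γ k
    shift k k≤v = begin
      γ k * fromℕ (suc (suc v ∸ k))
        ≡⟨ cong (λ w → γ k * fromℕ (suc w)) (ℕ.+-∸-assoc 1 k≤v) ⟩
      γ k * fromℕ (1 ℕ.+ suc (v ∸ k)) ≡⟨ cong (γ k *_) (fromℕ-+ 1 (suc (v ∸ k))) ⟩
      γ k * (1ℚ + fromℕ (suc (v ∸ k)))
        ≡⟨ solve 2 (λ g w → g :* (con 1ℚ :+ w) := g :* w :+ g) refl (γ k) (fromℕ (suc (v ∸ k))) ⟩
      γ k * fromℕ (suc (v ∸ k)) + γ k ∎

  -- At the primes beyond z, f has the local factors of d. This is what a sieve step consumes at its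
  -- own prime and has to preserve at the larger ones.
  HasPrimePowers : ℕ → (ℕ → ℚ) → Set
  HasPrimePowers z f = ∀ {q} → Prime q → z < q → ∀ k {m} → ¬ q ∣ m → 0 < m → f (q ^ k ℕ.* m) ≡ fromℕ (suc k) * f m

  0<cofactor : ∀ a {m n} → 0 < n → n ≡ a ℕ.* m → 0 < m
  0<cofactor a {zero}  0<n eq = contradiction (trans eq (ℕ.*-zeroʳ a)) (ℕ.>⇒≢ 0<n)
  0<cofactor a {suc m} 0<n eq = s≤s z≤n

  Smooth : ℕ → ℕ → Set
  Smooth z n = ∀ {p} → Prime p → p ∣ n → p ≤ z

  module Sieve (a : ℕ → ℚ) where

    α γ : ℕ → ℕ → ℚ
    α p k = a (p ^ k)
    γ p = secondDifference (α p)

    sieveStep : ∀ p → Dec (Prime p) → (ℕ → ℚ) → ℕ → ℚ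
    sieveStep p (yes _) f = conv p (γ p) f
    sieveStep p (no _)  f = f

    -- The multiplicative function that agrees with a at the powers of the primes
    -- p ≤ z, and with d at the powers of the other primes.
    F : ℕ → ℕ → ℚ
    F zero    = d
    F (suc z) = sieveStep (suc z) (prime? (suc z)) (F z)

    conv-prime : ∀ {z} (pp : Prime (suc z)) {f} → HasPrimePowers z f → ∀ v {m} → ¬ suc z ∣ m → 0 < m →
                 conv (suc z) (γ (suc z)) f (suc z ^ v ℕ.* m) ≡ α (suc z) v * f m
    conv-prime {z} pp {f} h v {m} ¬p∣m 0<m = begin
      conv p (γ p) f (p ^ v ℕ.* m)
        ≡⟨ conv-^-* (2≤prime pp) (γ p) f pp v ¬p∣m 0<m ⟩
      ∑ (suc v) (λ k → γ p k * f (p ^ (v ∸ k) ℕ.* m))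
        ≡⟨ ∑-cong (suc v) (λ k _ → trans (cong (γ p k *_) (h pp ℕ.≤-refl (v ∸ k) ¬p∣m 0<m))
             (solve 3 (λ g w f → g :* (w :* f) := f :* (g :* w)) refl (γ p k) (fromℕ (suc (v ∸ k))) (f m))) ⟩
      ∑ (suc v) (λ k → f m * (γ p k * fromℕ (suc (v ∸ k))))
        ≡⟨ ∑-scale (suc v) (f m) (λ k → γ p k * fromℕ (suc (v ∸ k))) ⟩
      f m * ∑ (suc v) (λ k → γ p k * fromℕ (suc (v ∸ k)))
        ≡⟨ cong (f m *_) (∑-secondDifference-* (α p) v) ⟩
      f m * α p v
        ≡⟨ ℚ.*-comm (f m) (α p v) ⟩
      α p v * f m ∎
      where
      open ≡-Reasoning
      p = suc z

    -- Convolution at p sees only the p-part of its argument; a power of a larger prime q is carried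
    -- along in the cofactor, to which the induction hypothesis applies.
    hasPrimePowers : ∀ z → HasPrimePowers z (F z)
    hasPrimePowers zero    qq _   k ¬q∣m 0<m = d-^-* qq ¬q∣m 0<m k
    hasPrimePowers (suc z) = step (prime? (suc z)) (hasPrimePowers z)
      where
      p = suc z
      step : (prime? : Dec (Prime p)) → HasPrimePowers z (F z) → HasPrimePowers p (sieveStep p prime? (F z))
      step (no _)   h qq p<q = h qq (ℕ.<-trans (ℕ.n<1+n z) p<q)
      step (yes pp) h {q} qq p<q k {n} ¬q∣n 0<n = viaPart (splitPrimePower (2≤prime pp) n 0<n)
        where
        open ≡-Reasoning
        f = F z
        viaPart : PrimePowerPart p n → conv p (γ p) f (q ^ k ℕ.* n) ≡ fromℕ (suc k) * conv p (γ p) f n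
        viaPart (primePowerPart v m n≡ ¬p∣m) = begin
          conv p (γ p) f (q ^ k ℕ.* n) ≡⟨ cong (conv p (γ p) f) reorder ⟩
          conv p (γ p) f (p ^ v ℕ.* (q ^ k ℕ.* m)) ≡⟨ conv-prime pp h v ¬p∣q^k*m 0<q^k*m ⟩
          α p v * f (q ^ k ℕ.* m)
            ≡⟨ cong (α p v *_) (h qq (ℕ.<-trans (ℕ.n<1+n z) p<q) k ¬q∣m 0<m) ⟩
          α p v * (fromℕ (suc k) * f m)
            ≡⟨ solve 3 (λ a k f → a :* (k :* f) := k :* (a :* f)) refl (α p v) (fromℕ (suc k)) (f m) ⟩
          fromℕ (suc k) * (α p v * f m)
            ≡⟨ cong (fromℕ (suc k) *_) (conv-prime pp h v ¬p∣m 0<m) ⟨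
          fromℕ (suc k) * conv p (γ p) f (p ^ v ℕ.* m)
            ≡⟨ cong (λ n → fromℕ (suc k) * conv p (γ p) f n) n≡ ⟨
          fromℕ (suc k) * conv p (γ p) f n ∎
          where
          0<m = 0<cofactor (p ^ v) 0<n n≡
          ¬q∣m : ¬ q ∣ m
          ¬q∣m q∣m = ¬q∣n (subst (q ∣_) (sym n≡) (∣n⇒∣m*n (p ^ v) q∣m))
          0<q^k*m : 0 < q ^ k ℕ.* m
          0<q^k*m = ℕ.≤-trans 0<m (ℕ.m≤n*m m (q ^ k) {{ℕ.m^n≢0 q k {{prime⇒nonZero qq}}}})
          ¬p∣q^k*m : ¬ p ∣ q ^ k ℕ.* m
          ¬p∣q^k*m h with euclidsLemma (q ^ k) m pp h
          ... | inj₁ p∣q^k = ℕ.<⇒≢ p<q (prime∣prime⇒≡ pp qq (prime∣^⇒∣ pp q k p∣q^k))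
          ... | inj₂ p∣m   = ¬p∣m p∣m
          reorder : q ^ k ℕ.* n ≡ p ^ v ℕ.* (q ^ k ℕ.* m)
          reorder = trans (cong (q ^ k ℕ.*_) n≡) (trans (sym (ℕ.*-assoc (q ^ k) (p ^ v) m))
            (trans (cong (ℕ._* m) (ℕ.*-comm (q ^ k) (p ^ v))) (ℕ.*-assoc (p ^ v) (q ^ k) m)))

    module _ (a-1 : a 1 ≡ 1ℚ) (multiplicative : ∀ {m n} → 0 < m → 0 < n → Coprime m n → a (m ℕ.* n) ≡ a m * a n) where

      F-smooth : ∀ z {n} → 0 < n → Smooth z n → F z n ≡ a n
      F-smooth zero {suc zero}        _ _ = sym a-1
      F-smooth zero {suc (suc n)}     _ smooth =
        let p , pp , p∣n = primeDivisor (suc (suc n)) (s≤s (s≤s z≤n)) in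
        contradiction (smooth pp p∣n) (ℕ.<⇒≱ (ℕ.≤-trans (s≤s z≤n) (2≤prime pp)))
      F-smooth (suc z) {n} 0<n smooth = step (prime? p) refl
        where
        p = suc z
        step : (pp? : Dec (Prime p)) → prime? p ≡ pp? → sieveStep p pp? (F z) n ≡ a n
        step (no ¬pp) _ = F-smooth z 0<n λ qq q∣n → ℕ.≤-pred (ℕ.≤∧≢⇒< (smooth qq q∣n) λ { refl → ¬pp qq })
        step (yes pp) _ = viaPart (splitPrimePower (2≤prime pp) n 0<n)
          where
          open ≡-Reasoning
          viaPart : PrimePowerPart p n → conv p (γ p) (F z) n ≡ a n
          viaPart (primePowerPart v m n≡ ¬p∣m) = begin
            conv p (γ p) (F z) n ≡⟨ cong (conv p (γ p) (F z)) n≡ ⟩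
            conv p (γ p) (F z) (p ^ v ℕ.* m) ≡⟨ conv-prime pp (hasPrimePowers z) v ¬p∣m 0<m ⟩
            α p v * F z m
              ≡⟨ cong (α p v *_) (F-smooth z 0<m λ qq q∣m → ℕ.≤-pred (ℕ.≤∧≢⇒<
                   (smooth qq (subst (_ ∣_) (sym n≡) (∣n⇒∣m*n (p ^ v) q∣m))) λ { refl → ¬p∣m q∣m })) ⟩
            a (p ^ v) * a m
              ≡⟨ multiplicative (ℕ.m^n>0 p v) 0<m (prime-∤⇒coprime-^ pp v ¬p∣m) ⟨
            a (p ^ v ℕ.* m) ≡⟨ cong a n≡ ⟨
            a n ∎
            where 0<m = 0<cofactor (p ^ v) 0<n n≡

      -- All primes dividing n are at most z and have been treated. So for fixed x the sum of F z up
      -- to x is that of a once z ≥ x.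
      F-≤ : ∀ z {n} → 0 < n → n ≤ z → F z n ≡ a n
      F-≤ z 0<n n≤z = F-smooth z 0<n λ pp p∣n → ℕ.≤-trans (∣⇒≤ {{ℕ.>-nonZero 0<n}} p∣n) n≤z

-- Geometric series, bounded products, partition numbers and the growth of A.

module GrowthBounds where

  open PGroups using (partitions)
  open Counting using (partitionsOf; partitionsUpTo; A-^-≤)
  open Approximation
  open SieveFunctions using (secondDifference)
  open import Defs using (A; fromℕ; fromℕ-+; fromℕ-*; 0≤fromℕ; 0<fromℕ; fromℕ-mono-≤; *-nonNeg; *-mono-≤; archimedean; ∑)
  open import Data.Bool.Base using (if_then_else_)
  open import Data.Integer.Base using (+_; +≤+)
  open import Data.List.Base using (List; []; _∷_; _++_; length; map; upTo; _∷ʳ_; concatMap)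
  open import Data.List.Properties using (length-++; length-map; upTo-∷ʳ; concatMap-++; ++-identityʳ)
  open import Data.Nat.Base as ℕ using (ℕ; zero; suc)
  open import Data.Nat.Primality using (Prime)
  import Data.Nat.Properties as ℕ
  open import Data.Product using (∃; _×_; _,_; proj₁; proj₂)
  open import Data.Rational.Base
  open import Data.Rational.Properties
  open import Data.Rational.Solver using (module +-*-Solver)
  open import Relation.Binary.PropositionalEquality using (_≡_; refl; sym; trans; cong; cong₂; subst; subst₂)
  open import Relation.Nullary using (Dec; yes; no; does)
  open +-*-Solver using (solve; _:=_; _:+_; _:*_; _:-_; :-_; con)

  pow : ℚ → ℕ → ℚ
  pow x zero    = 1ℚ
  pow x (suc k) = x * pow x k

  0≤pow : ∀ {x} → 0ℚ ≤ x → ∀ k → 0ℚ ≤ pow x k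
  0≤pow 0≤x zero    = nonNegative⁻¹ 1ℚ
  0≤pow 0≤x (suc k) = *-nonNeg 0≤x (0≤pow 0≤x k)

  pow-+ : ∀ x j k → pow x (j ℕ.+ k) ≡ pow x j * pow x k
  pow-+ x zero    k = sym (*-identityˡ (pow x k))
  pow-+ x (suc j) k = trans (cong (x *_) (pow-+ x j k)) (sym (*-assoc x (pow x j) (pow x k)))

  pow-* : ∀ x y k → pow (x * y) k ≡ pow x k * pow y k
  pow-* x y zero    = refl
  pow-* x y (suc k) = trans (cong (x * y *_) (pow-* x y k))
    (solve 4 (λ x y p q → x :* y :* (p :* q) := (x :* p) :* (y :* q)) refl x y (pow x k) (pow y k))

  pow-mono : ∀ {x y} → 0ℚ ≤ x → x ≤ y → ∀ k → pow x k ≤ pow y k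
  pow-mono 0≤x x≤y zero    = ≤-refl
  pow-mono 0≤x x≤y (suc k) = *-mono-≤ 0≤x (0≤pow (≤-trans 0≤x x≤y) k) x≤y (pow-mono 0≤x x≤y k)

  pow-≥1 : ∀ {x} → 1ℚ ≤ x → ∀ k → pow x k ≤ pow x (suc k)
  pow-≥1 {x} 1≤x k = subst (_≤ x * pow x k) (*-identityˡ (pow x k)) (*-monoʳ (0≤pow (≤-trans (nonNegative⁻¹ 1ℚ) 1≤x) k) 1≤x)

  -- This is (16/9) / 2, the ratio of the series over prime powers in the worst case p = 2.
  8/9 : ℚ
  8/9 = + 8 / 9

  -- A Bernoulli inequality, (9/8)^k ≥ 1 + k/9; the induction step is (10 + k) 8/9 ≤ 9 + k.
  pow-8/9 : ∀ k → fromℕ (9 ℕ.+ k) * pow 8/9 k ≤ fromℕ 9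
  pow-8/9 zero    = ≤-refl
  pow-8/9 (suc k) = begin
    fromℕ (9 ℕ.+ suc k) * (8/9 * pow 8/9 k) ≡⟨ cong (_* (8/9 * pow 8/9 k)) (fromℕ-+ 10 k) ⟩
    (fromℕ 10 + fromℕ k) * (8/9 * pow 8/9 k)
      ≡⟨ solve 2 (λ k p → (con (fromℕ 10) :+ k) :* (con 8/9 :* p) := ((con (fromℕ 10) :+ k) :* con 8/9) :* p) refl (fromℕ k) (pow 8/9 k) ⟩
    (fromℕ 10 + fromℕ k) * 8/9 * pow 8/9 k ≤⟨ *-monoʳ (0≤pow (nonNegative⁻¹ 8/9) k) bound ⟩
    (fromℕ 9 + fromℕ k) * pow 8/9 k ≡⟨ cong (_* pow 8/9 k) (fromℕ-+ 9 k) ⟨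
    fromℕ (9 ℕ.+ k) * pow 8/9 k ≤⟨ pow-8/9 k ⟩
    fromℕ 9 ∎
    where
    open ≤-Reasoning
    bound : (fromℕ 10 + fromℕ k) * 8/9 ≤ fromℕ 9 + fromℕ k
    bound = subst ((fromℕ 10 + fromℕ k) * 8/9 ≤_)
      (solve 1 (λ k → (con (fromℕ 10) :+ k) :* con 8/9 :+ (con (+ 1 / 9) :+ con (+ 1 / 9) :* k) := con (fromℕ 9) :+ k) refl (fromℕ k))
      (p≤p+q ((fromℕ 10 + fromℕ k) * 8/9) (0≤+ (nonNegative⁻¹ (+ 1 / 9)) (*-nonNeg (nonNegative⁻¹ (+ 1 / 9)) (0≤fromℕ k))))

  pow→0 : ∀ {x} → 0ℚ ≤ x → x ≤ 8/9 → ∀ ε → 0ℚ < ε → ∃ λ K → pow x K ≤ ε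
  pow→0 0≤x x≤8/9 ε 0<ε = K , ≤-trans (pow-mono 0≤x x≤8/9 K) (*-cancelˡ (0<fromℕ (8 ℕ.+ K)) (begin
    fromℕ (9 ℕ.+ K) * pow 8/9 K ≤⟨ pow-8/9 K ⟩
    fromℕ 9 ≤⟨ proj₂ (archimedean (fromℕ 9) 0<ε) ⟩
    fromℕ K * ε ≤⟨ *-monoʳ (<⇒≤ 0<ε) (fromℕ-mono-≤ (ℕ.m≤n+m K 9)) ⟩
    fromℕ (9 ℕ.+ K) * ε ∎))
    where
    open ≤-Reasoning
    K = proj₁ (archimedean (fromℕ 9) 0<ε)

  -- The 9 is 1 / (1 - 8/9).
  geometric : ∀ {r} → 0ℚ ≤ r → r ≤ 8/9 → ∀ K n → ∑ n (λ k → pow r (K ℕ.+ k)) ≤ fromℕ 9 * pow r K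
  geometric {r} 0≤r r≤8/9 K n = ≤-trans (p≤p+q (∑ n (λ k → pow r (K ℕ.+ k))) (*-nonNeg (0≤fromℕ 9) (0≤pow 0≤r (K ℕ.+ n)))) (telescope n)
    where
    open ≤-Reasoning
    telescope : ∀ n → ∑ n (λ k → pow r (K ℕ.+ k)) + fromℕ 9 * pow r (K ℕ.+ n) ≤ fromℕ 9 * pow r K
    telescope zero    = ≤-reflexive (trans (+-identityˡ _) (cong (λ k → fromℕ 9 * pow r k) (ℕ.+-identityʳ K)))
    telescope (suc n) = begin
      ∑ n f + p + fromℕ 9 * pow r (K ℕ.+ suc n)
        ≡⟨ cong (λ k → ∑ n f + p + fromℕ 9 * pow r k) (ℕ.+-suc K n) ⟩
      ∑ n f + p + fromℕ 9 * (r * p)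
        ≤⟨ +-monoʳ-≤ (∑ n f + p) (*-monoˡ (0≤fromℕ 9) (*-monoʳ (0≤pow 0≤r (K ℕ.+ n)) r≤8/9)) ⟩
      ∑ n f + p + fromℕ 9 * (8/9 * p)
        ≡⟨ solve 2 (λ s p → s :+ p :+ con (fromℕ 9) :* (con 8/9 :* p) := s :+ con (fromℕ 9) :* p) refl (∑ n f) p ⟩
      ∑ n f + fromℕ 9 * p ≤⟨ telescope n ⟩
      fromℕ 9 * pow r K ∎
      where
      f = λ k → pow r (K ℕ.+ k)
      p = pow r (K ℕ.+ n)

  -- A product of factors 1 + e j converges if e is dominated by the differences
  -- of a null sequence t.
  module ProductBound
    (b e t : ℕ → ℚ) (0≤b : ∀ j → 0ℚ ≤ b j) (0≤e : ∀ j → 0ℚ ≤ e j) (0≤t : ∀ j → 0ℚ ≤ t j)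
    (b-suc : ∀ j → b (suc j) ≡ b j * (1ℚ + e j)) (e-t : ∀ j → e j + t (suc j) ≤ t j)
    (w : ℕ) (tw≤½ : t w ≤ ½) where

    open ≤-Reasoning

    bound : ℚ
    bound = fromℕ 2 * b w

    0≤bound : 0ℚ ≤ bound
    0≤bound = *-nonNeg (0≤fromℕ 2) (0≤b w)

    b-mono : ∀ j n → b j ≤ b (j ℕ.+ n)
    b-mono j zero    = ≤-reflexive (cong b (sym (ℕ.+-identityʳ j)))
    b-mono j (suc n) = ≤-trans (b-mono j n) (subst (b (j ℕ.+ n) ≤_)
      (trans (cong (_+ b (j ℕ.+ n) * e (j ℕ.+ n)) (sym (*-identityʳ (b (j ℕ.+ n)))))
        (trans (sym (*-distribˡ-+ (b (j ℕ.+ n)) 1ℚ (e (j ℕ.+ n)))) (trans (sym (b-suc (j ℕ.+ n))) (cong b (sym (ℕ.+-suc j n))))))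
      (p≤p+q (b (j ℕ.+ n)) (*-nonNeg (0≤b (j ℕ.+ n)) (0≤e (j ℕ.+ n)))))

    -- (1 - t)(1 + e) ≤ 1 - (t - e), and t - e is at least the next t: the shrinking t pays for the
    -- growth of b. At the start 1 - t w ≥ ½, whence the 2 in `bound`.
    invariant : ∀ n → b (w ℕ.+ n) ≤ bound * (1ℚ - t (w ℕ.+ n))
    invariant zero    = subst (λ j → b j ≤ bound * (1ℚ - t j)) (sym (ℕ.+-identityʳ w)) (begin
      b w
        ≡⟨ solve 1 (λ b → b := con (fromℕ 2) :* b :* (con 1ℚ :- con ½)) refl (b w) ⟩
      bound * (1ℚ - ½) ≤⟨ *-monoˡ 0≤bound (+-monoʳ-≤ 1ℚ (neg-antimono-≤ tw≤½)) ⟩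
      bound * (1ℚ - t w) ∎)
    invariant (suc n) = subst (λ j → b j ≤ bound * (1ℚ - t j)) (sym (ℕ.+-suc w n)) (begin
      b (suc j) ≡⟨ b-suc j ⟩
      b j * (1ℚ + e j) ≤⟨ *-monoʳ (0≤+ (nonNegative⁻¹ 1ℚ) (0≤e j)) (invariant n) ⟩
      bound * (1ℚ - t j) * (1ℚ + e j) ≡⟨ *-assoc bound (1ℚ - t j) (1ℚ + e j) ⟩
      bound * ((1ℚ - t j) * (1ℚ + e j)) ≤⟨ *-monoˡ 0≤bound (begin
        (1ℚ - t j) * (1ℚ + e j)
          ≡⟨ solve 2 (λ t e → (con 1ℚ :- t) :* (con 1ℚ :+ e) := con 1ℚ :+ (e :- t) :- t :* e) refl (t j) (e j) ⟩
        1ℚ + (e j - t j) - t j * e j ≤⟨ p-q≤p (1ℚ + (e j - t j)) (*-nonNeg (0≤t j) (0≤e j)) ⟩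
        1ℚ + (e j - t j) ≤⟨ +-monoʳ-≤ 1ℚ (subst (_≤ - t (suc j))
             (solve 3 (λ e t u → e :+ u :- t :- u := e :- t) refl (e j) (t j) (t (suc j)))
             (subst (e j + t (suc j) - t j - t (suc j) ≤_) (+-identityˡ (- t (suc j)))
             (+-monoˡ-≤ (- t (suc j)) (subst (e j + t (suc j) - t j ≤_) (+-inverseʳ (t j)) (+-monoˡ-≤ (- t j) (e-t j)))))) ⟩
        1ℚ - t (suc j) ∎) ⟩
      bound * (1ℚ - t (suc j)) ∎)
      where j = w ℕ.+ n

    bounded : ∀ j → b j ≤ bound
    bounded j = begin
      b j ≤⟨ b-mono j w ⟩
      b (j ℕ.+ w) ≡⟨ cong b (ℕ.+-comm j w) ⟩
      b (w ℕ.+ j) ≤⟨ invariant j ⟩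
      bound * (1ℚ - t (w ℕ.+ j)) ≤⟨ *-monoˡ 0≤bound (p-q≤p 1ℚ (0≤t (w ℕ.+ j))) ⟩
      bound * 1ℚ ≡⟨ *-identityʳ bound ⟩
      bound ∎

  -- η bounds the growth of partition numbers and ¾ is its inverse. θ = η² serves for pairs of
  -- partitions and has to lie below 2.
  η ¾ θ : ℚ
  η = + 4 / 3
  ¾ = + 3 / 4
  θ = + 16 / 9

  ¾η : ∀ k → pow ¾ k * pow η k ≡ 1ℚ
  ¾η k = trans (sym (pow-* ¾ η k)) (one k)
    where
    one : ∀ k → pow 1ℚ k ≡ 1ℚ
    one zero    = refl
    one (suc k) = trans (*-identityˡ (pow 1ℚ k)) (one k)

  0≤¾^ : ∀ k → 0ℚ ≤ pow ¾ k
  0≤¾^ = 0≤pow (nonNegative⁻¹ ¾)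

  0≤η^ : ∀ k → 0ℚ ≤ pow η k
  0≤η^ = 0≤pow (nonNegative⁻¹ η)

  ¾≤1 : ¾ ≤ 1ℚ
  ¾≤1 = *≤* (+≤+ (ℕ.m≤m+n 3 1))

  ¾^≤¾ : ∀ k → pow ¾ (suc k) ≤ ¾
  ¾^≤¾ zero    = ≤-refl
  ¾^≤¾ (suc k) = ≤-trans (*-monoˡ {¾} (nonNegative⁻¹ ¾) (≤-trans (¾^≤¾ k) ¾≤1)) (≤-reflexive (*-identityʳ ¾))

  -- 1 + 4 y bounds 1 / (1 - y) for y ≤ ¾.
  partitionConstant : ℕ → ℚ
  partitionConstant zero    = 1ℚ
  partitionConstant (suc j) = partitionConstant j * (1ℚ + fromℕ 4 * pow ¾ (suc j))

  0≤partitionConstant : ∀ j → 0ℚ ≤ partitionConstant j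
  0≤partitionConstant zero    = nonNegative⁻¹ 1ℚ
  0≤partitionConstant (suc j) = *-nonNeg (0≤partitionConstant j) (0≤+ (nonNegative⁻¹ 1ℚ) (*-nonNeg (0≤fromℕ 4) (0≤¾^ (suc j))))

  -- 16 (¾)^(j + 1) is the tail from j on of the series of 4 (¾)^(i + 1), and 1/32 makes it at most
  -- ½ at K.
  partitionConstant-bounded : ∀ K → pow ¾ K ≤ + 1 / 32 → ∃ λ B → 0ℚ ≤ B × (∀ j → partitionConstant j ≤ B)
  partitionConstant-bounded K small = bound , 0≤bound , bounded
    where
    open ProductBound partitionConstant (λ j → fromℕ 4 * pow ¾ (suc j)) (λ j → fromℕ 16 * pow ¾ (suc j))
      0≤partitionConstant (λ j → *-nonNeg (0≤fromℕ 4) (0≤¾^ (suc j))) (λ j → *-nonNeg (0≤fromℕ 16) (0≤¾^ (suc j)))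
      (λ _ → refl)
      (λ j → ≤-reflexive (solve 1 (λ y → con (fromℕ 4) :* y :+ con (fromℕ 16) :* (con ¾ :* y) := con (fromℕ 16) :* y) refl (pow ¾ (suc j))))
      K
      (≤-trans (*-monoˡ {fromℕ 16} (0≤fromℕ 16) (≤-trans (*-monoʳ {pow ¾ K} (0≤¾^ K) ¾≤1)
         (≤-trans (≤-reflexive (*-identityˡ (pow ¾ K))) small))) (≤-reflexive refl))

  -- Abstract, since evaluating the bound is expensive.
  abstract
    partitionBound : ∃ λ B → 0ℚ ≤ B × (∀ j → partitionConstant j ≤ B)
    partitionBound = let K , small = pow→0 (nonNegative⁻¹ ¾) (*≤* (+≤+ (ℕ.m≤m+n 27 5))) (+ 1 / 32) (positive⁻¹ (+ 1 / 32))
      in partitionConstant-bounded K small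

  module Partition where
    bound = proj₁ partitionBound
    0≤bound = proj₁ (proj₂ partitionBound)
    bounded = proj₂ (proj₂ partitionBound)

  -- A coefficient of ∏ 1 / (1 - t^i) is bounded by the value of the product at t = ¾, divided by
  -- (¾)^k. In the step a part j + 1 costs the factor y = (¾)^(j + 1), and 1 + y + 4y² ≤ 1 + 4y
  -- holds because y ≤ ¾.
  length-partitions-≤ : ∀ j n k → fromℕ (length (partitions j n k)) ≤ partitionConstant j * pow η k
  length-partitions-≤ zero    n       zero    = ≤-refl
  length-partitions-≤ zero    n       (suc k) = *-nonNeg (nonNegative⁻¹ 1ℚ) (0≤η^ (suc k))
  length-partitions-≤ (suc j) zero    k       = ≤-trans (length-partitions-≤ j zero k)
    (*-monoʳ (0≤η^ k) (subst (partitionConstant j ≤_)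
      (trans (cong (_+ partitionConstant j * y) (sym (*-identityʳ (partitionConstant j)))) (sym (*-distribˡ-+ (partitionConstant j) 1ℚ y)))
      (p≤p+q (partitionConstant j) (*-nonNeg (0≤partitionConstant j) (*-nonNeg (0≤fromℕ 4) (0≤¾^ (suc j)))))))
    where y = fromℕ 4 * pow ¾ (suc j)
  length-partitions-≤ (suc j) (suc n) k       = begin
    fromℕ (length (partitions j (suc n) k ++ rest (suc j ℕ.≤? k)))
      ≡⟨ trans (cong fromℕ (length-++ (partitions j (suc n) k))) (fromℕ-+ (length (partitions j (suc n) k)) (length (rest (suc j ℕ.≤? k)))) ⟩
    fromℕ (length (partitions j (suc n) k)) + fromℕ (length (rest (suc j ℕ.≤? k)))
      ≤⟨ +-mono-≤ (length-partitions-≤ j (suc n) k) (rest-≤ (suc j ℕ.≤? k)) ⟩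
    c * pow η k + c′ * (y * pow η k)
      ≡⟨ solve 3 (λ c y e → c :* e :+ c :* (con 1ℚ :+ con (fromℕ 4) :* y) :* (y :* e) := c :* (con 1ℚ :+ y :+ con (fromℕ 4) :* y :* y) :* e) refl c y (pow η k) ⟩
    c * (1ℚ + y + fromℕ 4 * y * y) * pow η k
      ≤⟨ *-monoʳ (0≤η^ k) (*-monoˡ (0≤partitionConstant j) (≤-trans (+-monoʳ-≤ (1ℚ + y) (*-monoˡ (*-nonNeg (0≤fromℕ 4) (0≤¾^ (suc j))) (¾^≤¾ j)))
           (≤-reflexive (solve 1 (λ y → con 1ℚ :+ y :+ con (fromℕ 4) :* y :* con ¾ := con 1ℚ :+ con (fromℕ 4) :* y) refl y)))) ⟩
    c * (1ℚ + fromℕ 4 * y) * pow η k ∎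
    where
    open ≤-Reasoning
    c = partitionConstant j
    c′ = partitionConstant (suc j)
    y = pow ¾ (suc j)
    rest : Dec (suc j ℕ.≤ k) → List (List ℕ)
    rest dec = if does dec then map (suc j ∷_) (partitions (suc j) n (k ℕ.∸ suc j)) else []
    rest-≤ : ∀ dec → fromℕ (length (rest dec)) ≤ c′ * (y * pow η k)
    rest-≤ (no _)    = *-nonNeg (0≤partitionConstant (suc j)) (*-nonNeg (0≤¾^ (suc j)) (0≤η^ k))
    rest-≤ (yes j<k) = subst₂ _≤_
      (cong fromℕ (sym (length-map (suc j ∷_) (partitions (suc j) n (k ℕ.∸ suc j)))))
      (cong (c′ *_) ηk)
      (length-partitions-≤ (suc j) n (k ℕ.∸ suc j))
      where
      ηk : pow η (k ℕ.∸ suc j) ≡ y * pow η k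
      ηk = begin-equality
        pow η (k ℕ.∸ suc j) ≡⟨ *-identityˡ (pow η (k ℕ.∸ suc j)) ⟨
        1ℚ * pow η (k ℕ.∸ suc j)
          ≡⟨ cong (_* pow η (k ℕ.∸ suc j)) (¾η (suc j)) ⟨
        y * pow η (suc j) * pow η (k ℕ.∸ suc j)
          ≡⟨ *-assoc y (pow η (suc j)) (pow η (k ℕ.∸ suc j)) ⟩
        y * (pow η (suc j) * pow η (k ℕ.∸ suc j))
          ≡⟨ cong (y *_) (pow-+ η (suc j) (k ℕ.∸ suc j)) ⟨
        y * pow η (suc j ℕ.+ (k ℕ.∸ suc j))
          ≡⟨ cong (λ k → y * pow η k) (ℕ.m+[n∸m]≡n j<k) ⟩
        y * pow η k ∎

  length-partitionsOf-≤ : ∀ k → fromℕ (length (partitionsOf k)) ≤ Partition.bound * pow η k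
  length-partitionsOf-≤ k = ≤-trans (length-partitions-≤ k k k) (*-monoʳ (0≤η^ k) (Partition.bounded k))

  length-partitionsUpTo-≤ : ∀ k → fromℕ (length (partitionsUpTo k)) ≤ Partition.bound * (fromℕ 4 * pow η k)
  length-partitionsUpTo-≤ k = ≤-trans (upTo-≤ (suc k)) (*-monoˡ Partition.0≤bound (sum-≤ k))
    where
    open ≤-Reasoning
    upTo-≤ : ∀ x → fromℕ (length (concatMap partitionsOf (upTo x))) ≤ Partition.bound * ∑ x (pow η)
    upTo-≤ zero    = ≤-reflexive (sym (*-zeroʳ Partition.bound))
    upTo-≤ (suc x) = begin
      fromℕ (length (concatMap partitionsOf (upTo (suc x))))
        ≡⟨ cong (λ xs → fromℕ (length (concatMap partitionsOf xs))) (upTo-∷ʳ x) ⟨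
      fromℕ (length (concatMap partitionsOf (upTo x ∷ʳ x)))
        ≡⟨ cong (λ xs → fromℕ (length xs)) (concatMap-++ partitionsOf (upTo x) (x ∷ [])) ⟩
      fromℕ (length (concatMap partitionsOf (upTo x) ++ (partitionsOf x ++ [])))
        ≡⟨ cong fromℕ (trans (length-++ (concatMap partitionsOf (upTo x)))
             (cong (λ xs → length (concatMap partitionsOf (upTo x)) ℕ.+ length xs) (++-identityʳ (partitionsOf x)))) ⟩
      fromℕ (length (concatMap partitionsOf (upTo x)) ℕ.+ length (partitionsOf x))
        ≡⟨ fromℕ-+ (length (concatMap partitionsOf (upTo x))) (length (partitionsOf x)) ⟩
      fromℕ (length (concatMap partitionsOf (upTo x))) + fromℕ (length (partitionsOf x))
        ≤⟨ +-mono-≤ (upTo-≤ x) (length-partitionsOf-≤ x) ⟩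
      Partition.bound * ∑ x (pow η) + Partition.bound * pow η x
        ≡⟨ *-distribˡ-+ Partition.bound (∑ x (pow η)) (pow η x) ⟨
      Partition.bound * (∑ x (pow η) + pow η x) ∎
    sum-≤ : ∀ k → ∑ (suc k) (pow η) ≤ fromℕ 4 * pow η k
    sum-≤ zero    = *≤* (+≤+ (ℕ.m≤m+n 1 3))
    sum-≤ (suc k) = ≤-trans (+-monoˡ-≤ (η * pow η k) (sum-≤ k))
      (≤-reflexive (solve 1 (λ p → con (fromℕ 4) :* p :+ con η :* p := con (fromℕ 4) :* (con η :* p)) refl (pow η k)))

  growthConstant : ℚ
  growthConstant = fromℕ 4 * (Partition.bound * Partition.bound)

  0≤growthConstant : 0ℚ ≤ growthConstant
  0≤growthConstant = *-nonNeg (0≤fromℕ 4) (*-nonNeg Partition.0≤bound Partition.0≤bound)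

  A-growth : ∀ {p} → Prime p → ∀ k → fromℕ (A (p ℕ.^ k)) ≤ growthConstant * pow θ k
  A-growth {p} pp k = begin
    fromℕ (A (p ℕ.^ k)) ≤⟨ fromℕ-mono-≤ (A-^-≤ pp k) ⟩
    fromℕ (length (partitionsOf k) ℕ.* length (partitionsUpTo k))
      ≡⟨ fromℕ-* (length (partitionsOf k)) (length (partitionsUpTo k)) ⟩
    fromℕ (length (partitionsOf k)) * fromℕ (length (partitionsUpTo k))
      ≤⟨ *-mono-≤ (0≤fromℕ (length (partitionsOf k))) (*-nonNeg Partition.0≤bound (*-nonNeg (0≤fromℕ 4) (0≤η^ k)))
           (length-partitionsOf-≤ k) (length-partitionsUpTo-≤ k) ⟩
    Partition.bound * pow η k * (Partition.bound * (fromℕ 4 * pow η k))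
      ≡⟨ solve 2 (λ b e → b :* e :* (b :* (con (fromℕ 4) :* e)) := con (fromℕ 4) :* (b :* b) :* (e :* e)) refl Partition.bound (pow η k) ⟩
    growthConstant * (pow η k * pow η k) ≡⟨ cong (growthConstant *_) (pow-* η η k) ⟨
    growthConstant * pow θ k ∎
    where open ≤-Reasoning

  0≤θ^ : ∀ k → 0ℚ ≤ pow θ k
  0≤θ^ = 0≤pow (nonNegative⁻¹ θ)

  -- 4 = 1 + 2 + 1 is the sum of the absolute coefficients of (1 - t)²; since θ ≥ 1, the earlier
  -- values are bounded by the latest power.
  secondDifference-growth : ∀ {α : ℕ → ℚ} {M} → 0ℚ ≤ M → (∀ k → 0ℚ ≤ α k) → (∀ k → α k ≤ M * pow θ k) →
                            ∀ k → ∣ secondDifference α k ∣ ≤ fromℕ 4 * M * pow θ k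
  secondDifference-growth {α} {M} 0≤M 0≤α h = go
    where
    open ≤-Reasoning
    θ-mono : ∀ k → M * pow θ k ≤ M * pow θ (suc k)
    θ-mono k = *-monoˡ 0≤M (pow-≥1 (*≤* (+≤+ (ℕ.m≤m+n 9 7))) k)
    B : ℕ → ℚ
    B k = M * pow θ k
    0≤B : ∀ k → 0ℚ ≤ B k
    0≤B k = *-nonNeg 0≤M (0≤θ^ k)
    step : ∀ k → ∣ α (suc k) - fromℕ 2 * α k ∣ ≤ fromℕ 3 * B (suc k)
    step k = begin
      ∣ α (suc k) - fromℕ 2 * α k ∣ ≤⟨ ∣p-q∣≤∣p∣+∣q∣ (α (suc k)) (fromℕ 2 * α k) ⟩
      ∣ α (suc k) ∣ + ∣ fromℕ 2 * α k ∣
        ≡⟨ cong₂ _+_ (0≤p⇒∣p∣≡p (0≤α (suc k))) (0≤p⇒∣p∣≡p (*-nonNeg (0≤fromℕ 2) (0≤α k))) ⟩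
      α (suc k) + fromℕ 2 * α k
        ≤⟨ +-mono-≤ (h (suc k)) (*-monoˡ (0≤fromℕ 2) (≤-trans (h k) (θ-mono k))) ⟩
      B (suc k) + fromℕ 2 * B (suc k)
        ≡⟨ solve 1 (λ b → b :+ con (fromℕ 2) :* b := con (fromℕ 3) :* b) refl (B (suc k)) ⟩
      fromℕ 3 * B (suc k) ∎
    widen : ∀ k → fromℕ 4 * B k ≡ fromℕ 4 * M * pow θ k
    widen k = sym (*-assoc (fromℕ 4) M (pow θ k))
    3≤4 : ∀ k → fromℕ 3 * B k ≤ fromℕ 4 * B k
    3≤4 k = *-monoʳ (0≤B k) (fromℕ-mono-≤ (ℕ.m≤m+n 3 1))
    go : ∀ k → ∣ secondDifference α k ∣ ≤ fromℕ 4 * M * pow θ k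
    go zero          = subst₂ _≤_ (sym (0≤p⇒∣p∣≡p (0≤α 0))) (widen 0)
      (≤-trans (h 0) (subst (_≤ fromℕ 4 * B 0) (*-identityˡ (B 0)) (*-monoʳ (0≤B 0) (fromℕ-mono-≤ (ℕ.m≤m+n 1 3)))))
    go (suc zero)    = subst (∣ α 1 - fromℕ 2 * α 0 ∣ ≤_) (widen 1) (≤-trans (step 0) (3≤4 1))
    go (suc (suc k)) = subst (∣ secondDifference α (suc (suc k)) ∣ ≤_) (widen (suc (suc k))) (begin
      ∣ α (suc (suc k)) - fromℕ 2 * α (suc k) + α k ∣
        ≤⟨ ∣p+q∣≤∣p∣+∣q∣ (α (suc (suc k)) - fromℕ 2 * α (suc k)) (α k) ⟩
      ∣ α (suc (suc k)) - fromℕ 2 * α (suc k) ∣ + ∣ α k ∣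
        ≤⟨ +-mono-≤ (step (suc k)) (≤-trans (≤-reflexive (0≤p⇒∣p∣≡p (0≤α k)))
             (≤-trans (h k) (≤-trans (θ-mono k) (θ-mono (suc k))))) ⟩
      fromℕ 3 * B (suc (suc k)) + B (suc (suc k))
        ≡⟨ solve 1 (λ b → con (fromℕ 3) :* b :+ b := con (fromℕ 4) :* b) refl (B (suc (suc k))) ⟩
      fromℕ 4 * B (suc (suc k)) ∎)

-- Summatory functions under the sieve and their uniform convergence.

module SieveSums where

  open Arithmetic
  open Approximation
  open DivisorSums
  open SieveFunctions
  open GrowthBounds
  open import Defs using (fromℕ; fromℕ-+; fromℕ-*; 0≤fromℕ; *-nonNeg; *-mono-≤; ∣-∣-triangle; ∣p∣≤∣q∣+∣p-q∣; ∑; ∑-+; ∑-diff)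
  open import Data.Integer.Base using (+_)
  open import Data.Nat.Base as ℕ using (ℕ; zero; suc; NonZero; z≤n; s≤s)
  open import Data.Nat.Coprimality using (Coprime)
  import Data.Nat.DivMod as ℕ
  open import Data.Nat.Primality using (Prime; prime?)
  import Data.Nat.Properties as ℕ
  open import Data.Product using (∃; _×_; _,_; proj₁; proj₂)
  open import Data.Rational.Base hiding (NonZero)
  open import Data.Rational.Properties
  open import Data.Rational.Solver using (module +-*-Solver)
  open import Relation.Binary.PropositionalEquality using (_≡_; refl; sym; trans; cong; cong₂; subst; subst₂)
  open import Relation.Nullary using (yes; no)
  open +-*-Solver using (solve; _:=_; _:+_; _:*_; _:-_; :-_; con)

  -- Each of the x quotients ⌊x / i⌋ is within 1 of x / i.
  partial-d-W : ∀ x → ∣ partial d x - 1ℚ * W x ∣ ≤ fromℕ x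
  partial-d-W x = subst₂ _≤_
    (cong₂ (λ s t → ∣ s - t ∣) (sym (partial-d x)) (trans (∑-scale x (fromℕ x) ν) (sym (*-identityˡ (W x)))))
    (*-identityʳ (fromℕ x))
    (∑-diff x (λ i _ → ∣p-q∣≤ (≤-trans (fromℕ-/ i x) (p≤p+q (fromℕ x * ν i) (nonNegative⁻¹ 1ℚ))) (/-fromℕ i x)))

  approximable-d : Approximable (partial d)
  approximable-d = approximable-small 1ℚ λ where
    .below ε 0<ε → let X , h = small-id .below ε 0<ε in X , λ x X≤x → ≤-trans (partial-d-W x) (h x X≤x)

  Bounded : ℚ → (ℕ → ℚ) → Set
  Bounded B S = ∀ x → ∣ S x ∣ ≤ B * W x

  bounded-d : Bounded 1ℚ (partial d)
  bounded-d x = subst₂ _≤_ (sym (0≤p⇒∣p∣≡p (subst (0ℚ ≤_) (sym (partial-d x)) (0≤∑ x (λ i _ → 0≤fromℕ (x ℕ./ suc i))))))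
    (trans (∑-scale x (fromℕ x) ν) (sym (*-identityˡ (W x))))
    (subst (_≤ ∑ x (λ i → fromℕ x * ν i)) (sym (partial-d x)) (∑-mono x (λ i _ → fromℕ-/ i x)))

  -- Puts a prime power into the successor form in which the lemmas on `x / suc m` are stated.
  prime-power : ∀ z k → ∃ λ m → suc z ℕ.^ k ≡ suc m × ν m ≡ pow (ν z) k
  prime-power z zero    = 0 , refl , trans (sym (*-identityˡ (ν 0))) (*ν 0)
  prime-power z (suc k) = ℕ.pred (suc z ℕ.^ suc k) , sym pred≡ , (begin
    ν m ≡⟨ *-identityʳ (ν m) ⟨
    ν m * 1ℚ ≡⟨ cong (ν m *_) one ⟨
    ν m * (fromℕ (suc m) * (ν z * pow (ν z) k))
      ≡⟨ *-assoc (ν m) (fromℕ (suc m)) (ν z * pow (ν z) k) ⟨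
    ν m * fromℕ (suc m) * (ν z * pow (ν z) k)
      ≡⟨ cong (_* (ν z * pow (ν z) k)) (trans (*-comm (ν m) (fromℕ (suc m))) (*ν m)) ⟩
    1ℚ * (ν z * pow (ν z) k) ≡⟨ *-identityˡ (ν z * pow (ν z) k) ⟩
    ν z * pow (ν z) k ∎)
    where
    open Relation.Binary.PropositionalEquality.≡-Reasoning
    m = ℕ.pred (suc z ℕ.^ suc k)
    pred≡ : suc m ≡ suc z ℕ.^ suc k
    pred≡ = ℕ.suc-pred (suc z ℕ.^ suc k) {{ℕ.m^n≢0 (suc z) (suc k)}}
    inverse : ∀ k → fromℕ (suc z ℕ.^ k) * pow (ν z) k ≡ 1ℚ
    inverse zero    = *-identityˡ 1ℚ
    inverse (suc k) = begin
      fromℕ (suc z ℕ.* suc z ℕ.^ k) * (ν z * pow (ν z) k)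
        ≡⟨ cong (_* (ν z * pow (ν z) k)) (fromℕ-* (suc z) (suc z ℕ.^ k)) ⟩
      fromℕ (suc z) * fromℕ (suc z ℕ.^ k) * (ν z * pow (ν z) k)
        ≡⟨ solve 4 (λ a b c e → a :* b :* (c :* e) := (a :* c) :* (b :* e)) refl (fromℕ (suc z)) (fromℕ (suc z ℕ.^ k)) (ν z) (pow (ν z) k) ⟩
      fromℕ (suc z) * ν z * (fromℕ (suc z ℕ.^ k) * pow (ν z) k)
        ≡⟨ cong₂ _*_ (*ν z) (inverse k) ⟩
      1ℚ * 1ℚ ≡⟨ *-identityˡ 1ℚ ⟩
      1ℚ ∎
    one : fromℕ (suc m) * (ν z * pow (ν z) k) ≡ 1ℚ
    one = trans (cong (λ n → fromℕ n * (ν z * pow (ν z) k)) pred≡) (inverse (suc k))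

  module _ {q m : ℕ} .{{q≢0 : NonZero q}} (q≡ : q ≡ suc m) where

    /-suc : ∀ x → x ℕ./ q ≡ x ℕ./ suc m
    /-suc x = ℕ./-congʳ q≡

  -- One prime p = z + 1: the passage from S = ∑ f to S′ = ∑ conv p γ f.
  module PrimeStep (z : ℕ) (1≤z : 1 ℕ.≤ z) (γ : ℕ → ℚ) (Γ : ℚ) (0≤Γ : 0ℚ ≤ Γ) (γ-≤ : ∀ k → ∣ γ k ∣ ≤ Γ * pow θ k)
                   (γ-0 : γ 0 ≡ 1ℚ) (γ-1 : γ 1 ≡ 0ℚ) (f : ℕ → ℚ) (B : ℚ) (0≤B : 0ℚ ≤ B) (S-≤ : Bounded B (partial f)) where

    open ≤-Reasoning
    p = suc z
    S = partial f
    S′ = partial (conv p γ f)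
    instance
      p^≢0 : ∀ {k} → NonZero (p ℕ.^ k)
      p^≢0 {k} = ℕ.m^n≢0 p k

    r : ℚ
    r = θ * ν z

    0≤r : 0ℚ ≤ r
    0≤r = *-nonNeg (nonNegative⁻¹ θ) (0≤ν z)

    r≤8/9 : r ≤ 8/9
    r≤8/9 = *-monoˡ {θ} (nonNegative⁻¹ θ) (ν-anti 1≤z)

    term : ℕ → ℕ → ℚ
    term x k = γ k * S ((x ℕ./ p ℕ.^ k) {{p^≢0 {k}}})

    -- γ k contributes θ^k, and W (x / p^k) ≤ W x / p^k contributes p^(-k); together they give the
    -- ratio r = θ / p.
    term-≤ : ∀ x k → ∣ term x k ∣ ≤ Γ * B * W x * pow r k
    term-≤ x k = begin
      ∣ γ k * S y ∣ ≡⟨ ∣p*q∣≡∣p∣*∣q∣ (γ k) (S y) ⟩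
      ∣ γ k ∣ * ∣ S y ∣
        ≤⟨ *-mono-≤ (0≤∣p∣ (γ k)) (*-nonNeg 0≤B (*-nonNeg (0≤pow (0≤ν z) k) (0≤W x))) (γ-≤ k)
             (≤-trans (S-≤ y) (*-monoˡ 0≤B W-≤)) ⟩
      Γ * pow θ k * (B * (pow (ν z) k * W x))
        ≡⟨ solve 5 (λ g t b v w → g :* t :* (b :* (v :* w)) := g :* b :* w :* (t :* v)) refl Γ (pow θ k) B (pow (ν z) k) (W x) ⟩
      Γ * B * W x * (pow θ k * pow (ν z) k) ≡⟨ cong (Γ * B * W x *_) (pow-* θ (ν z) k) ⟨
      Γ * B * W x * pow r k ∎
      where
      y = (x ℕ./ p ℕ.^ k) {{p^≢0 {k}}}
      pp = prime-power z k
      m = proj₁ pp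
      W-≤ : W y ≤ pow (ν z) k * W x
      W-≤ = subst₂ (λ y v → W y ≤ v * W x) (sym (/-suc {{p^≢0 {k}}} (proj₁ (proj₂ pp)) x)) (proj₂ (proj₂ pp)) (W-/-≤ m x)

    S′≡ : ∀ x → S′ x ≡ ∑ (suc x) (term x)
    S′≡ = partial-conv {p} (s≤s 1≤z) γ f

    tail : ∀ K x → K ℕ.≤ suc x → ∣ S′ x - ∑ K (term x) ∣ ≤ fromℕ 9 * (Γ * B) * pow r K * W x
    tail K x K≤ = begin
      ∣ S′ x - ∑ K (term x) ∣ ≡⟨ cong ∣_∣ difference ⟩
      ∣ ∑ n (λ k → term x (K ℕ.+ k)) ∣ ≤⟨ ∣∑∣≤∑ n (λ k → term x (K ℕ.+ k)) ⟩
      ∑ n (λ k → ∣ term x (K ℕ.+ k) ∣) ≤⟨ ∑-mono n (λ k _ → term-≤ x (K ℕ.+ k)) ⟩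
      ∑ n (λ k → Γ * B * W x * pow r (K ℕ.+ k))
        ≡⟨ ∑-scale n (Γ * B * W x) (λ k → pow r (K ℕ.+ k)) ⟩
      Γ * B * W x * ∑ n (λ k → pow r (K ℕ.+ k))
        ≤⟨ *-monoˡ (*-nonNeg (*-nonNeg 0≤Γ 0≤B) (0≤W x)) (geometric 0≤r r≤8/9 K n) ⟩
      Γ * B * W x * (fromℕ 9 * pow r K)
        ≡⟨ solve 3 (λ g w r → g :* w :* (con (fromℕ 9) :* r) := con (fromℕ 9) :* g :* r :* w) refl (Γ * B) (W x) (pow r K) ⟩
      fromℕ 9 * (Γ * B) * pow r K * W x ∎
      where
      n = suc x ℕ.∸ K
      difference : S′ x - ∑ K (term x) ≡ ∑ n (λ k → term x (K ℕ.+ k))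
      difference = trans (cong (_- ∑ K (term x)) (trans (S′≡ x)
        (trans (cong (λ k → ∑ k (term x)) (sym (ℕ.m+[n∸m]≡n K≤))) (∑-+ K n (term x)))))
        (solve 2 (λ a b → a :+ b :- a := b) refl (∑ K (term x)) (∑ n (λ k → term x (K ℕ.+ k))))

    -- Here γ 1 = 0 enters: the change from S to S′ starts at k = 2 and is therefore of size r² =
    -- O(1/p²).
    head : ∀ x → ∑ 2 (term x) ≡ S x
    head x = trans (cong₂ (λ a b → 0ℚ + a * S (x ℕ./ 1) + b * S ((x ℕ./ p ℕ.^ 1) {{p^≢0 {1}}})) γ-0 γ-1)
      (trans (solve 2 (λ a b → con 0ℚ :+ con 1ℚ :* a :+ con 0ℚ :* b := a) refl (S (x ℕ./ 1)) (S ((x ℕ./ p ℕ.^ 1) {{p^≢0 {1}}})))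
        (cong S (ℕ.n/1≡n x)))

    e : ℚ
    e = fromℕ 9 * (Γ * (θ * θ)) * (ν z * ν z)

    0≤e : 0ℚ ≤ e
    0≤e = *-nonNeg (*-nonNeg (0≤fromℕ 9) (*-nonNeg 0≤Γ (nonNegative⁻¹ (θ * θ)))) (*-nonNeg (0≤ν z) (0≤ν z))

    change : ∀ x → ∣ S′ x - S x ∣ ≤ B * e * W x
    -- At x = 0 both sums are empty; removing two terms by `tail` requires x ≥ 1.
    change zero    = subst (_≤ B * e * W 0) refl (*-nonNeg (*-nonNeg 0≤B 0≤e) (0≤W 0))
    change (suc x) = subst₂ (λ s t → ∣ S′ (suc x) - s ∣ ≤ t * W (suc x)) (head (suc x))
      (solve 4 (λ g b t v → con (fromℕ 9) :* (g :* b) :* (t :* v :* (t :* v :* con 1ℚ)) :=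
                 b :* (con (fromℕ 9) :* (g :* (t :* t)) :* (v :* v))) refl Γ B θ (ν z))
      (tail 2 (suc x) (s≤s (s≤s z≤n)))

    bounded′ : Bounded (B * (1ℚ + e)) S′
    bounded′ x = begin
      ∣ S′ x ∣ ≤⟨ ∣p∣≤∣q∣+∣p-q∣ (S′ x) (S x) ⟩
      ∣ S x ∣ + ∣ S′ x - S x ∣ ≤⟨ +-mono-≤ (S-≤ x) (change x) ⟩
      B * W x + B * e * W x
        ≡⟨ solve 3 (λ b e w → b :* w :+ b :* e :* w := b :* (con 1ℚ :+ e) :* w) refl B e (W x) ⟩
      B * (1ℚ + e) * W x ∎

    -- The first K terms are a finite combination of the functions S (x / p^k), and the tail is at
    -- most a constant times r^K W x, uniformly in x.
    approximable′ : Approximable S → Approximable S′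
    approximable′ s = approximable-limit λ ε 0<ε →
      let K , small = pow→0 0≤r r≤8/9 (shrink 0≤c ε) (0<shrink 0≤c 0<ε)
      in (λ x → ∑ K (term x)) , approximable-∑ K approximable-term , K , λ x K≤x → begin
        ∣ S′ x - ∑ K (term x) ∣ ≤⟨ tail K x (ℕ.m≤n⇒m≤1+n K≤x) ⟩
        c * pow r K * W x
          ≤⟨ *-monoʳ (0≤W x) (≤-trans (*-monoˡ 0≤c small) (*-shrink 0≤c 0<ε)) ⟩
        ε * W x ∎
      where
      c = fromℕ 9 * (Γ * B)
      0≤c = *-nonNeg (0≤fromℕ 9) (*-nonNeg 0≤Γ 0≤B)
      approximable-term : ∀ k → Approximable (λ x → term x k)
      approximable-term k = approximable-* (γ k) (approximable-cong (λ x → cong S (sym (/-suc {{p^≢0 {k}}} (proj₁ (proj₂ pp)) x)))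
        (approximable-/ (proj₁ pp) s))
        where pp = prime-power z k

  module SieveGrowth (a : ℕ → ℚ) (Γ : ℚ) (0≤Γ : 0ℚ ≤ Γ)
    (γ-≤ : ∀ {p} → Prime p → ∀ k → ∣ Sieve.γ a p k ∣ ≤ Γ * pow θ k)
    (γ-0 : ∀ {p} → Prime p → Sieve.γ a p 0 ≡ 1ℚ) (γ-1 : ∀ {p} → Prime p → Sieve.γ a p 1 ≡ 0ℚ)
    (a-1 : a 1 ≡ 1ℚ) (multiplicative : ∀ {m n} → 0 ℕ.< m → 0 ℕ.< n → Coprime m n → a (m ℕ.* n) ≡ a m * a n) where

    open Sieve a
    open ≤-Reasoning

    c : ℚ
    c = fromℕ 9 * (Γ * (θ * θ))

    0≤c : 0ℚ ≤ c
    0≤c = *-nonNeg (0≤fromℕ 9) (*-nonNeg 0≤Γ (nonNegative⁻¹ (θ * θ)))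

    -- `b` spends a factor 1 + e z on every z, whether z + 1 is prime or not; as e z = c / (z + 1)²,
    -- the product stays bounded all the same. `t` is the null sequence whose differences dominate
    -- `e`.
    e t b : ℕ → ℚ
    e z = c * (ν z * ν z)
    t z = fromℕ 2 * c * ν z
    b zero    = 1ℚ
    b (suc z) = b z * (1ℚ + e z)

    0≤e : ∀ z → 0ℚ ≤ e z
    0≤e z = *-nonNeg 0≤c (*-nonNeg (0≤ν z) (0≤ν z))

    0≤2c : 0ℚ ≤ fromℕ 2 * c
    0≤2c = *-nonNeg (0≤fromℕ 2) 0≤c

    0≤t : ∀ z → 0ℚ ≤ t z
    0≤t z = *-nonNeg 0≤2c (0≤ν z)

    0≤b : ∀ z → 0ℚ ≤ b z
    0≤b zero    = nonNegative⁻¹ 1ℚ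
    0≤b (suc z) = *-nonNeg (0≤b z) (0≤+ (nonNegative⁻¹ 1ℚ) (0≤e z))

    -- 1 / (z + 1)² ≤ 2 / ((z + 1)(z + 2)), and the right side telescopes as 2 / (z + 1) - 2 / (z +
    -- 2).
    e-t : ∀ z → e z + t (suc z) ≤ t z
    e-t z = begin
      c * (ν z * ν z) + fromℕ 2 * c * ν (suc z)
        ≤⟨ +-monoˡ-≤ (fromℕ 2 * c * ν (suc z)) (*-monoˡ 0≤c (*-monoˡ (0≤ν z) ν-≤)) ⟩
      c * (ν z * (fromℕ 2 * ν (suc z))) + fromℕ 2 * c * ν (suc z)
        ≡⟨ solve 3 (λ c v u → c :* (v :* (con (fromℕ 2) :* u)) :+ con (fromℕ 2) :* c :* u := con (fromℕ 2) :* c :* (v :* u :+ u)) refl c (ν z) (ν (suc z)) ⟩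
      fromℕ 2 * c * (ν z * ν (suc z) + ν (suc z))
        ≡⟨ cong (fromℕ 2 * c *_) ν-difference ⟩
      fromℕ 2 * c * ν z ∎
      where
      ν-difference : ν z * ν (suc z) + ν (suc z) ≡ ν z
      ν-difference = begin-equality
        ν z * u + u
          ≡⟨ cong (λ w → ν z * u + w) (trans (cong (_* u) (*ν z)) (*-identityˡ u)) ⟨
        ν z * u + fromℕ (suc z) * ν z * u
          ≡⟨ solve 3 (λ v u n → v :* u :+ n :* v :* u := v :* ((con 1ℚ :+ n) :* u)) refl (ν z) u (fromℕ (suc z)) ⟩
        ν z * ((1ℚ + fromℕ (suc z)) * u)
          ≡⟨ cong (λ w → ν z * (w * u)) (fromℕ-+ 1 (suc z)) ⟨
        ν z * (fromℕ (suc (suc z)) * u) ≡⟨ cong (ν z *_) (*ν (suc z)) ⟩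
        ν z * 1ℚ ≡⟨ *-identityʳ (ν z) ⟩
        ν z ∎
        where u = ν (suc z)
      ν-≤ : ν z ≤ fromℕ 2 * ν (suc z)
      ν-≤ = subst₂ _≤_ ν-difference (solve 1 (λ u → u :+ u := con (fromℕ 2) :* u) refl (ν (suc z)))
        (+-monoˡ-≤ (ν (suc z)) (subst (ν z * ν (suc z) ≤_) (*-identityˡ (ν (suc z))) (*-monoʳ (0≤ν (suc z)) (ν-anti {0} {z} z≤n))))

    S : ℕ → ℕ → ℚ
    S z = partial (F z)

    t-small : ∀ ε → 0ℚ < ε → ∃ λ w → ∀ z → w ℕ.≤ z → t z ≤ ε
    t-small ε 0<ε = let w , h = ν-limit (shrink 0≤2c ε) (0<shrink 0≤2c 0<ε) in
      w , λ z w≤z → ≤-trans (*-monoˡ 0≤2c (h z w≤z)) (*-shrink 0≤2c 0<ε)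

    2≤p : ∀ {z} → Prime (suc z) → 1 ℕ.≤ z
    2≤p pp = ℕ.≤-pred (2≤prime pp)

    S-bounded : ∀ z → Bounded (b z) (S z)
    S-bounded zero = bounded-d
    S-bounded (suc z) = step (prime? (suc z))
      where
      step : ∀ dec → Bounded (b (suc z)) (partial (sieveStep (suc z) dec (F z)))
      step (yes pp) = PrimeStep.bounded′ z (2≤p pp) (γ (suc z)) Γ 0≤Γ (γ-≤ pp) (γ-0 pp) (γ-1 pp) (F z) (b z) (0≤b z) (S-bounded z)
      step (no _) x = ≤-trans (S-bounded z x) (*-monoʳ (0≤W x) (subst (_≤ b (suc z)) (*-identityʳ (b z))
        (*-monoˡ (0≤b z) (p≤p+q 1ℚ (0≤e z)))))

    S-change : ∀ z x → ∣ S (suc z) x - S z x ∣ ≤ b z * e z * W x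
    S-change z x = step (prime? (suc z))
      where
      step : ∀ dec → ∣ partial (sieveStep (suc z) dec (F z)) x - S z x ∣ ≤ b z * e z * W x
      step (yes pp) = PrimeStep.change z (2≤p pp) (γ (suc z)) Γ 0≤Γ (γ-≤ pp) (γ-0 pp) (γ-1 pp) (F z) (b z) (0≤b z) (S-bounded z) x
      step (no _)   = subst (_≤ b z * e z * W x) (cong ∣_∣ (sym (+-inverseʳ (S z x)))) (*-nonNeg (*-nonNeg (0≤b z) (0≤e z)) (0≤W x))

    S-approximable : ∀ z → Approximable (S z)
    S-approximable zero = approximable-d
    S-approximable (suc z) = step (prime? (suc z))
      where
      step : ∀ dec → Approximable (partial (sieveStep (suc z) dec (F z)))
      step (yes pp) = PrimeStep.approximable′ z (2≤p pp) (γ (suc z)) Γ 0≤Γ (γ-≤ pp) (γ-0 pp) (γ-1 pp) (F z) (b z) (0≤b z) (S-bounded z)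
                        (S-approximable z)
      step (no _)   = S-approximable z

    S-≤ : ∀ z x → x ℕ.≤ z → S z x ≡ partial a x
    S-≤ z x x≤z = ∑-cong x λ i i<x → F-≤ a-1 multiplicative z (s≤s z≤n) (ℕ.≤-trans i<x x≤z)

    module _ (w : ℕ) (tw≤½ : t w ≤ ½) where
      open ProductBound b e t 0≤b 0≤e 0≤t (λ _ → refl) e-t w tw≤½

      S-converges : ∀ z n x → ∣ S (n ℕ.+ z) x - S z x ∣ ≤ bound * (t z - t (n ℕ.+ z)) * W x
      S-converges z zero    x = ≤-reflexive (trans (cong ∣_∣ (+-inverseʳ (S z x)))
        (sym (trans (cong (λ u → bound * u * W x) (+-inverseʳ (t z))) (trans (cong (_* W x) (*-zeroʳ bound)) (*-zeroˡ (W x))))))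
      S-converges z (suc n) x = begin
        ∣ S (suc y) x - S z x ∣
          ≤⟨ ∣-∣-triangle (S (suc y) x) (S y x) (S z x) ⟩
        ∣ S (suc y) x - S y x ∣ + ∣ S y x - S z x ∣
          ≤⟨ +-mono-≤ (≤-trans (S-change y x) (*-monoʳ (0≤W x) (*-mono-≤ (0≤b y) (≤-trans (0≤e y) e≤) (bounded y) e≤)))
               (S-converges z n x) ⟩
        bound * (t y - t (suc y)) * W x + bound * (t z - t y) * W x
          ≡⟨ solve 5 (λ b y s z w → b :* (y :- s) :* w :+ b :* (z :- y) :* w := b :* (z :- s) :* w) refl bound (t y) (t (suc y)) (t z) (W x) ⟩
        bound * (t z - t (suc y)) * W x ∎
        where
        y = n ℕ.+ z
        e≤ : e y ≤ t y - t (suc y)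
        e≤ = subst (_≤ t y - t (suc y)) (solve 2 (λ e t → e :+ t :- t := e) refl (e y) (t (suc y))) (+-monoˡ-≤ (- t (suc y)) (e-t y))

      -- After x further steps the sieve has reached x + z ≥ x, where its sum up to x is that of a;
      -- the telescoped bound does not depend on the number of steps.
      S-close : ∀ z x → ∣ partial a x - S z x ∣ ≤ bound * t z * W x
      S-close z x = subst (λ s → ∣ s - S z x ∣ ≤ bound * t z * W x) (S-≤ (x ℕ.+ z) x (ℕ.m≤m+n x z))
        (≤-trans (S-converges z x x) (*-monoʳ (0≤W x) (*-monoˡ 0≤bound (p-q≤p (t z) (0≤t (x ℕ.+ z))))))

      approximable : Approximable (partial a)
      approximable = approximable-limit λ ε 0<ε →
        let z , h = t-small (shrink 0≤bound ε) (0<shrink 0≤bound 0<ε)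
        in S z , S-approximable z , 0 , λ x _ → ≤-trans (S-close z x)
             (*-monoʳ (0≤W x) (≤-trans (*-monoˡ 0≤bound (h z ℕ.≤-refl)) (*-shrink 0≤bound 0<ε)))

    approximable-a : Approximable (partial a)
    approximable-a = let w , h = t-small ½ (positive⁻¹ ½) in approximable w (h w ℕ.≤-refl)

-- Riemann sums of the logarithm compared with harmonic numbers.

module Logarithm where

  open Approximation
  open import Defs hiding (A)
  open import Data.Integer.Base using (+_)
  open import Data.Nat.Base as ℕ using (ℕ; zero; suc; z≤n; s≤s)
  import Data.Nat.Properties as ℕ
  open import Data.Product using (_,_; proj₁; proj₂)
  open import Data.Rational.Base
  open import Data.Rational.Properties
  open import Data.Rational.Solver using (module +-*-Solver)
  open import Relation.Binary.PropositionalEquality using (_≡_; refl; sym; trans; cong; cong₂; subst)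
  open +-*-Solver using (solve; _:=_; _:+_; _:*_; _:-_; :-_; con)
  open ℝ

  0<1 : 0ℚ < 1ℚ
  0<1 = positive⁻¹ 1ℚ

  module Unit = Bounds 0<1 ≤-refl

  recip-unique : ∀ {p y} (0<p : 0ℚ < p) → p * y ≡ 1ℚ → recip 0<p ≡ y
  recip-unique {p} {y} 0<p py≡1 = trans (sym (*-identityʳ (recip 0<p))) (trans (cong (recip 0<p *_) (sym py≡1))
    (trans (sym (*-assoc (recip 0<p) p y)) (trans (cong (_* y) (recip-inverseˡ 0<p)) (*-identityˡ y))))

  κκ≡1 : Unit.κ * Unit.κ ≡ 1ℚ
  κκ≡1 = cong₂ _*_ κ≡1 κ≡1
    where
    κ≡1 : Unit.κ ≡ 1ℚ
    κ≡1 = recip-unique 0<1 refl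

  fromℕ-suc-1 : ∀ m → fromℕ (suc m) - 1ℚ ≡ fromℕ m
  fromℕ-suc-1 m = trans (cong (_- 1ℚ) (fromℕ-+ 1 m)) (solve 1 (λ m → con 1ℚ :+ m :- con 1ℚ := m) refl (fromℕ m))

  -- Riemann sums of ∫ dt/t over [1, M + 1] whose number of steps is a multiple of
  -- M are differences of harmonic numbers.
  module _ (n m : ℕ) where
    private
      N = suc n
      M = suc m
      k = suc M
      0<k = 0<fromℕ M

    riemann-harmonic : riemann (N ℕ.* M) 0<k ≡ ∑ (N ℕ.* M) (λ i → ν (N ℕ.+ i))
    riemann-harmonic = ∑-cong (N ℕ.* M) λ i i< → begin
      (fromℕ k - 1ℚ) * recip (0<node (N ℕ.* M) i 0<k)
        ≡⟨ cong₂ _*_ (fromℕ-suc-1 M) (recip-unique (0<node (N ℕ.* M) i 0<k) (inverse i i<)) ⟩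
      fromℕ M * (ν m * ν (N ℕ.+ i)) ≡⟨ *-assoc (fromℕ M) (ν m) (ν (N ℕ.+ i)) ⟨
      fromℕ M * ν m * ν (N ℕ.+ i)
        ≡⟨ trans (cong (_* ν (N ℕ.+ i)) (*ν m)) (*-identityˡ (ν (N ℕ.+ i))) ⟩
      ν (N ℕ.+ i) ∎
      where
      open Relation.Binary.PropositionalEquality.≡-Reasoning
      inverse : ∀ i → i ℕ.< N ℕ.* M → node (N ℕ.* M) i (fromℕ k) * (ν m * ν (N ℕ.+ i)) ≡ 1ℚ
      inverse i i< = begin
        node (N ℕ.* M) i (fromℕ k) * (ν m * v)
          ≡⟨ cong (_* (ν m * v)) (trans (node-≡ (N ℕ.* M) i (fromℕ k) i<)
               (cong₂ (λ a b → a + fromℕ (suc i) * b) (fromℕ-* N M) (fromℕ-suc-1 M))) ⟩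
        (fromℕ N * fromℕ M + fromℕ (suc i) * fromℕ M) * (ν m * v)
          ≡⟨ solve 5 (λ n m i w v → (n :* m :+ i :* m) :* (w :* v) := (m :* w) :* ((n :+ i) :* v)) refl (fromℕ N) (fromℕ M) (fromℕ (suc i)) (ν m) v ⟩
        fromℕ M * ν m * ((fromℕ N + fromℕ (suc i)) * v)
          ≡⟨ cong₂ _*_ (*ν m) (cong (_* v) (trans (sym (fromℕ-+ N (suc i))) (cong fromℕ (ℕ.+-suc N i)))) ⟩
        1ℚ * (fromℕ (suc (N ℕ.+ i)) * v)
          ≡⟨ trans (*-identityˡ _) (*ν (N ℕ.+ i)) ⟩
        1ℚ ∎
        where v = ν (N ℕ.+ i)

    -- The N terms 1 / (N (j + 1) + r + 1) with r < N lie between 1 / (N (j + 2)) and 1 / (N (j +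
    -- 1)), so a block lies between 1 / (j + 2) and 1 / (j + 1).
    block : ℕ → ℚ
    block j = ∑ N (λ r → ν (N ℕ.+ (j ℕ.* N ℕ.+ r)))

    riemann-blocks : riemann (N ℕ.* M) 0<k ≡ ∑ M block
    riemann-blocks = trans riemann-harmonic
      (trans (cong (λ x → ∑ x (λ i → ν (N ℕ.+ i))) (ℕ.*-comm N M)) (∑-* M N (λ i → ν (N ℕ.+ i))))

    private
      N-times : ∀ c → fromℕ N * (c * ν n) ≡ c
      N-times c = trans (solve 3 (λ n c v → n :* (c :* v) := (n :* v) :* c) refl (fromℕ N) c (ν n))
        (trans (cong (_* c) (*ν n)) (*-identityˡ c))

      fromℕ-N : ∀ j → fromℕ (suc j ℕ.* N) * (ν j * ν n) ≡ 1ℚ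
      fromℕ-N j = trans (cong (_* (ν j * ν n)) (fromℕ-* (suc j) N))
        (trans (solve 4 (λ a b c e → a :* b :* (c :* e) := (a :* c) :* (b :* e)) refl (fromℕ (suc j)) (fromℕ N) (ν j) (ν n))
          (trans (cong₂ _*_ (*ν j) (*ν n)) (*-identityˡ 1ℚ)))

    block-upper : ∀ j → block j ≤ ν j
    block-upper j = subst (block j ≤_) (trans (∑-const N (ν j * ν n)) (N-times (ν j)))
      (∑-mono N λ r _ → recip-≤ (0<fromℕ (N ℕ.+ (j ℕ.* N ℕ.+ r))) (subst (_≤ fromℕ (suc (N ℕ.+ (j ℕ.* N ℕ.+ r))) * (ν j * ν n)) (fromℕ-N j)
        (*-monoʳ (*-nonNeg (0≤ν j) (0≤ν n)) (fromℕ-mono-≤ {suc j ℕ.* N} {suc (N ℕ.+ (j ℕ.* N ℕ.+ r))}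
          (ℕ.m≤n⇒m≤1+n (ℕ.+-monoʳ-≤ N (ℕ.m≤m+n (j ℕ.* N) r)))))))

    block-lower : ∀ j → ν (suc j) ≤ block j
    block-lower j = subst (_≤ block j) (trans (∑-const N (ν (suc j) * ν n)) (N-times (ν (suc j))))
      (∑-mono N λ r r<N → let i = N ℕ.+ (j ℕ.* N ℕ.+ r) ; y = ν (suc j) * ν n in begin
        y ≡⟨ *-identityʳ y ⟨
        y * 1ℚ ≡⟨ cong (y *_) (*ν i) ⟨
        y * (fromℕ (suc i) * ν i)
          ≡⟨ solve 3 (λ y f v → y :* (f :* v) := (f :* y) :* v) refl y (fromℕ (suc i)) (ν i) ⟩
        fromℕ (suc i) * y * ν i
          ≤⟨ *-monoʳ (0≤ν i) (*-monoʳ (*-nonNeg (0≤ν (suc j)) (0≤ν n)) (fromℕ-mono-≤ {suc i} {suc (suc j) ℕ.* N} (i< r r<N))) ⟩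
        fromℕ (suc (suc j) ℕ.* N) * y * ν i
          ≡⟨ trans (cong (_* ν i) (fromℕ-N (suc j))) (*-identityˡ (ν i)) ⟩
        ν i ∎)
      where
      open ≤-Reasoning
      i< : ∀ r → r ℕ.< N → suc (N ℕ.+ (j ℕ.* N ℕ.+ r)) ℕ.≤ suc (suc j) ℕ.* N
      i< r r<N = ℕ.≤-trans (ℕ.≤-reflexive (trans (sym (ℕ.+-suc N (j ℕ.* N ℕ.+ r))) (cong (N ℕ.+_) (sym (ℕ.+-suc (j ℕ.* N) r)))))
        (ℕ.+-monoʳ-≤ N (ℕ.≤-trans (ℕ.+-monoʳ-≤ (j ℕ.* N) r<N) (ℕ.≤-reflexive (ℕ.+-comm (j ℕ.* N) N))))

    harmonic-shift : ∀ M → H (suc M) ≡ ∑ M (λ j → ν (suc j)) + 1ℚ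
    harmonic-shift zero    = refl
    harmonic-shift (suc M) = trans (cong (_+ ν (suc M)) (harmonic-shift M))
      (solve 2 (λ a v → a :+ con 1ℚ :+ v := a :+ v :+ con 1ℚ) refl (∑ M (λ j → ν (suc j))) (ν (suc M)))

    -- Summing the bounds for the M blocks puts the Riemann sum between H (M + 1) - 1 and H M.
    riemann-H : ∣ riemann (N ℕ.* M) 0<k - H k ∣ ≤ 1ℚ
    riemann-H = subst (λ s → ∣ s - H k ∣ ≤ 1ℚ) (sym riemann-blocks) (∣p-q∣≤
      (≤-trans (∑-mono M (λ j _ → block-upper j)) (≤-trans (H-mono (ℕ.n≤1+n M)) (p≤p+q (H k) (nonNegative⁻¹ 1ℚ))))
      (subst (_≤ ∑ M block + 1ℚ) (sym (harmonic-shift M)) (+-monoˡ-≤ 1ℚ (∑-mono M (λ j _ → block-lower j)))))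

    -- Refining N steps to N M costs at most M² / N, since the integrand is handled on [1, M + 1]; N
    -- ≥ M² makes this at most 1.
    riemann-refined : M ℕ.* M ℕ.≤ N → ∣ riemann N 0<k - H k ∣ ≤ fromℕ 2
    riemann-refined M²≤N = ≤-trans (∣-∣-triangle (riemann N 0<k) (riemann (N ℕ.* M) 0<k) (H k))
      (+-mono-≤ (begin
        ∣ riemann N 0<k - riemann (N ℕ.* M) 0<k ∣
          ≤⟨ Unit.refine n m 0<k (fromℕ-mono-≤ {1} {k} (s≤s z≤n)) ⟩
        ∣ fromℕ k - 1ℚ ∣ * ∣ fromℕ k - 1ℚ ∣ * (Unit.κ * Unit.κ) * ν n
          ≡⟨ cong₂ (λ a b → a * a * b * ν n) (trans (cong ∣_∣ (fromℕ-suc-1 M)) (0≤p⇒∣p∣≡p (0≤fromℕ M))) κκ≡1 ⟩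
        fromℕ M * fromℕ M * 1ℚ * ν n
          ≡⟨ cong (_* ν n) (trans (*-identityʳ (fromℕ M * fromℕ M)) (sym (fromℕ-* M M))) ⟩
        fromℕ (M ℕ.* M) * ν n ≤⟨ *-monoʳ (0≤ν n) (fromℕ-mono-≤ M²≤N) ⟩
        fromℕ N * ν n ≡⟨ *ν n ⟩
        1ℚ ∎) riemann-H)
      where open ≤-Reasoning

  -- For endpoints at least 1 the Riemann sums have Lipschitz constant 1, so moving q to k adds at
  -- most 1 to the previous 2.
  riemann-bound : ∀ k n {q} (0<q : 0ℚ < q) → 2 ℕ.≤ k → k ℕ.* k ℕ.≤ suc n → 1ℚ ≤ q → ∣ q - fromℕ k ∣ ≤ 1ℚ →
                  ∣ riemann (suc n) 0<q - H k ∣ ≤ fromℕ 3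
  riemann-bound k@(suc M@(suc m)) n {q} 0<q (s≤s (s≤s _)) k²≤n 1≤q near = ≤-trans
    (∣-∣-triangle (riemann (suc n) 0<q) (riemann (suc n) (0<fromℕ M)) (H k))
    (+-mono-≤
      (≤-trans (Unit.lipschitz n 0<q (0<fromℕ M) 1≤q (fromℕ-mono-≤ {1} {k} (s≤s z≤n)))
        (≤-trans (≤-reflexive (trans (cong (∣ q - fromℕ k ∣ *_) κκ≡1) (*-identityʳ ∣ q - fromℕ k ∣))) near))
      (riemann-refined n m (ℕ.≤-trans (ℕ.*-mono-≤ (ℕ.n≤1+n M) (ℕ.n≤1+n M)) k²≤n)))

  -- The value of `recip` does not depend on the proof of positivity, so any such proof may stand
  -- for the one inside `log`.
  log-seq : ∀ x (0<x : 0ℝ <ʳ x) n (0<q : 0ℚ < seq x (proj₁ (proj₂ (proj₂ 0<x)) ℕ.+ n)) →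
            seq (log x 0<x) n ≡ riemann (suc n) 0<q
  log-seq x (c , 0<c , N , c≤) n 0<q = refl

-- The constant C and the passage from x H x to x log x.

module FinalEstimate where

  open Approximation
  open Logarithm
  open import Defs hiding (A)
  open import Data.Integer.Base using (+_)
  open import Data.Nat.Base as ℕ using (ℕ; suc; z≤n; s≤s)
  import Data.Nat.Properties as ℕ
  open import Data.Product using (∃; _,_; proj₁; proj₂)
  open import Data.Rational.Base
  open import Data.Rational.Properties
  open import Data.Rational.Solver using (module +-*-Solver)
  open import Data.Sum.Base using (inj₁; inj₂)
  open import Relation.Binary.PropositionalEquality using (_≡_; refl; sym; trans; cong; cong₂; subst; subst₂)
  open +-*-Solver using (solve; _:=_; _:+_; _:*_; _:-_; :-_; con)
  open ℝ

  p≤∣p∣ : ∀ p → p ≤ ∣ p ∣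
  p≤∣p∣ p with ≤-total 0ℚ p
  ... | inj₁ 0≤p = ≤-reflexive (sym (0≤p⇒∣p∣≡p 0≤p))
  ... | inj₂ p≤0 = ≤-trans p≤0 (0≤∣p∣ p)

  fromℕ-cancel-≤ : ∀ {m n} → fromℕ m ≤ fromℕ n → m ℕ.≤ n
  fromℕ-cancel-≤ {m} {n} h = ℕ.≮⇒≥ λ n<m → <-irrefl refl (<-≤-trans (n<1+n n) (≤-trans (fromℕ-mono-≤ {suc n} {m} n<m) h))
    where
    n<1+n : ∀ n → fromℕ n < fromℕ (suc n)
    n<1+n n = subst₂ _<_ (+-identityˡ (fromℕ n)) (sym (fromℕ-+ 1 n)) (+-monoˡ-< (fromℕ n) 0<1)

  W>0 : ∀ {x} → 1 ℕ.≤ x → 0ℚ < W x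
  W>0 {x} 1≤x = <-≤-trans 0<1 (subst (_≤ W x) (*-identityˡ 1ℚ)
    (*-mono-≤ (nonNegative⁻¹ 1ℚ) (0≤H x) (fromℕ-mono-≤ {1} {x} 1≤x) (H-mono {1} {x} 1≤x)))

  *-cancelʳ-W : ∀ {x p q} → 1 ℕ.≤ x → p * W x ≤ q * W x → p ≤ q
  *-cancelʳ-W {x} 1≤x = *-cancelʳ-≤-pos (W x) {{positive (W>0 1≤x)}}

  record NearLog (x : ℝ) (0<x : 0ℝ <ʳ x) (k n : ℕ) : Set where
    field
      near-x   : ∣ seq x n - fromℕ k ∣ ≤ 1ℚ
      near-log : ∣ seq (log x 0<x) n - H k ∣ ≤ fromℕ 3

  floor-near : ∀ x k → IsFloor x k → ∃ λ N → ∀ n → N ℕ.≤ n → ∣ seq x n - fromℕ k ∣ ≤ 1ℚ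
  floor-near x k (k≤x , ε , 0<ε , M , x<k+1) =
    let N , h = k≤x 1ℚ 0<1 in N ℕ.⊔ M , λ n le →
      ∣p-q∣≤ (≤-trans (p≤p+q (seq x n) (<⇒≤ 0<ε)) (≤-trans (x<k+1 n (ℕ.m⊔n≤o⇒n≤o N M le))
               (≤-reflexive (trans (fromℕ-+ 1 k) (+-comm 1ℚ (fromℕ k))))))
             (h n (ℕ.m⊔n≤o⇒m≤o N M le))

  -- At a common index the slack `ε` of x < k + 1 pays for the tolerance of X + 1 ≤ x.
  floor-≥ : ∀ x k X → IsFloor x k → fromℚ (fromℕ (suc X)) ≤ʳ x → X ℕ.≤ k
  floor-≥ x k X (_ , ε , 0<ε , M , x<k+1) X≤x =
    let N , h = X≤x ε 0<ε ; n = N ℕ.⊔ M in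
    ℕ.≤-pred (fromℕ-cancel-≤ {suc X} {suc k} (≤-trans (h n (ℕ.m≤m⊔n N M)) (x<k+1 n (ℕ.m≤n⊔m N M))))

  -- From the index k² on, the Riemann sums have enough steps for `riemann-bound`. The logarithm
  -- samples x at N₀ + n instead of n, but both samples are within 1 of k.
  nearLog : ∀ x (0<x : 0ℝ <ʳ x) k → 2 ℕ.≤ k → IsFloor x k → ∃ λ N → ∀ n → N ℕ.≤ n → NearLog x 0<x k n
  nearLog x 0<x@(c , 0<c , N₀ , c≤) k 2≤k floor =
    let N , h = floor-near x k floor in N ℕ.⊔ k ℕ.* k , λ n le →
    let N≤n = ℕ.m⊔n≤o⇒m≤o N (k ℕ.* k) le
        near = h (N₀ ℕ.+ n) (ℕ.≤-trans N≤n (ℕ.m≤n+m n N₀))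
        1≤q = 1≤ near
        0<q = <-≤-trans 0<1 1≤q
    in record
      { near-x = h n N≤n
      ; near-log = subst (λ l → ∣ l - H k ∣ ≤ fromℕ 3) (sym (log-seq x 0<x n 0<q))
          (riemann-bound k n 0<q 2≤k (ℕ.m≤n⇒m≤1+n (ℕ.m⊔n≤o⇒n≤o N (k ℕ.* k) le)) 1≤q near) }
    where
    open ≤-Reasoning
    1≤ : ∀ {q} → ∣ q - fromℕ k ∣ ≤ 1ℚ → 1ℚ ≤ q
    1≤ {q} near = begin
      1ℚ ≡⟨⟩
      fromℕ 2 - 1ℚ ≤⟨ +-mono-≤ (fromℕ-mono-≤ {2} {k} 2≤k) (neg-antimono-≤ near) ⟩
      fromℕ k - ∣ q - fromℕ k ∣
        ≤⟨ p≤q+r⇒p-q≤r (≤-trans (p≤∣p-q∣+q (fromℕ k) q) (≤-reflexive (cong (_+ q) (∣p-q∣-sym (fromℕ k) q)))) ⟩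
      q ∎
      where
      p≤∣p-q∣+q : ∀ p q → p ≤ ∣ p - q ∣ + q
      p≤∣p-q∣+q p q = subst (_≤ ∣ p - q ∣ + q) (solve 2 (λ p q → p :- q :+ q := p) refl p q) (+-monoˡ-≤ q (p≤∣p∣ (p - q)))

  logError : ℕ → ℚ
  logError k = fromℕ 6 * fromℕ k + H k

  small-logError : Small logError
  small-logError = small-+ (small-* (0≤fromℕ 6) small-id) small-H

  -- k H - x l = k (H - l) + (k - x) l is at most 3 k + (H + 3) in absolute value, and 3 ≤ 3 k.
  W-near : ∀ x 0<x k n → 1 ℕ.≤ k → NearLog x 0<x k n → ∣ W k - seq x n * seq (log x 0<x) n ∣ ≤ logError k
  W-near x 0<x k n 1≤k near = begin
    ∣ K * h - X * l ∣
      ≡⟨ cong ∣_∣ (solve 4 (λ k h x l → k :* h :- x :* l := k :* (h :- l) :+ (k :- x) :* l) refl K h X l) ⟩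
    ∣ K * (h - l) + (K - X) * l ∣ ≤⟨ ∣p+q∣≤∣p∣+∣q∣ (K * (h - l)) ((K - X) * l) ⟩
    ∣ K * (h - l) ∣ + ∣ (K - X) * l ∣
      ≡⟨ cong₂ _+_ (∣p*q∣≡∣p∣*∣q∣ K (h - l)) (∣p*q∣≡∣p∣*∣q∣ (K - X) l) ⟩
    ∣ K ∣ * ∣ h - l ∣ + ∣ K - X ∣ * ∣ l ∣
      ≡⟨ cong₂ _+_ (cong₂ _*_ (0≤p⇒∣p∣≡p (0≤fromℕ k)) (∣p-q∣-sym h l)) (cong (_* ∣ l ∣) (∣p-q∣-sym K X)) ⟩
    K * ∣ l - h ∣ + ∣ X - K ∣ * ∣ l ∣ ≤⟨ +-mono-≤ (*-monoˡ (0≤fromℕ k) near-log)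
         (*-mono-≤ (0≤∣p∣ (X - K)) (0≤+ (0≤H k) (0≤fromℕ 3)) near-x ∣l∣≤) ⟩
    K * fromℕ 3 + 1ℚ * (h + fromℕ 3)
      ≡⟨ solve 2 (λ k h → k :* con (fromℕ 3) :+ con 1ℚ :* (h :+ con (fromℕ 3)) := con (fromℕ 3) :* k :+ con (fromℕ 3) :* con 1ℚ :+ h) refl K h ⟩
    fromℕ 3 * K + fromℕ 3 * 1ℚ + h
      ≤⟨ +-monoˡ-≤ h (+-monoʳ-≤ (fromℕ 3 * K) (*-monoˡ (0≤fromℕ 3) (fromℕ-mono-≤ {1} {k} 1≤k))) ⟩
    fromℕ 3 * K + fromℕ 3 * K + h
      ≡⟨ cong (_+ h) (solve 1 (λ k → con (fromℕ 3) :* k :+ con (fromℕ 3) :* k := con (fromℕ 6) :* k) refl K) ⟩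
    logError k ∎
    where
    open ≤-Reasoning
    open NearLog near
    K = fromℕ k
    h = H k
    X = seq x n
    l = seq (log x 0<x) n
    ∣l∣≤ : ∣ l ∣ ≤ h + fromℕ 3
    ∣l∣≤ = ≤-trans (∣p∣≤∣q∣+∣p-q∣ l h) (+-mono-≤ (≤-reflexive (0≤p⇒∣p∣≡p (0≤H k))) near-log)

  module Asymptotic {S : ℕ → ℚ} (approx : Approximable S) (S-≥ : ∀ x → W x ≤ S x + fromℕ x) where
    open ≤-Reasoning

    c : ℕ → ℚ
    c n = proj₁ (approx .approximate (ν n) (0<ν n))

    threshold : ℕ → ℕ
    threshold n = proj₁ (proj₂ (approx .approximate (ν n) (0<ν n)))

    close : ∀ n x → threshold n ℕ.≤ x → ∣ S x - c n * W x ∣ ≤ ν n * W x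
    close n = proj₂ (proj₂ (approx .approximate (ν n) (0<ν n)))

    -- Both constants approximate S at one x beyond both thresholds; W x > 0 is then cancelled.
    c-cauchy : ∀ m n → ∣ c m - c n ∣ ≤ ν m + ν n
    c-cauchy m n = *-cancelʳ-W {x} 1≤x (begin
      ∣ c m - c n ∣ * W x ≡⟨ cong (∣ c m - c n ∣ *_) (0≤p⇒∣p∣≡p (0≤W x)) ⟨
      ∣ c m - c n ∣ * ∣ W x ∣ ≡⟨ ∣p*q∣≡∣p∣*∣q∣ (c m - c n) (W x) ⟨
      ∣ (c m - c n) * W x ∣
        ≡⟨ cong ∣_∣ (solve 3 (λ a b w → (a :- b) :* w := a :* w :- b :* w) refl (c m) (c n) (W x)) ⟩
      ∣ c m * W x - c n * W x ∣ ≤⟨ ∣-∣-triangle (c m * W x) (S x) (c n * W x) ⟩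
      ∣ c m * W x - S x ∣ + ∣ S x - c n * W x ∣
        ≤⟨ +-mono-≤ (≤-trans (≤-reflexive (∣p-q∣-sym (c m * W x) (S x))) (close m x m≤)) (close n x n≤) ⟩
      ν m * W x + ν n * W x ≡⟨ *-distribʳ-+ (W x) (ν m) (ν n) ⟨
      (ν m + ν n) * W x ∎)
      where
      x = 1 ℕ.⊔ (threshold m ℕ.⊔ threshold n)
      1≤x = ℕ.m≤m⊔n 1 (threshold m ℕ.⊔ threshold n)
      m≤ = ℕ.≤-trans (ℕ.m≤m⊔n (threshold m) (threshold n)) (ℕ.m≤n⊔m 1 (threshold m ℕ.⊔ threshold n))
      n≤ = ℕ.≤-trans (ℕ.m≤n⊔m (threshold m) (threshold n)) (ℕ.m≤n⊔m 1 (threshold m ℕ.⊔ threshold n))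

    C : ℝ
    C = record
      { seq = c
      ; cauchy = λ ε 0<ε → let N , h = ν-limit (ε * ½) (half 0<ε) in N , λ m n N≤m N≤n → begin
          ∣ c m - c n ∣ ≤⟨ c-cauchy m n ⟩
          ν m + ν n ≤⟨ +-mono-≤ (h m N≤m) (h n N≤n) ⟩
          ε * ½ + ε * ½ ≡⟨ halves ε ⟩
          ε ∎ }

    -- At a large x the hypothesis on S and x = o(W) give S x ≥ (1 - 1/4) W x, and the precision 1 /
    -- (n + 1) takes away at most another quarter.
    c-≥½ : ∀ n → 3 ℕ.≤ n → ½ ≤ c n
    c-≥½ n 3≤n = *-cancelʳ-W {x} 1≤x (begin
      ½ * W x
        ≡⟨ solve 1 (λ w → con ½ :* w := w :- con (+ 1 / 4) :* w :- con (+ 1 / 4) :* w) refl (W x) ⟩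
      W x - (+ 1 / 4) * W x - (+ 1 / 4) * W x
        ≤⟨ +-mono-≤ (p≤q+r⇒p-q≤r (≤-trans (S-≥ x) (≤-trans (+-monoʳ-≤ (S x) id≤) (≤-reflexive (+-comm (S x) ((+ 1 / 4) * W x))))))
             (neg-antimono-≤ (*-monoʳ (0≤W x) (≤-trans (ν-anti 3≤n) (≤-reflexive refl)))) ⟩
      S x - ν n * W x ≤⟨ p≤q+r⇒p-q≤r (begin
        S x
          ≡⟨ solve 2 (λ s c → s := s :- c :+ c) refl (S x) (c n * W x) ⟩
        S x - c n * W x + c n * W x
          ≤⟨ +-monoˡ-≤ (c n * W x) (≤-trans (p≤∣p∣ (S x - c n * W x)) (close n x n≤)) ⟩
        ν n * W x + c n * W x ∎) ⟩
      c n * W x ∎)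
      where
      quarter = small-id .below (+ 1 / 4) (positive⁻¹ (+ 1 / 4))
      x = 1 ℕ.⊔ (threshold n ℕ.⊔ proj₁ quarter)
      1≤x = ℕ.m≤m⊔n 1 (threshold n ℕ.⊔ proj₁ quarter)
      n≤ = ℕ.≤-trans (ℕ.m≤m⊔n (threshold n) (proj₁ quarter)) (ℕ.m≤n⊔m 1 (threshold n ℕ.⊔ proj₁ quarter))
      id≤ : fromℕ x ≤ (+ 1 / 4) * W x
      id≤ = proj₂ quarter x (ℕ.≤-trans (ℕ.m≤n⊔m (threshold n) (proj₁ quarter)) (ℕ.m≤n⊔m 1 (threshold n ℕ.⊔ proj₁ quarter)))

    module _ (ε : ℚ) (0<ε : 0ℚ < ε) where

      -- Three errors ε/24 add up to ε/8 ≤ (ε/4) cₙ, because cₙ ≥ ½. In δ the ε/4 bounds the change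
      -- from W to x log x, and the ½ keeps x log x at least W / 2.
      ε/24 δ : ℚ
      ε/24 = ε * (+ 1 / 24)
      δ = (ε * (+ 1 / 4)) ⊓ ½

      0<δ : 0ℚ < δ
      0<δ with ⊓-sel (ε * (+ 1 / 4)) ½
      ... | inj₁ eq = subst (0ℚ <_) (sym eq) (*-pos 0<ε (positive⁻¹ (+ 1 / 4)))
      ... | inj₂ eq = subst (0ℚ <_) (sym eq) (positive⁻¹ ½)

      νj = ν-limit ε/24 (*-pos 0<ε (positive⁻¹ (+ 1 / 24)))
      j = proj₁ νj
      err = small-logError .below δ 0<δ
      X = 2 ℕ.⊔ (threshold j ℕ.⊔ proj₁ err)

      -- cₙ W k is the middle term: its distance from either side is at most (ε/4) cₙ W k, and W k
      -- is at most twice the sampled x log x. The threshold on k involves only the fixed j, whereas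
      -- n may grow with x.
      main : ∀ x 0<x k n → X ℕ.≤ k → 3 ℕ.⊔ j ℕ.≤ n → NearLog x 0<x k n →
             ∣ S k - c n * seq x n * seq (log x 0<x) n ∣ ≤ ε * ∣ c n * seq x n * seq (log x 0<x) n ∣
      main x 0<x k n X≤k le near = subst (λ z → ∣ S k - z ∣ ≤ ε * ∣ z ∣) (sym (*-assoc cₙ (seq x n) (seq (log x 0<x) n))) (begin
        ∣ S k - cₙ * y ∣ ≤⟨ ∣-∣-triangle (S k) (cₙ * w) (cₙ * y) ⟩
        ∣ S k - cₙ * w ∣ + ∣ cₙ * w - cₙ * y ∣ ≤⟨ +-mono-≤ S-close C-close ⟩
        ε * (+ 1 / 4) * cₙ * w + ε * (+ 1 / 4) * cₙ * w
          ≡⟨ solve 3 (λ e c w → e :* con (+ 1 / 4) :* c :* w :+ e :* con (+ 1 / 4) :* c :* w := e :* (c :* (con ½ :* w))) refl ε cₙ w ⟩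
        ε * (cₙ * (½ * w)) ≤⟨ *-monoˡ (<⇒≤ 0<ε) (*-monoˡ 0≤cₙ y-≥) ⟩
        ε * (cₙ * ∣ y ∣)
          ≡⟨ cong (λ z → ε * (z * ∣ y ∣)) (0≤p⇒∣p∣≡p 0≤cₙ) ⟨
        ε * (∣ cₙ ∣ * ∣ y ∣) ≡⟨ cong (ε *_) (∣p*q∣≡∣p∣*∣q∣ cₙ y) ⟨
        ε * ∣ cₙ * y ∣ ∎)
        where
        cₙ = c n
        y = seq x n * seq (log x 0<x) n
        w = W k
        j≤n = ℕ.m⊔n≤o⇒n≤o 3 j le
        ½≤cₙ = c-≥½ n (ℕ.m⊔n≤o⇒m≤o 3 j le)
        0≤cₙ : 0ℚ ≤ cₙ
        0≤cₙ = ≤-trans (nonNegative⁻¹ ½) ½≤cₙ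
        2≤k = ℕ.m⊔n≤o⇒m≤o 2 (threshold j ℕ.⊔ proj₁ err) X≤k
        rest≤k = ℕ.m⊔n≤o⇒n≤o 2 (threshold j ℕ.⊔ proj₁ err) X≤k
        w-y : ∣ w - y ∣ ≤ δ * w
        w-y = ≤-trans (W-near x 0<x k n (ℕ.≤-trans (s≤s z≤n) 2≤k) near) (proj₂ err k (ℕ.m⊔n≤o⇒n≤o (threshold j) (proj₁ err) rest≤k))
        y-≥ : ½ * w ≤ ∣ y ∣
        y-≥ = begin
          ½ * w ≡⟨ solve 1 (λ w → con ½ :* w := w :- con ½ :* w) refl w ⟩
          w - ½ * w ≤⟨ p≤q+r⇒p-q≤r (begin
            w ≡⟨ 0≤p⇒∣p∣≡p (0≤W k) ⟨
            ∣ w ∣ ≤⟨ ∣p∣≤∣q∣+∣p-q∣ w y ⟩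
            ∣ y ∣ + ∣ w - y ∣
              ≤⟨ +-monoʳ-≤ ∣ y ∣ (≤-trans w-y (*-monoʳ (0≤W k) (p⊓q≤q (ε * (+ 1 / 4)) ½))) ⟩
            ∣ y ∣ + ½ * w ≡⟨ +-comm ∣ y ∣ (½ * w) ⟩
            ½ * w + ∣ y ∣ ∎) ⟩
          ∣ y ∣ ∎
        C-close : ∣ cₙ * w - cₙ * y ∣ ≤ ε * (+ 1 / 4) * cₙ * w
        C-close = begin
          ∣ cₙ * w - cₙ * y ∣
            ≡⟨ cong ∣_∣ (solve 3 (λ c w y → c :* w :- c :* y := c :* (w :- y)) refl cₙ w y) ⟩
          ∣ cₙ * (w - y) ∣
            ≡⟨ trans (∣p*q∣≡∣p∣*∣q∣ cₙ (w - y)) (cong (_* ∣ w - y ∣) (0≤p⇒∣p∣≡p 0≤cₙ)) ⟩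
          cₙ * ∣ w - y ∣
            ≤⟨ *-monoˡ 0≤cₙ (≤-trans w-y (*-monoʳ (0≤W k) (p⊓q≤p (ε * (+ 1 / 4)) ½))) ⟩
          cₙ * (ε * (+ 1 / 4) * w)
            ≡⟨ solve 3 (λ e c w → c :* (e :* w) := e :* c :* w) refl (ε * (+ 1 / 4)) cₙ w ⟩
          ε * (+ 1 / 4) * cₙ * w ∎
        S-close : ∣ S k - cₙ * w ∣ ≤ ε * (+ 1 / 4) * cₙ * w
        S-close = begin
          ∣ S k - cₙ * w ∣ ≤⟨ ∣-∣-triangle (S k) (c j * w) (cₙ * w) ⟩
          ∣ S k - c j * w ∣ + ∣ c j * w - cₙ * w ∣
            ≤⟨ +-mono-≤ (close j k (ℕ.m⊔n≤o⇒m≤o (threshold j) (proj₁ err) rest≤k)) (≤-reflexive factor) ⟩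
          ν j * w + ∣ c j - cₙ ∣ * w
            ≤⟨ +-mono-≤ (*-monoʳ (0≤W k) (proj₂ νj j ℕ.≤-refl))
                 (*-monoʳ (0≤W k) (≤-trans (c-cauchy j n) (+-mono-≤ (proj₂ νj j ℕ.≤-refl) (proj₂ νj n j≤n)))) ⟩
          ε/24 * w + (ε/24 + ε/24) * w
            ≡⟨ solve 2 (λ e w → e :* con (+ 1 / 24) :* w :+ (e :* con (+ 1 / 24) :+ e :* con (+ 1 / 24)) :* w := e :* con (+ 1 / 4) :* con ½ :* w) refl ε w ⟩
          ε * (+ 1 / 4) * ½ * w
            ≤⟨ *-monoʳ (0≤W k) (*-monoˡ (*-nonNeg (<⇒≤ 0<ε) (nonNegative⁻¹ (+ 1 / 4))) ½≤cₙ) ⟩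
          ε * (+ 1 / 4) * cₙ * w ∎
          where
          factor : ∣ c j * w - cₙ * w ∣ ≡ ∣ c j - cₙ ∣ * w
          factor = trans (cong ∣_∣ (solve 3 (λ a b w → a :* w :- b :* w := (a :- b) :* w) refl (c j) cₙ w))
            (trans (∣p*q∣≡∣p∣*∣q∣ (c j - cₙ) w) (cong (∣ c j - cₙ ∣ *_) (0≤p⇒∣p∣≡p (0≤W k))))

    asymptotic : ∃ λ (C : ℝ) → ∀ (ε : ℚ) → 0ℚ < ε → ∃ λ (X : ℝ) →
      ∀ (x : ℝ) (0<x : 0ℝ <ʳ x) (k : ℕ) → X ≤ʳ x → IsFloor x k →
      ∣ fromℚ (S k) -ʳ C *ʳ x *ʳ log x 0<x ∣ʳ ≤ʳ fromℚ ε *ʳ ∣ C *ʳ x *ʳ log x 0<x ∣ʳ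
    asymptotic = C , λ ε 0<ε → fromℚ (fromℕ (suc (X ε 0<ε))) , λ x 0<x k X≤x floor ε′ 0<ε′ →
      let X≤k = floor-≥ x k (X ε 0<ε) floor X≤x
          N , near = nearLog x 0<x k (ℕ.≤-trans (ℕ.m≤m⊔n 2 (threshold (j ε 0<ε) ℕ.⊔ proj₁ (err ε 0<ε))) X≤k) floor
          M = 3 ℕ.⊔ j ε 0<ε
      in N ℕ.⊔ M , λ n le →
        ≤-trans (main ε 0<ε x 0<x k n X≤k (ℕ.m⊔n≤o⇒n≤o N M le) (near n (ℕ.m⊔n≤o⇒m≤o N M le)))
          (p≤p+q (ε * ∣ c n * seq x n * seq (log x 0<x) n ∣) (<⇒≤ 0<ε′))

-- Application to A.

module Summatory where

  open Arithmetic
  open Counting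
  open Approximation
  open DivisorSums
  open GrowthBounds
  open SieveSums
  open FinalEstimate
  open import Defs using (A; ℝ; 0ℝ; _<ʳ_; _≤ʳ_; IsFloor; fromℚ; _-ʳ_; _*ʳ_; log; ∣_∣ʳ; partialSum; fromℕ; fromℕ-+; fromℕ-*; 0≤fromℕ; fromℕ-mono-≤; *-nonNeg; ∣p∣≤∣q∣+∣p-q∣; ∣p-q∣-sym)
  open import Data.List.Base using ([]; _∷_; map; upTo; _∷ʳ_)
  open import Data.List.Properties using (map-++; upTo-∷ʳ)
  open import Data.Nat.Base as ℕ using (ℕ; zero; suc; z≤n; s≤s; _^_)
  open import Data.Nat.Coprimality using (Coprime)
  open import Data.Nat.DivMod renaming (_/_ to _/ℕ_) using ()
  open import Data.Nat.Divisibility using (∣1⇒≡1)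
  open import Data.Nat.ListAction using (sum)
  open import Data.Nat.ListAction.Properties using (sum-++)
  open import Data.Nat.Primality using (Prime; prime[2]; ¬prime[1])
  import Data.Nat.Properties as ℕ
  open import Data.Product using (∃)
  open import Data.Rational.Base hiding (NonZero)
  open import Data.Rational.Properties
  open import Data.Rational.Solver using (module +-*-Solver)
  open import Relation.Binary.PropositionalEquality using (_≡_; refl; sym; trans; cong; cong₂; subst)
  open +-*-Solver using (solve; _:=_; _:+_; _:*_; _:-_; con)

  -- Abstract, so that the enumeration of groups behind A is never unfolded.
  abstract
    a : ℕ → ℚ
    a n = fromℕ (A n)

    -- Squeezed between two bounds: 1 = 2^0 is a prime power, and 1 is a divisor of 1.
    A-1 : A 1 ≡ 1
    A-1 = ℕ.≤-antisym (A-^-≤ prime[2] 0) (length-divisors-≤-A 0)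

    a-1 : a 1 ≡ 1ℚ
    a-1 = cong fromℕ A-1

    d≤a : ∀ {n} → 0 ℕ.< n → d n ≤ a n
    d≤a {suc n} _ = d≤A n

    a-prime-≤ : ∀ {p} → Prime p → a (p ^ 1) ≤ fromℕ 2
    a-prime-≤ {p} pp = fromℕ-mono-≤ {A (p ^ 1)} {2} (A-^-≤ pp 1)

    a-multiplicative : ∀ {m n} → 0 ℕ.< m → 0 ℕ.< n → Coprime m n → a (m ℕ.* n) ≡ a m * a n
    a-multiplicative {m} {n} 0<m 0<n m⊥n = trans (cong fromℕ (A-* {m} {n} 0<m 0<n m⊥n)) (fromℕ-* (A m) (A n))

    a-growth : ∀ {p} → Prime p → ∀ k → a (p ^ k) ≤ growthConstant * pow θ k
    a-growth = A-growth

    0≤a : ∀ n → 0ℚ ≤ a n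
    0≤a n = 0≤fromℕ (A n)

    a≡ : ∀ n → a n ≡ fromℕ (A n)
    a≡ n = refl

  a-prime-≥ : ∀ {p} → Prime p → fromℕ 2 ≤ a (p ^ 1)
  a-prime-≥ {p} pp = ≤-trans (≤-reflexive (sym d≡2)) (d≤a {p ^ 1} (ℕ.≤-trans (s≤s z≤n) (n<m^n (2≤prime pp) 1)))
    where
    d≡2 : d (p ^ 1) ≡ fromℕ 2
    d≡2 = trans (cong d (sym (ℕ.*-identityʳ (p ^ 1))))
      (trans (d-^-* pp (λ p∣1 → ¬prime[1] (subst Prime (∣1⇒≡1 p∣1) pp)) (s≤s z≤n) 1) (*-identityʳ (fromℕ 2)))

  a-prime : ∀ {p} → Prime p → a (p ^ 1) ≡ fromℕ 2
  a-prime pp = ≤-antisym (a-prime-≤ pp) (a-prime-≥ pp)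

  approximable-A : Approximable (partial a)
  approximable-A = SieveGrowth.approximable-a a (fromℕ 4 * growthConstant) (*-nonNeg (0≤fromℕ 4) 0≤growthConstant)
    (λ {p} pp → secondDifference-growth {λ k → a (p ^ k)} 0≤growthConstant (λ k → 0≤a (p ^ k)) (a-growth pp))
    (λ _ → a-1)
    (λ pp → trans (cong₂ (λ s t → s - fromℕ 2 * t) (a-prime pp) a-1) refl)
    a-1 a-multiplicative

  fromℕ-partialSum : ∀ f k → fromℕ (partialSum f k) ≡ partial (λ n → fromℕ (f n)) k
  fromℕ-partialSum f zero    = refl
  fromℕ-partialSum f (suc k) = begin
    fromℕ (sum (map g (upTo (suc k))))
      ≡⟨ cong (λ xs → fromℕ (sum (map g xs))) (upTo-∷ʳ k) ⟨
    fromℕ (sum (map g (upTo k ∷ʳ k)))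
      ≡⟨ cong (λ xs → fromℕ (sum xs)) (map-++ g (upTo k) (k ∷ [])) ⟩
    fromℕ (sum (map g (upTo k) ∷ʳ g k))
      ≡⟨ cong fromℕ (sum-++ (map g (upTo k)) (g k ∷ [])) ⟩
    fromℕ (partialSum f k ℕ.+ (g k ℕ.+ 0))
      ≡⟨ cong (λ n → fromℕ (partialSum f k ℕ.+ n)) (ℕ.+-identityʳ (g k)) ⟩
    fromℕ (partialSum f k ℕ.+ g k) ≡⟨ fromℕ-+ (partialSum f k) (g k) ⟩
    fromℕ (partialSum f k) + fromℕ (g k)
      ≡⟨ cong (_+ fromℕ (g k)) (fromℕ-partialSum f k) ⟩
    partial (λ n → fromℕ (f n)) (suc k) ∎
    where
    open Relation.Binary.PropositionalEquality.≡-Reasoning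
    g = λ i → f (suc i)

  -- d ≤ A termwise, and the sum of d is within x of W x.
  W≤partial-a : ∀ x → W x ≤ partial a x + fromℕ x
  W≤partial-a x = begin
    W x ≡⟨ *-identityˡ (W x) ⟨
    1ℚ * W x ≤⟨ p≤∣p∣ (1ℚ * W x) ⟩
    ∣ 1ℚ * W x ∣ ≤⟨ ∣p∣≤∣q∣+∣p-q∣ (1ℚ * W x) (partial d x) ⟩
    ∣ partial d x ∣ + ∣ 1ℚ * W x - partial d x ∣
      ≡⟨ cong₂ _+_ (0≤p⇒∣p∣≡p 0≤D) (∣p-q∣-sym (1ℚ * W x) (partial d x)) ⟩
    partial d x + ∣ partial d x - 1ℚ * W x ∣
      ≤⟨ +-mono-≤ (∑-mono x (λ i _ → d≤a {suc i} (s≤s z≤n))) (partial-d-W x) ⟩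
    partial a x + fromℕ x ∎
    where
    open ≤-Reasoning
    0≤D : 0ℚ ≤ partial d x
    0≤D = subst (0ℚ ≤_) (sym (partial-d x)) (0≤∑ x (λ i _ → 0≤fromℕ (x /ℕ suc i)))

  partial-a : ∀ k → partial a k ≡ fromℕ (partialSum A k)
  partial-a k = trans (∑-cong k (λ i _ → a≡ (suc i))) (sym (fromℕ-partialSum A k))

  W≤partial-S : ∀ x → W x ≤ fromℕ (partialSum A x) + fromℕ x
  W≤partial-S x = subst (λ s → W x ≤ s + fromℕ x) (partial-a x) (W≤partial-a x)

open import Defs
open import Data.Nat.Base using (ℕ)
open import Data.Product using (∃)
open import Data.Rational.Base using (ℚ; 0ℚ; _<_)
open Approximation using (approximable-cong)
open FinalEstimate using (module Asymptotic)
open Summatory using (approximable-A; partial-a; W≤partial-S)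

corollary4 : ∃ λ (C : ℝ) → ∀ (ε : ℚ) → 0ℚ < ε → ∃ λ (X : ℝ) →
    ∀ (x : ℝ) (0<x : 0ℝ <ʳ x) (k : ℕ) → X ≤ʳ x → IsFloor x k →
    ∣ fromℚ (fromℕ (partialSum A k)) -ʳ C *ʳ x *ʳ log x 0<x ∣ʳ
    ≤ʳ fromℚ ε *ʳ ∣ C *ʳ x *ʳ log x 0<x ∣ʳ
corollary4 = Asymptotic.asymptotic (approximable-cong partial-a approximable-A) W≤partial-S
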